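{- Let $S=\operatorname{PSL}(2,q)$ with $q=p^n\geq 5$, where $p$ is a prime and $n\geq 1$ is an integer, and let $G$ be an almost simple group with socle $S$, so that $S\leq G\leq\operatorname{Aut}(S)$. Then $\mathcal{E}^{**}(G)$ is claw-free if and only if $S\leq G\leq\operatorname{PGL}(2,q)$.
   Context: For a finite group $G$, the enhanced power graph $\mathcal{E}(G)$ is the graph with vertex set $G$ in which two distinct vertices $u,v$ are adjacent if and only if $\langle u,v\rangle$ is cyclic. A vertex is dominating if it is adjacent to all other vertices. The proper enhanced power graph $\mathcal{E}^{**}(G)$ is the subgraph of $\mathcal{E}(G)$ induced on the non-dominating vertices. A graph is claw-free if it has no induced subgraph isomorphic to $K_{1,3}$. Here $\operatorname{Aut}(S)=\operatorname{P\Gamma L}(2,q)=\operatorname{PGL}(2,q)\rtimes\langle\varphi\rangle$, with $\varphi$ the standard field automorphism of order $n$, and $S$ and $\operatorname{PGL}(2,q)$ are regarded as subgroups of $\operatorname{Aut}(S)$. -}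

module Defs where

open import Level using (Level; _⊔_; suc; 0ℓ)
open import Algebra.Bundles using (Group; CommutativeRing)
open import Algebra.Morphism.Structures using (module RingMorphisms)
import Algebra.Morphism.Construct.Identity as Identity
import Algebra.Morphism.Construct.Composition as Composition
import Algebra.Properties.Group as GroupProperties
import Algebra.Properties.Ring as RingProperties
import Algebra.Properties.CommutativeSemiring.Binomial as Binomial
import Algebra.Properties.CommutativeMonoid.Sum as Sum
import Algebra.Properties.CommutativeSemiring.Exp as Exp
import Algebra.Properties.Semiring.Mult as Mult
import Algebra.Solver.Ring.NaturalCoefficients.Default as Solver
open import Data.Empty using (⊥; ⊥-elim)
open import Data.Fin.Base as Fin using (Fin; toℕ; fromℕ; inject₁; punchOut)
import Data.Fin.Properties as Fin
open import Data.Fin.Permutation using (Permutation′; permutation)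
open import Data.Nat.Base as ℕ using (ℕ)
import Data.Nat.Properties as ℕ
open import Data.Nat.Combinatorics using (_C_; nCn≡1; nCk≡n!/k![n-k]!; k![n∸k]!∣n!)
open import Data.Nat.Divisibility
  using (_∣_; divides; m∣m*n; ∣⇒≤)
open import Data.Nat.DivMod using (m/n*n≡m)
open import Data.Nat.Primality using (Prime; euclidsLemma; prime⇒nonTrivial; prime⇒nonZero)
open import Data.Product.Base using (Σ; ∃; _×_; _,_; proj₁; proj₂)
open import Data.Sum.Base as Sum⊎ using (_⊎_; inj₁; inj₂)
open import Data.Unit.Base using (⊤; tt)
open import Function.Base using (_∘_; id)
open import Function.Bundles using (Inverse; _⇔_)
open import Function.Definitions using (Injective)
open import Relation.Binary.Bundles using (Setoid)
open import Relation.Binary.Core using (Rel)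
open import Relation.Binary.Definitions using (Symmetric; Decidable; _Respects₂_)
import Relation.Binary.Construct.On as On
open import Relation.Binary.PropositionalEquality as ≡ using (_≡_; _≢_)
import Relation.Binary.Reasoning.Setoid as SetoidReasoning
open import Relation.Nullary using (¬_; yes; no)
open import Relation.Nullary.Decidable using (map′)
open import Relation.Unary using (Pred; _∈_; _⊆_; _≐_)

private
  variable
    a b c e ℓ ℓ₁ ℓ₂ s t : Level

record Graph a ℓ e : Set (suc (a ⊔ ℓ ⊔ e)) where
  infix 4 _~_
  field
    vertices : Setoid a ℓ
  open Setoid vertices public using () renaming (Carrier to Vertex; _≈_ to _≈ᵥ_)
  field
    _~_      : Rel Vertex e
    ~-resp-≈ : _~_ Respects₂ _≈ᵥ_
    ~-sym    : Symmetric _~_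
    ~-irrefl : ∀ {x y} → x ≈ᵥ y → ¬ (x ~ y)

infix 4 _≅_

record _≅_ (Γ : Graph a ℓ₁ s) (Δ : Graph b ℓ₂ t) : Set (a ⊔ b ⊔ ℓ₁ ⊔ ℓ₂ ⊔ s ⊔ t) where
  private
    module Γ = Graph Γ
    module Δ = Graph Δ
  field
    bijection : Inverse Γ.vertices Δ.vertices
  open Inverse bijection public using (to; from)
  field
    adjacency : ∀ x y → (x Γ.~ y) ⇔ (to x Δ.~ to y)

induced : (Γ : Graph a ℓ e) → Pred (Graph.Vertex Γ) s → Graph (a ⊔ s) ℓ e
induced Γ P = record
  { vertices = On.setoid {B = Σ Vertex P} vertices proj₁
  ; _~_      = λ x y → proj₁ x ~ proj₁ y
  ; ~-resp-≈ = proj₁ ~-resp-≈ , proj₂ ~-resp-≈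
  ; ~-sym    = ~-sym
  ; ~-irrefl = ~-irrefl
  }
  where open Graph Γ

-- The complete bipartite graph K_{m,n}.
K : ℕ → ℕ → Graph 0ℓ 0ℓ 0ℓ
K m n = record
  { vertices = ≡.setoid (Fin m ⊎ Fin n)
  ; _~_      = Adj
  ; ~-resp-≈ = (λ { ≡.refl p → p }) , (λ { ≡.refl p → p })
  ; ~-sym    = λ {x} {y} → Adj-sym x y
  ; ~-irrefl = λ { {inj₁ _} ≡.refl () ; {inj₂ _} ≡.refl () }
  }
  where
  Adj : Rel (Fin m ⊎ Fin n) 0ℓ
  Adj (inj₁ _) (inj₁ _) = ⊥
  Adj (inj₁ _) (inj₂ _) = ⊤
  Adj (inj₂ _) (inj₁ _) = ⊤
  Adj (inj₂ _) (inj₂ _) = ⊥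

  Adj-sym : ∀ x y → Adj x y → Adj y x
  Adj-sym (inj₁ _) (inj₂ _) _ = tt
  Adj-sym (inj₂ _) (inj₁ _) _ = tt

-- The level of the vertex sets P is that of the vertex equality, which is
-- exactly what the image { x | ∃ k , f k ≈ x } of a map from Fin 1 ⊎ Fin 3
-- needs; no claw is missed by this choice.
ClawFree : Graph a ℓ e → Set (a ⊔ suc ℓ ⊔ e)
ClawFree {ℓ = ℓ} Γ = ∀ (P : Pred (Graph.Vertex Γ) ℓ) → ¬ (K 1 3 ≅ induced Γ P)

module _ (G : Group a ℓ) where
  open Group G

  data Generated (X : Pred Carrier s) : Pred Carrier (a ⊔ ℓ ⊔ s) where
    gen    : ∀ {x} → x ∈ X → x ∈ Generated X
    gen-≈  : ∀ {x y} → x ≈ y → x ∈ Generated X → y ∈ Generated X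
    gen-ε  : ε ∈ Generated X
    gen-∙  : ∀ {x y} → x ∈ Generated X → y ∈ Generated X → x ∙ y ∈ Generated X
    gen-⁻¹ : ∀ {x} → x ∈ Generated X → x ⁻¹ ∈ Generated X

  record Subgroup s : Set (a ⊔ ℓ ⊔ suc s) where
    field
      Member : Pred Carrier s
      resp   : ∀ {x y} → x ≈ y → x ∈ Member → y ∈ Member
      ε-∈    : ε ∈ Member
      ∙-∈    : ∀ {x y} → x ∈ Member → y ∈ Member → x ∙ y ∈ Member
      ⁻¹-∈   : ∀ {x} → x ∈ Member → x ⁻¹ ∈ Member

  generated : Pred Carrier s → Subgroup (a ⊔ ℓ ⊔ s)
  generated X = record
    { Member = Generated X ; resp = gen-≈ ; ε-∈ = gen-ε ; ∙-∈ = gen-∙ ; ⁻¹-∈ = gen-⁻¹ }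

  cyclic : Carrier → Subgroup (a ⊔ ℓ)
  cyclic x = generated (_≈ x)

  ⟨_,_⟩ : Carrier → Carrier → Subgroup (a ⊔ ℓ)
  ⟨ x , y ⟩ = generated (λ z → z ≈ x ⊎ z ≈ y)

  IsCyclic : Subgroup s → Set (a ⊔ ℓ ⊔ s)
  IsCyclic H = ∃ λ g → Subgroup.Member H ≐ Subgroup.Member (cyclic g)

  private
    Generated-mono : {X : Pred Carrier s} {Y : Pred Carrier t} →
                     X ⊆ Y → Generated X ⊆ Generated Y
    Generated-mono X⊆Y (gen x∈X)    = gen (X⊆Y x∈X)
    Generated-mono X⊆Y (gen-≈ eq p) = gen-≈ eq (Generated-mono X⊆Y p)
    Generated-mono X⊆Y gen-ε        = gen-ε
    Generated-mono X⊆Y (gen-∙ p q)  = gen-∙ (Generated-mono X⊆Y p) (Generated-mono X⊆Y q)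
    Generated-mono X⊆Y (gen-⁻¹ p)   = gen-⁻¹ (Generated-mono X⊆Y p)

    IsCyclic-resp : {X : Pred Carrier s} {Y : Pred Carrier t} → X ⊆ Y → Y ⊆ X →
                    IsCyclic (generated X) → IsCyclic (generated Y)
    IsCyclic-resp X⊆Y Y⊆X (g , to , from) =
      g , (λ p → to (Generated-mono Y⊆X p)) , (λ p → Generated-mono X⊆Y (from p))

    pair-cong : ∀ {x x′ y y′ z} → x ≈ x′ → y ≈ y′ → z ≈ x ⊎ z ≈ y → z ≈ x′ ⊎ z ≈ y′
    pair-cong p q = Sum⊎.map (λ r → trans r p) (λ r → trans r q)

  enhancedPowerGraph : Graph a ℓ (a ⊔ ℓ)
  enhancedPowerGraph = record
    { vertices = setoid
    ; _~_      = λ u v → (¬ u ≈ v) × IsCyclic ⟨ u , v ⟩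
    ; ~-resp-≈ =
        (λ y≈z (u≉y , cyc) → (λ eq → u≉y (trans eq (sym y≈z))) ,
           IsCyclic-resp (pair-cong refl y≈z) (pair-cong refl (sym y≈z)) cyc)
      , (λ y≈z (y≉u , cyc) → (λ eq → y≉u (trans y≈z eq)) ,
           IsCyclic-resp (pair-cong y≈z refl) (pair-cong (sym y≈z) refl) cyc)
    ; ~-sym    = λ (u≉v , cyc) → (λ eq → u≉v (sym eq)) , IsCyclic-resp Sum⊎.swap Sum⊎.swap cyc
    ; ~-irrefl = λ eq (u≉v , _) → u≉v eq
    }

module _ (Γ : Graph a ℓ e) where
  open Graph Γ

  IsDominating : Pred Vertex (a ⊔ ℓ ⊔ e)
  IsDominating u = ∀ v → ¬ (v ≈ᵥ u) → u ~ v

properEnhancedPowerGraph : Group a ℓ → Graph (a ⊔ ℓ) ℓ (a ⊔ ℓ)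
properEnhancedPowerGraph G = induced (enhancedPowerGraph G) (λ u → ¬ IsDominating (enhancedPowerGraph G) u)

whole : (G : Group a ℓ) → Subgroup G 0ℓ
whole G = record
  { Member = λ _ → ⊤ ; resp = λ _ _ → tt ; ε-∈ = tt ; ∙-∈ = λ _ _ → tt ; ⁻¹-∈ = λ _ → tt }

infix 4 _≤_

_≤_ : {G : Group a ℓ} → Subgroup G s → Subgroup G t → Set (a ⊔ s ⊔ t)
H ≤ K = Subgroup.Member H ⊆ Subgroup.Member K

subgroupGroup : (G : Group a ℓ) → Subgroup G s → Group (a ⊔ s) ℓ
subgroupGroup G H = record
  { Carrier = Σ Carrier Member
  ; _≈_     = λ x y → proj₁ x ≈ proj₁ y
  ; _∙_     = λ (x , p) (y , q) → x ∙ y , ∙-∈ p q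
  ; ε       = ε , ε-∈
  ; _⁻¹     = λ (x , p) → x ⁻¹ , ⁻¹-∈ p
  ; isGroup = record
    { isMonoid = record
      { isSemigroup = record
        { isMagma = record
          { isEquivalence = Setoid.isEquivalence (On.setoid {B = Σ Carrier Member} setoid proj₁)
          ; ∙-cong = ∙-cong
          }
        ; assoc = λ (x , _) (y , _) (z , _) → assoc x y z
        }
      ; identity = (λ (x , _) → identityˡ x) , (λ (x , _) → identityʳ x)
      }
    ; inverse = (λ (x , _) → inverseˡ x) , (λ (x , _) → inverseʳ x)
    ; ⁻¹-cong = ⁻¹-cong
    }
  }
  where
  open Group G
  open Subgroup H

-- A (left) action of H on N by automorphisms.
record GroupAction (H : Group b ℓ₂) (N : Group a ℓ₁) : Set (a ⊔ b ⊔ ℓ₁ ⊔ ℓ₂) where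
  private
    module H = Group H
    module N = Group N
  infixr 7 _▷_
  field
    _▷_    : H.Carrier → N.Carrier → N.Carrier
    ▷-cong : ∀ {h h′ n n′} → h H.≈ h′ → n N.≈ n′ → (h ▷ n) N.≈ (h′ ▷ n′)
    ▷-homo : ∀ h m n → (h ▷ (m N.∙ n)) N.≈ ((h ▷ m) N.∙ (h ▷ n))
    ε-▷    : ∀ n → (H.ε ▷ n) N.≈ n
    ∙-▷    : ∀ h k n → ((h H.∙ k) ▷ n) N.≈ (h ▷ (k ▷ n))

semidirectProduct : (N : Group a ℓ₁) (H : Group b ℓ₂) → GroupAction H N → Group (a ⊔ b) (ℓ₁ ⊔ ℓ₂)
semidirectProduct N H α = record
  { Carrier = N.Carrier × H.Carrier
  ; _≈_     = λ (m , h) (n , k) → (m N.≈ n) × (h H.≈ k)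
  ; _∙_     = λ (m , h) (n , k) → (m N.∙ (h ▷ n)) , (h H.∙ k)
  ; ε       = N.ε , H.ε
  ; _⁻¹     = λ (m , h) → (h H.⁻¹ ▷ (m N.⁻¹)) , h H.⁻¹
  ; isGroup = record
    { isMonoid = record
      { isSemigroup = record
        { isMagma = record
          { isEquivalence = record
            { refl  = N.refl , H.refl
            ; sym   = λ (p , q) → N.sym p , H.sym q
            ; trans = λ (p , q) (p′ , q′) → N.trans p p′ , H.trans q q′
            }
          ; ∙-cong = λ (p , q) (p′ , q′) → N.∙-cong p (▷-cong q p′) , H.∙-cong q q′
          }
        ; assoc = λ (m , h) (n , k) (o , l) →
            N.trans (N.assoc m (h ▷ n) ((h H.∙ k) ▷ o))
              (N.∙-congˡ (N.trans (N.∙-congˡ (∙-▷ h k o)) (N.sym (▷-homo h n (k ▷ o)))))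
          , H.assoc h k l
        }
      ; identity =
          (λ (m , h) → N.trans (N.identityˡ (H.ε ▷ m)) (ε-▷ m) , H.identityˡ h)
        , (λ (m , h) → N.trans (N.∙-congˡ (▷-ε h)) (N.identityʳ m) , H.identityʳ h)
      }
    ; inverse =
        (λ (m , h) → N.trans (N.sym (▷-homo (h H.⁻¹) (m N.⁻¹) m))
                       (N.trans (▷-cong H.refl (N.inverseˡ m)) (▷-ε (h H.⁻¹)))
                   , H.inverseˡ h)
      , (λ (m , h) → N.trans (N.∙-congˡ (N.trans (N.sym (∙-▷ h (h H.⁻¹) (m N.⁻¹)))
                       (N.trans (▷-cong (H.inverseʳ h) N.refl) (ε-▷ (m N.⁻¹)))))
                       (N.inverseʳ m)
                   , H.inverseʳ h)
    ; ⁻¹-cong = λ (p , q) → ▷-cong (H.⁻¹-cong q) (N.⁻¹-cong p) , H.⁻¹-cong q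
    }
  }
  where
  module N = Group N
  module H = Group H
  open GroupAction α

  ▷-ε : ∀ h → (h ▷ N.ε) N.≈ N.ε
  ▷-ε h = GroupProperties.identityˡ-unique N (h ▷ N.ε) (h ▷ N.ε)
    (N.trans (N.sym (▷-homo h N.ε N.ε)) (▷-cong H.refl (N.identityˡ N.ε)))

-- A subgroup of N, regarded as a subgroup of N ⋊ H.
normalFactor : (N : Group a ℓ₁) (H : Group b ℓ₂) (α : GroupAction H N) →
               Subgroup N s → Subgroup (semidirectProduct N H α) (ℓ₂ ⊔ s)
normalFactor N H α M = record
  { Member = λ (m , h) → m ∈ Member × h H.≈ H.ε
  ; resp   = λ (p , q) (m∈ , h≈ε) → resp p m∈ , H.trans (H.sym q) h≈ε
  ; ε-∈    = ε-∈ , H.refl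
  ; ∙-∈    = λ (m∈ , h≈ε) (n∈ , k≈ε) →
      ∙-∈ m∈ (resp (N.sym (trivial h≈ε)) n∈) ,
      H.trans (H.∙-cong h≈ε k≈ε) (H.identityˡ H.ε)
  ; ⁻¹-∈   = λ (m∈ , h≈ε) →
      resp (N.sym (trivial (inverse≈ε h≈ε))) (⁻¹-∈ m∈) , inverse≈ε h≈ε
  }
  where
  module N = Group N
  module H = Group H
  open GroupAction α
  open Subgroup M

  trivial : ∀ {h n} → h H.≈ H.ε → (h ▷ n) N.≈ n
  trivial {n = n} h≈ε = N.trans (▷-cong h≈ε N.refl) (ε-▷ n)

  inverse≈ε : ∀ {h} → h H.≈ H.ε → (h H.⁻¹) H.≈ H.ε
  inverse≈ε h≈ε = H.trans (H.⁻¹-cong h≈ε) (GroupProperties.ε⁻¹≈ε H)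

record FiniteField c ℓ (q : ℕ) : Set (suc (c ⊔ ℓ)) where
  field
    commutativeRing : CommutativeRing c ℓ
  open CommutativeRing commutativeRing public
  field
    1≉0         : ¬ (1# ≈ 0#)
    invertible  : ∀ x → ¬ (x ≈ 0#) → ∃ λ y → x * y ≈ 1#
    enumeration : Inverse setoid (≡.setoid (Fin q))

module _ (R : CommutativeRing c ℓ) where
  open CommutativeRing R

  record RingAutomorphism : Set (c ⊔ ℓ) where
    open RingMorphisms rawRing rawRing using (IsRingIsomorphism)
    field
      ⟦_⟧               : Carrier → Carrier
      isRingIsomorphism : IsRingIsomorphism ⟦_⟧
    open IsRingIsomorphism isRingIsomorphism public

  automorphismGroup : Group (c ⊔ ℓ) (c ⊔ ℓ)
  automorphismGroup = record
    { Carrier = RingAutomorphism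
    ; _≈_     = λ σ τ → ∀ x → ⟦ σ ⟧ x ≈ ⟦ τ ⟧ x
    ; _∙_     = λ σ τ → record
      { ⟦_⟧ = ⟦ σ ⟧ ∘ ⟦ τ ⟧
      ; isRingIsomorphism = Composition.isRingIsomorphism trans
          (isRingIsomorphism τ) (isRingIsomorphism σ)
      }
    ; ε       = record { ⟦_⟧ = id ; isRingIsomorphism = Identity.isRingIsomorphism rawRing refl }
    ; _⁻¹     = inverse
    ; isGroup = record
      { isMonoid = record
        { isSemigroup = record
          { isMagma = record
            { isEquivalence = record
              { refl  = λ _ → refl
              ; sym   = λ p x → sym (p x)
              ; trans = λ p q x → trans (p x) (q x)
              }
            ; ∙-cong = λ {σ} {_} {_} {ω} p q x → trans (⟦⟧-cong σ (q x)) (p (⟦ ω ⟧ x))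
            }
          ; assoc = λ _ _ _ _ → refl
          }
        ; identity = (λ _ _ → refl) , (λ _ _ → refl)
        }
      ; inverse = inverseˡ , inverseʳ
      ; ⁻¹-cong = λ {σ} {τ} p x → injective τ
          (trans (sym (p _)) (trans (inverseʳ σ x) (sym (inverseʳ τ x))))
      }
    }
    where
    open RingAutomorphism

    inv : RingAutomorphism → Carrier → Carrier
    inv σ y = proj₁ (surjective σ y)

    inverseʳ : ∀ σ y → ⟦ σ ⟧ (inv σ y) ≈ y
    inverseʳ σ y = proj₂ (surjective σ y) refl

    inverseˡ : ∀ σ x → inv σ (⟦ σ ⟧ x) ≈ x
    inverseˡ σ x = injective σ (inverseʳ σ (⟦ σ ⟧ x))

    inverse : RingAutomorphism → RingAutomorphism
    inverse σ = record
      { ⟦_⟧ = inv σ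
      ; isRingIsomorphism = record
        { isRingMonomorphism = record
          { isRingHomomorphism = record
            { isSemiringHomomorphism = record
              { isNearSemiringHomomorphism = record
                { +-isMonoidHomomorphism = record
                  { isMagmaHomomorphism = record
                    { isRelHomomorphism = record { cong = inv-cong }
                    ; homo = λ x y → injective σ (trans (inverseʳ σ (x + y))
                        (sym (trans (+-homo σ _ _) (+-cong (inverseʳ σ x) (inverseʳ σ y)))))
                    }
                  ; ε-homo = injective σ (trans (inverseʳ σ 0#) (sym (0#-homo σ)))
                  }
                ; *-homo = λ x y → injective σ (trans (inverseʳ σ (x * y))
                    (sym (trans (*-homo σ _ _) (*-cong (inverseʳ σ x) (inverseʳ σ y)))))
                }
              ; 1#-homo = injective σ (trans (inverseʳ σ 1#) (sym (1#-homo σ)))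
              }
            ; -‿homo = λ x → injective σ (trans (inverseʳ σ (- x))
                (sym (trans (-‿homo σ _) (-‿cong (inverseʳ σ x)))))
            }
          ; injective = λ {x} {y} p →
              trans (sym (inverseʳ σ x)) (trans (⟦⟧-cong σ p) (inverseʳ σ y))
          }
        ; surjective = λ y → ⟦ σ ⟧ y , λ {z} p → trans (inv-cong p) (inverseˡ σ y)
        }
      }
      where
      inv-cong : ∀ {x y} → x ≈ y → inv σ x ≈ inv σ y
      inv-cong {x} {y} p = injective σ (trans (inverseʳ σ x) (trans p (sym (inverseʳ σ y))))

private
  prime∤! : ∀ {p} → Prime p → ∀ k → k ℕ.< p → ¬ (p ∣ k ℕ.!)
  prime∤! pr ℕ.zero    _   p∣1 =
    ℕ.<⇒≱ (ℕ.nonTrivial⇒n>1 _ {{prime⇒nonTrivial pr}}) (∣⇒≤ p∣1)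
  prime∤! pr (ℕ.suc k) k<p p∣ with euclidsLemma (ℕ.suc k) (k ℕ.!) pr p∣
  ... | inj₁ p∣k  = ℕ.<⇒≱ k<p (∣⇒≤ p∣k)
  ... | inj₂ p∣k! = prime∤! pr k (ℕ.<-trans (ℕ.n<1+n k) k<p) p∣k!

  prime∣C : ∀ {p} → Prime p → ∀ k → 0 ℕ.< k → k ℕ.< p → p ∣ p C k
  prime∣C {p@(ℕ.suc p′)} pr k 0<k k<p
    with euclidsLemma (p C k) (k ℕ.! ℕ.* (p ℕ.∸ k) ℕ.!) pr
           (≡.subst (p ∣_) (≡.sym C*) (m∣m*n (p′ ℕ.!)))
    where
    instance _ = k ℕ.!* (p ℕ.∸ k) !≢0
    C* : (p C k) ℕ.* (k ℕ.! ℕ.* (p ℕ.∸ k) ℕ.!) ≡ p ℕ.!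
    C* = ≡.trans (≡.cong (ℕ._* (k ℕ.! ℕ.* (p ℕ.∸ k) ℕ.!)) (nCk≡n!/k![n-k]! (ℕ.<⇒≤ k<p)))
                 (m/n*n≡m (k![n∸k]!∣n! (ℕ.<⇒≤ k<p)))
  ... | inj₁ p∣C = p∣C
  ... | inj₂ p∣! with euclidsLemma (k ℕ.!) ((p ℕ.∸ k) ℕ.!) pr p∣!
  ...   | inj₁ p∣k! = ⊥-elim (prime∤! pr k k<p p∣k!)
  ...   | inj₂ p∣   = ⊥-elim (prime∤! pr (p ℕ.∸ k) (ℕ.∸-monoʳ-< 0<k (ℕ.<⇒≤ k<p)) p∣)

  Fin-injective⇒surjective : ∀ {n} (f : Fin n → Fin n) → Injective _≡_ _≡_ f →
                             ∀ y → ∃ λ x → f x ≡ y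
  Fin-injective⇒surjective {ℕ.suc n} f inj y with Fin.any? (λ x → f x Fin.≟ y)
  ... | yes hit = hit
  ... | no miss = ⊥-elim (ℕ.<-irrefl ≡.refl (Fin.injective⇒≤ {f = g} g-inj))
    where
    y≢f : ∀ x → y ≢ f x
    y≢f x eq = miss (x , ≡.sym eq)
    g : Fin (ℕ.suc n) → Fin n
    g x = punchOut (y≢f x)
    g-inj : Injective _≡_ _≡_ g
    g-inj {x} {x′} eq = inj (Fin.punchOut-injective (y≢f x) (y≢f x′) eq)

-- That F has characteristic p is derived from its having p ^ n elements.
module Frobenius {p : ℕ} (n : ℕ) (pr : Prime p) (F : FiniteField c ℓ (p ℕ.^ n)) where
  open FiniteField F
  open Exp commutativeSemiring using (_^_; ^-congˡ; ^-distrib-*)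
  open Mult semiring using (×1-homo-*; ×-assoc-*; ×-assocˡ; ×-congʳ; ×-congˡ)
    renaming (_×_ to _·_)
  open Sum +-commutativeMonoid
    using (sum; sum-permute; sum-cong-≋; sum-replicate; sum-replicate-zero; ∑-distrib-+; sum-init-last)
  open RingProperties ring using (x∙y⁻¹≈ε⇒x≈y; +-identityˡ-unique; +-inverseʳ-unique)
  open SetoidReasoning setoid
  open Inverse enumeration using (to; from; to-cong; strictlyInverseˡ; strictlyInverseʳ)

  to-injective : ∀ {x y} → to x ≡ to y → x ≈ y
  to-injective {x} {y} eq = trans (sym (strictlyInverseʳ x))
    (trans (reflexive (≡.cong from eq)) (strictlyInverseʳ y))

  _≟_ : Decidable _≈_
  x ≟ y = map′ to-injective to-cong (to x Fin.≟ to y)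

  integral : ∀ x y → x * y ≈ 0# → x ≈ 0# ⊎ y ≈ 0#
  integral x y xy≈0 with x ≟ 0#
  ... | yes x≈0 = inj₁ x≈0
  ... | no  x≉0 = let (z , xz≈1) = invertible x x≉0 in inj₂ (begin
    y            ≈⟨ *-identityˡ y ⟨
    1# * y       ≈⟨ *-congʳ xz≈1 ⟨
    (x * z) * y  ≈⟨ *-congʳ (*-comm x z) ⟩
    (z * x) * y  ≈⟨ *-assoc z x y ⟩
    z * (x * y)  ≈⟨ *-congˡ xy≈0 ⟩
    z * 0#       ≈⟨ zeroʳ z ⟩
    0#           ∎)

  ^-zero : ∀ x m → x ^ m ≈ 0# → x ≈ 0#
  ^-zero x ℕ.zero    1≈0 = ⊥-elim (1≉0 1≈0)
  ^-zero x (ℕ.suc m) eq with integral x (x ^ m) eq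
  ... | inj₁ x≈0  = x≈0
  ... | inj₂ xᵐ≈0 = ^-zero x m xᵐ≈0

  translation : Permutation′ (p ℕ.^ n)
  translation = permutation
    (λ i → to (1# + from i)) (λ i → to (- 1# + from i))
    (λ i → ≡.trans (to-cong (cancel (+-congˡ (strictlyInverseʳ (- 1# + from i))) (-‿inverseʳ 1#)))
                   (strictlyInverseˡ i))
    (λ i → ≡.trans (to-cong (cancel (+-congˡ (strictlyInverseʳ (1# + from i))) (-‿inverseˡ 1#)))
                   (strictlyInverseˡ i))
    where
    cancel : ∀ {x y z w} → w ≈ x + (y + z) → x + y ≈ 0# → w ≈ z
    cancel {x} {y} {z} {w} eq xy≈0 = begin
      w            ≈⟨ eq ⟩
      x + (y + z)  ≈⟨ +-assoc x y z ⟨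
      (x + y) + z  ≈⟨ +-congʳ xy≈0 ⟩
      0# + z       ≈⟨ +-identityˡ z ⟩
      z            ∎

  order·1≈0 : (p ℕ.^ n) · 1# ≈ 0#
  order·1≈0 = +-identityˡ-unique ((p ℕ.^ n) · 1#) (sum from) (begin
    (p ℕ.^ n) · 1# + sum from              ≈⟨ +-congʳ (sum-replicate (p ℕ.^ n)) ⟨
    sum {p ℕ.^ n} (λ _ → 1#) + sum from    ≈⟨ ∑-distrib-+ (λ _ → 1#) from ⟨
    sum (λ i → 1# + from i)                ≈⟨ sum-cong-≋ (λ i → sym (strictlyInverseʳ (1# + from i))) ⟩
    sum (λ i → from (to (1# + from i)))    ≈⟨ sum-permute from translation ⟨
    sum from                               ∎)

  ^·1 : ∀ m → (p ℕ.^ m) · 1# ≈ (p · 1#) ^ m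
  ^·1 ℕ.zero    = +-identityʳ 1#
  ^·1 (ℕ.suc m) = trans (×1-homo-* p (p ℕ.^ m)) (*-congˡ (^·1 m))

  p·1≈0 : p · 1# ≈ 0#
  p·1≈0 = ^-zero (p · 1#) n (trans (sym (^·1 n)) order·1≈0)

  p∣m⇒m·x≈0 : ∀ {m} x → p ∣ m → m · x ≈ 0#
  p∣m⇒m·x≈0 x (divides k ≡.refl) = begin
    (k ℕ.* p) · x         ≈⟨ ×-congˡ (ℕ.*-comm k p) ⟩
    (p ℕ.* k) · x         ≈⟨ ×-assocˡ x p k ⟨
    p · (k · x)           ≈⟨ ×-congʳ p (*-identityˡ (k · x)) ⟨
    p · (1# * (k · x))    ≈⟨ ×-assoc-* p 1# (k · x) ⟨
    (p · 1#) * (k · x)    ≈⟨ *-congʳ p·1≈0 ⟩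
    0# * (k · x)          ≈⟨ zeroˡ (k · x) ⟩
    0#                    ∎

  freshman′ : ∀ {r} → p ≡ ℕ.suc r → ∀ x y → (x + y) ^ ℕ.suc r ≈ x ^ ℕ.suc r + y ^ ℕ.suc r
  freshman′ {r} p≡ x y = begin
    (x + y) ^ ℕ.suc r
      ≈⟨ theorem (ℕ.suc r) x y ⟩
    f Fin.zero + sum (f ∘ Fin.suc)
      ≈⟨ +-congˡ (sum-init-last (f ∘ Fin.suc)) ⟩
    f Fin.zero + (sum (λ i → f (Fin.suc (inject₁ i))) + f (Fin.suc (fromℕ r)))
      ≈⟨ +-cong first (+-cong middle last) ⟩
    y ^ ℕ.suc r + (0# + x ^ ℕ.suc r)
      ≈⟨ +-congˡ (+-identityˡ _) ⟩
    y ^ ℕ.suc r + x ^ ℕ.suc r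
      ≈⟨ +-comm _ _ ⟩
    x ^ ℕ.suc r + y ^ ℕ.suc r ∎
    where
    open Binomial commutativeSemiring using (theorem; binomialTerm)
    f : Fin (ℕ.suc (ℕ.suc r)) → Carrier
    f = binomialTerm x y (ℕ.suc r)

    first : f Fin.zero ≈ y ^ ℕ.suc r
    first = trans (+-identityʳ _) (*-identityˡ _)

    middle : sum (λ i → f (Fin.suc (inject₁ i))) ≈ 0#
    middle = trans (sum-cong-≋ λ i → p∣m⇒m·x≈0 _
        (≡.subst (λ m → m ∣ ℕ.suc r C toℕ (Fin.suc (inject₁ i))) (≡.sym p≡)
          (prime∣C (≡.subst Prime p≡ pr) _ (ℕ.s≤s ℕ.z≤n)
            (ℕ.s≤s (≡.subst (ℕ._< r) (≡.sym (Fin.toℕ-inject₁ i)) (Fin.toℕ<n i))))))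
      (sum-replicate-zero r)

    last : f (Fin.suc (fromℕ r)) ≈ x ^ ℕ.suc r
    last rewrite Fin.toℕ-fromℕ r | nCn≡1 (ℕ.suc r) | ℕ.n∸n≡0 r =
      trans (+-identityʳ _) (*-identityʳ _)

  freshman : ∀ x y → (x + y) ^ p ≈ x ^ p + y ^ p
  freshman x y = ≡.subst (λ m → (x + y) ^ m ≈ x ^ m + y ^ m) suc-pred≡
    (freshman′ (≡.sym suc-pred≡) x y)
    where suc-pred≡ = ℕ.suc-pred p {{prime⇒nonZero pr}}

  one^ : ∀ m → 1# ^ m ≈ 1#
  one^ ℕ.zero    = refl
  one^ (ℕ.suc m) = trans (*-identityˡ _) (one^ m)

  zero^ : 0# ^ p ≈ 0#
  zero^ = +-identityˡ-unique (0# ^ p) (0# ^ p)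
    (trans (sym (freshman 0# 0#)) (^-congˡ p (+-identityˡ 0#)))

  neg^ : ∀ x → (- x) ^ p ≈ - (x ^ p)
  neg^ x = +-inverseʳ-unique (x ^ p) ((- x) ^ p)
    (trans (sym (freshman x (- x))) (trans (^-congˡ p (-‿inverseʳ x)) zero^))

  ^p-injective : ∀ {x y} → x ^ p ≈ y ^ p → x ≈ y
  ^p-injective {x} {y} eq = x∙y⁻¹≈ε⇒x≈y x y (^-zero (x - y) p (begin
    (x - y) ^ p          ≈⟨ freshman x (- y) ⟩
    x ^ p + (- y) ^ p    ≈⟨ +-cong eq (neg^ y) ⟩
    y ^ p + - (y ^ p)    ≈⟨ -‿inverseʳ (y ^ p) ⟩
    0#                   ∎))

  ^p-surjective : ∀ y → ∃ λ x → x ^ p ≈ y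
  ^p-surjective y =
    let (i , eq) = Fin-injective⇒surjective (λ i → to (from i ^ p))
          (λ {i} {j} e → ≡.trans (≡.sym (strictlyInverseˡ i))
            (≡.trans (to-cong (^p-injective (to-injective e))) (strictlyInverseˡ j)))
          (to y)
    in from i , to-injective eq

  frobenius : RingAutomorphism commutativeRing
  frobenius = record
    { ⟦_⟧ = _^ p
    ; isRingIsomorphism = record
      { isRingMonomorphism = record
        { isRingHomomorphism = record
          { isSemiringHomomorphism = record
            { isNearSemiringHomomorphism = record
              { +-isMonoidHomomorphism = record
                { isMagmaHomomorphism = record
                  { isRelHomomorphism = record { cong = ^-congˡ p }
                  ; homo = freshman
                  }
                ; ε-homo = zero^
                }
              ; *-homo = λ x y → ^-distrib-* x y p
              }
            ; 1#-homo = one^ p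
            }
          ; -‿homo = neg^
          }
        ; injective = ^p-injective
        }
      ; surjective = λ y → let (x , eq) = ^p-surjective y in
          x , λ z≈x → trans (^-congˡ p z≈x) eq
      }
    }

module Matrices (R : CommutativeRing c ℓ) where
  open CommutativeRing R
  private
    module S = Solver commutativeSemiring
    open S using (solve; _:+_; _:*_; _:=_)

  record M₂ : Set c where
    constructor mat
    field
      m₁₁ m₁₂ m₂₁ m₂₂ : Carrier
  open M₂ public

  infix 4 _≈ₘ_

  record _≈ₘ_ (A B : M₂) : Set ℓ where
    constructor eqs
    field
      e₁₁ : m₁₁ A ≈ m₁₁ B
      e₁₂ : m₁₂ A ≈ m₁₂ B
      e₂₁ : m₂₁ A ≈ m₂₁ B
      e₂₂ : m₂₂ A ≈ m₂₂ B

  infixl 7 _*ₘ_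
  infixr 8 _•_

  _*ₘ_ : M₂ → M₂ → M₂
  mat a b c d *ₘ mat e f g h =
    mat (a * e + b * g) (a * f + b * h)
        (c * e + d * g) (c * f + d * h)

  _•_ : Carrier → M₂ → M₂
  k • mat a b c d = mat (k * a) (k * b) (k * c) (k * d)

  1ₘ : M₂
  1ₘ = mat 1# 0# 0# 1#

  det : M₂ → Carrier
  det (mat a b c d) = a * d - b * c

  mapₘ : (Carrier → Carrier) → M₂ → M₂
  mapₘ f (mat a b c d) = mat (f a) (f b) (f c) (f d)

  ≈ₘ-refl : ∀ {A} → A ≈ₘ A
  ≈ₘ-refl = eqs refl refl refl refl

  ≈ₘ-sym : ∀ {A B} → A ≈ₘ B → B ≈ₘ A
  ≈ₘ-sym (eqs p q r s) = eqs (sym p) (sym q) (sym r) (sym s)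

  ≈ₘ-trans : ∀ {A B C} → A ≈ₘ B → B ≈ₘ C → A ≈ₘ C
  ≈ₘ-trans (eqs p q r s) (eqs p′ q′ r′ s′) =
    eqs (trans p p′) (trans q q′) (trans r r′) (trans s s′)

  *ₘ-cong : ∀ {A B C D} → A ≈ₘ B → C ≈ₘ D → A *ₘ C ≈ₘ B *ₘ D
  *ₘ-cong (eqs p q r s) (eqs p′ q′ r′ s′) = eqs
    (+-cong (*-cong p p′) (*-cong q r′)) (+-cong (*-cong p q′) (*-cong q s′))
    (+-cong (*-cong r p′) (*-cong s r′)) (+-cong (*-cong r q′) (*-cong s s′))

  •-cong : ∀ {k l A B} → k ≈ l → A ≈ₘ B → k • A ≈ₘ l • B
  •-cong k (eqs p q r s) = eqs (*-cong k p) (*-cong k q) (*-cong k r) (*-cong k s)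

  *ₘ-assoc : ∀ A B C → (A *ₘ B) *ₘ C ≈ₘ A *ₘ (B *ₘ C)
  *ₘ-assoc (mat a b c d) (mat e f g h) (mat i j k l) =
    eqs (entry a b i k) (entry a b j l) (entry c d i k) (entry c d j l)
    where
    entry : ∀ x y z w → (x * e + y * g) * z + (x * f + y * h) * w ≈
                        x * (e * z + f * w) + y * (g * z + h * w)
    entry x y z w = solve 8 (λ x y z w e f g h →
      (x :* e :+ y :* g) :* z :+ (x :* f :+ y :* h) :* w :=
      x :* (e :* z :+ f :* w) :+ y :* (g :* z :+ h :* w)) refl x y z w e f g h

  *ₘ-identityˡ : ∀ A → 1ₘ *ₘ A ≈ₘ A
  *ₘ-identityˡ (mat a b c d) = eqs (top a c) (top b d) (bot a c) (bot b d)
    where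
    top : ∀ x y → 1# * x + 0# * y ≈ x
    top x y = trans (+-cong (*-identityˡ x) (zeroˡ y)) (+-identityʳ x)
    bot : ∀ x y → 0# * x + 1# * y ≈ y
    bot x y = trans (+-cong (zeroˡ x) (*-identityˡ y)) (+-identityˡ y)

  *ₘ-identityʳ : ∀ A → A *ₘ 1ₘ ≈ₘ A
  *ₘ-identityʳ (mat a b c d) = eqs (left a b) (right a b) (left c d) (right c d)
    where
    left : ∀ x y → x * 1# + y * 0# ≈ x
    left x y = trans (+-cong (*-identityʳ x) (zeroʳ y)) (+-identityʳ x)
    right : ∀ x y → x * 0# + y * 1# ≈ y
    right x y = trans (+-cong (zeroʳ x) (*-identityʳ y)) (+-identityˡ y)

  •-identity : ∀ A → 1# • A ≈ₘ A
  •-identity (mat a b c d) = eqs (*-identityˡ a) (*-identityˡ b) (*-identityˡ c) (*-identityˡ d)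

  •-assoc : ∀ k l A → (k * l) • A ≈ₘ k • (l • A)
  •-assoc k l (mat a b c d) = eqs (*-assoc k l a) (*-assoc k l b) (*-assoc k l c) (*-assoc k l d)

  •-*ₘ : ∀ k l A B → (k • A) *ₘ (l • B) ≈ₘ (k * l) • (A *ₘ B)
  •-*ₘ k l (mat a b c d) (mat e f g h) =
    eqs (entry a b e g) (entry a b f h) (entry c d e g) (entry c d f h)
    where
    entry : ∀ x y z w → (k * x) * (l * z) + (k * y) * (l * w) ≈ (k * l) * (x * z + y * w)
    entry x y z w = solve 6 (λ k l x y z w →
      (k :* x) :* (l :* z) :+ (k :* y) :* (l :* w) := (k :* l) :* (x :* z :+ y :* w))
      refl k l x y z w

  det-cong : ∀ {A B} → A ≈ₘ B → det A ≈ det B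
  det-cong (eqs p q r s) = +-cong (*-cong p s) (-‿cong (*-cong q r))

  det-1ₘ : det 1ₘ ≈ 1#
  det-1ₘ = trans (+-cong (*-identityˡ 1#) (trans (-‿cong (zeroˡ 0#)) -0#≈0#)) (+-identityʳ 1#)
    where open RingProperties ring using (-0#≈0#)

  det-*ₘ : ∀ A B → det (A *ₘ B) ≈ det A * det B
  det-*ₘ (mat a b c d) (mat e f g h) = begin
    P - Q            ≈⟨ +-congʳ P≈D+Q ⟩
    (D + Q) - Q      ≈⟨ +-assoc D Q (- Q) ⟩
    D + (Q - Q)      ≈⟨ +-congˡ (-‿inverseʳ Q) ⟩
    D + 0#           ≈⟨ +-identityʳ D ⟩
    D                ∎
    where
    open SetoidReasoning setoid
    open RingProperties ring using (-‿distribˡ-*; -‿distribʳ-*; -‿involutive; +-cancelʳ)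
    P = (a * e + b * g) * (c * f + d * h)
    Q = (a * f + b * h) * (c * e + d * g)
    x = a * d
    y = b * c
    z = e * h
    w = f * g
    D = (x - y) * (z - w)

    P≈ : P + (x * w + y * z) ≈ Q + (x * z + y * w)
    P≈ = solve 8 (λ a b c d e f g h →
      (a :* e :+ b :* g) :* (c :* f :+ d :* h) :+ ((a :* d) :* (f :* g) :+ (b :* c) :* (e :* h)) :=
      (a :* f :+ b :* h) :* (c :* e :+ d :* g) :+ ((a :* d) :* (e :* h) :+ (b :* c) :* (f :* g)))
      refl a b c d e f g h

    neg*neg : (- y) * (- w) ≈ y * w
    neg*neg = trans (sym (-‿distribˡ-* y (- w)))
      (trans (-‿cong (sym (-‿distribʳ-* y w))) (-‿involutive (y * w)))

    D≈ : D + (x * w + y * z) ≈ x * z + y * w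
    D≈ = begin
      D + (x * w + y * z)
        ≈⟨ solve 6 (λ x y z w u v →
             (x :+ u) :* (z :+ v) :+ (x :* w :+ y :* z) :=
             x :* z :+ u :* v :+ (x :* (v :+ w) :+ (u :+ y) :* z)) refl x y z w (- y) (- w) ⟩
      x * z + (- y) * (- w) + (x * (- w + w) + (- y + y) * z)
        ≈⟨ +-cong (+-congˡ neg*neg) (+-cong (*-congˡ (-‿inverseˡ w)) (*-congʳ (-‿inverseˡ y))) ⟩
      x * z + y * w + (x * 0# + 0# * z)
        ≈⟨ +-congˡ (trans (+-cong (zeroʳ x) (zeroˡ z)) (+-identityˡ 0#)) ⟩
      x * z + y * w + 0#
        ≈⟨ +-identityʳ _ ⟩
      x * z + y * w ∎

    P≈D+Q : P ≈ D + Q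
    P≈D+Q = +-cancelʳ (x * w + y * z) P (D + Q) (begin
      P + (x * w + y * z)          ≈⟨ P≈ ⟩
      Q + (x * z + y * w)          ≈⟨ +-congˡ D≈ ⟨
      Q + (D + (x * w + y * z))    ≈⟨ +-assoc Q D _ ⟨
      (Q + D) + (x * w + y * z)    ≈⟨ +-congʳ (+-comm Q D) ⟩
      (D + Q) + (x * w + y * z)    ∎)

module LinearGroups {q : ℕ} (F : FiniteField c ℓ q) where
  open FiniteField F
  open Matrices commutativeRing
  private
    Aut = automorphismGroup commutativeRing

  record InvertibleMatrix : Set (c ⊔ ℓ) where
    constructor inv
    field
      matrix   : M₂
      inverse  : M₂
      inverseˡ : inverse *ₘ matrix ≈ₘ 1ₘ
      inverseʳ : matrix *ₘ inverse ≈ₘ 1ₘ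
  open InvertibleMatrix public using (matrix)

  inverse-unique : ∀ {A B C} → B *ₘ A ≈ₘ 1ₘ → A *ₘ C ≈ₘ 1ₘ → B ≈ₘ C
  inverse-unique {A} {B} {C} BA AC =
    ≈ₘ-trans (≈ₘ-sym (*ₘ-identityʳ B))
    (≈ₘ-trans (*ₘ-cong ≈ₘ-refl (≈ₘ-sym AC))
    (≈ₘ-trans (≈ₘ-sym (*ₘ-assoc B A C))
    (≈ₘ-trans (*ₘ-cong BA ≈ₘ-refl) (*ₘ-identityˡ C))))

  product-inverse : ∀ {A A′ B B′} → A *ₘ A′ ≈ₘ 1ₘ → B *ₘ B′ ≈ₘ 1ₘ →
                    (A *ₘ B) *ₘ (B′ *ₘ A′) ≈ₘ 1ₘ
  product-inverse {A} {A′} {B} {B′} AA′ BB′ =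
    ≈ₘ-trans (*ₘ-assoc A B (B′ *ₘ A′))
    (≈ₘ-trans (*ₘ-cong ≈ₘ-refl
      (≈ₘ-trans (≈ₘ-sym (*ₘ-assoc B B′ A′))
      (≈ₘ-trans (*ₘ-cong BB′ ≈ₘ-refl) (*ₘ-identityˡ A′)))) AA′)

  GL : Group (c ⊔ ℓ) ℓ
  GL = record
    { Carrier = InvertibleMatrix
    ; _≈_     = λ A B → matrix A ≈ₘ matrix B
    ; _∙_     = λ (inv A A′ l r) (inv B B′ l′ r′) →
        inv (A *ₘ B) (B′ *ₘ A′) (product-inverse l′ l) (product-inverse r r′)
    ; ε       = inv 1ₘ 1ₘ (*ₘ-identityˡ 1ₘ) (*ₘ-identityˡ 1ₘ)
    ; _⁻¹     = λ (inv A A′ l r) → inv A′ A r l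
    ; isGroup = record
      { isMonoid = record
        { isSemigroup = record
          { isMagma = record
            { isEquivalence = record { refl = ≈ₘ-refl ; sym = ≈ₘ-sym ; trans = ≈ₘ-trans }
            ; ∙-cong = *ₘ-cong
            }
          ; assoc = λ A B C → *ₘ-assoc (matrix A) (matrix B) (matrix C)
          }
        ; identity = (λ A → *ₘ-identityˡ (matrix A)) , (λ A → *ₘ-identityʳ (matrix A))
        }
      ; inverse = InvertibleMatrix.inverseˡ , InvertibleMatrix.inverseʳ
      ; ⁻¹-cong = λ {(inv A A′ l r)} {(inv B B′ l′ r′)} A≈B →
          inverse-unique l (≈ₘ-trans (*ₘ-cong A≈B ≈ₘ-refl) r′)
      }
    }

  module GL = Group GL

  infix 4 _∼_

  -- Equality modulo the nonzero scalar matrices.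
  record _∼_ (A B : InvertibleMatrix) : Set (c ⊔ ℓ) where
    constructor scaled
    field
      scalar   : Carrier
      scalar≉0 : ¬ (scalar ≈ 0#)
      equation : matrix A ≈ₘ scalar • matrix B

  unit≉0 : ∀ {x y} → x * y ≈ 1# → ¬ (x ≈ 0#)
  unit≉0 {x} {y} xy≈1 x≈0 = 1≉0 (trans (sym xy≈1) (trans (*-congʳ x≈0) (zeroˡ y)))

  *≉0 : ∀ {x y} → ¬ (x ≈ 0#) → ¬ (y ≈ 0#) → ¬ (x * y ≈ 0#)
  *≉0 {x} {y} x≉0 y≉0 xy≈0 = let (z , xz≈1) = invertible x x≉0 in
    y≉0 (trans (sym (*-identityˡ y))
        (trans (*-congʳ (trans (sym xz≈1) (*-comm x z)))
        (trans (*-assoc z x y) (trans (*-congˡ xy≈0) (zeroʳ z)))))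

  unscale : ∀ {k l A B} → k * l ≈ 1# → A ≈ₘ k • B → B ≈ₘ l • A
  unscale {k} {l} {A} {B} kl≈1 A≈kB = ≈ₘ-sym
    (≈ₘ-trans (•-cong refl A≈kB)
    (≈ₘ-trans (≈ₘ-sym (•-assoc l k B))
    (≈ₘ-trans (•-cong (trans (*-comm l k) kl≈1) ≈ₘ-refl) (•-identity B))))

  GL⇒∼ : ∀ {A B} → A GL.≈ B → A ∼ B
  GL⇒∼ A≈B = scaled 1# 1≉0 (≈ₘ-trans A≈B (≈ₘ-sym (•-identity _)))

  ∼-sym : ∀ {A B} → A ∼ B → B ∼ A
  ∼-sym (scaled k k≉0 eq) = let (l , kl≈1) = invertible k k≉0 in
    scaled l (unit≉0 (trans (*-comm l k) kl≈1)) (unscale kl≈1 eq)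

  ∼-trans : ∀ {A B C} → A ∼ B → B ∼ C → A ∼ C
  ∼-trans (scaled k k≉0 p) (scaled l l≉0 q) = scaled (k * l) (*≉0 k≉0 l≉0)
    (≈ₘ-trans p (≈ₘ-trans (•-cong refl q) (≈ₘ-sym (•-assoc k l _))))

  ∼-∙-cong : ∀ {A B C D} → A ∼ B → C ∼ D → (A GL.∙ C) ∼ (B GL.∙ D)
  ∼-∙-cong (scaled k k≉0 p) (scaled l l≉0 q) = scaled (k * l) (*≉0 k≉0 l≉0)
    (≈ₘ-trans (*ₘ-cong p q) (•-*ₘ k l _ _))

  ∼-⁻¹-cong : ∀ {A B} → A ∼ B → (A GL.⁻¹) ∼ (B GL.⁻¹)
  ∼-⁻¹-cong {inv A A′ l r} {inv B B′ l′ r′} (scaled k k≉0 A≈kB) =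
    let (m , km≈1) = invertible k k≉0 in
    scaled m (unit≉0 (trans (*-comm m k) km≈1)) (inverse-unique l
      (≈ₘ-trans (*ₘ-cong A≈kB ≈ₘ-refl)
      (≈ₘ-trans (•-*ₘ k m B B′)
      (≈ₘ-trans (•-cong km≈1 r′) (•-identity 1ₘ)))))

  PGL : Group (c ⊔ ℓ) (c ⊔ ℓ)
  PGL = record
    { Carrier = InvertibleMatrix
    ; _≈_     = _∼_
    ; _∙_     = GL._∙_
    ; ε       = GL.ε
    ; _⁻¹     = GL._⁻¹
    ; isGroup = record
      { isMonoid = record
        { isSemigroup = record
          { isMagma = record
            { isEquivalence = record { refl = GL⇒∼ ≈ₘ-refl ; sym = ∼-sym ; trans = ∼-trans }
            ; ∙-cong = ∼-∙-cong
            }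
          ; assoc = λ A B C → GL⇒∼ (GL.assoc A B C)
          }
        ; identity = (λ A → GL⇒∼ (GL.identityˡ A)) , (λ A → GL⇒∼ (GL.identityʳ A))
        }
      ; inverse = (λ A → GL⇒∼ (GL.inverseˡ A)) , (λ A → GL⇒∼ (GL.inverseʳ A))
      ; ⁻¹-cong = ∼-⁻¹-cong
      }
    }

  module PGL = Group PGL

  -- PSL(2,F) is the image of SL(2,F) in PGL(2,F).
  PSL : Subgroup PGL (c ⊔ ℓ)
  PSL = record
    { Member = λ A → ∃ λ B → det (matrix B) ≈ 1# × A ∼ B
    ; resp   = λ A≈A′ (B , det≈1 , A≈B) → B , det≈1 , PGL.trans (PGL.sym A≈A′) A≈B
    ; ε-∈    = GL.ε , det-1ₘ , PGL.refl
    ; ∙-∈    = λ (B , p , A≈B) (D , q , C≈D) → B GL.∙ D ,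
        trans (det-*ₘ (matrix B) (matrix D)) (trans (*-cong p q) (*-identityˡ 1#)) ,
        PGL.∙-cong A≈B C≈D
    ; ⁻¹-∈   = λ (B , p , A≈B) → B GL.⁻¹ ,
        trans (sym (*-identityˡ _)) (trans (*-congʳ (sym p))
          (trans (sym (det-*ₘ (matrix B) (matrix (B GL.⁻¹))))
            (trans (det-cong (GL.inverseʳ B)) det-1ₘ))) ,
        PGL.⁻¹-cong A≈B
    }

  -- Field automorphisms act on PGL(2,F) entrywise.
  entrywise : {s : Level} (H : Subgroup Aut s) → GroupAction (subgroupGroup Aut H) PGL
  entrywise H = record
    { _▷_    = λ (σ , _) → map σ
    ; ▷-cong = λ {(σ , _)} {(τ , _)} {A} {B} σ≈τ (scaled k k≉0 (eqs p q r s)) →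
        let image = λ {x y} (eq : x ≈ k * y) →
              trans (⟦⟧-cong σ eq) (trans (*-homo σ k y) (*-congˡ (σ≈τ y))) in
        scaled (⟦ σ ⟧ k) (λ σk≈0 → k≉0 (injective σ (trans σk≈0 (sym (0#-homo σ)))))
          (eqs (image p) (image q) (image r) (image s))
    ; ▷-homo = λ (σ , _) A B → GL⇒∼ (mapₘ-* σ (matrix A) (matrix B))
    ; ε-▷    = λ _ → GL⇒∼ ≈ₘ-refl
    ; ∙-▷    = λ _ _ _ → GL⇒∼ ≈ₘ-refl
    }
    where
    open RingAutomorphism

    mapₘ-* : ∀ σ A B → mapₘ ⟦ σ ⟧ (A *ₘ B) ≈ₘ mapₘ ⟦ σ ⟧ A *ₘ mapₘ ⟦ σ ⟧ B
    mapₘ-* σ (mat a b c d) (mat e f g h) = eqs (entry a b e g) (entry a b f h) (entry c d e g) (entry c d f h)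
      where
      entry : ∀ x y z w → ⟦ σ ⟧ (x * z + y * w) ≈ ⟦ σ ⟧ x * ⟦ σ ⟧ z + ⟦ σ ⟧ y * ⟦ σ ⟧ w
      entry x y z w = trans (+-homo σ (x * z) (y * w)) (+-cong (*-homo σ x z) (*-homo σ y w))

    mapₘ-1 : ∀ σ → mapₘ ⟦ σ ⟧ 1ₘ ≈ₘ 1ₘ
    mapₘ-1 σ = eqs (1#-homo σ) (0#-homo σ) (0#-homo σ) (1#-homo σ)

    mapₘ-cong : ∀ σ {A B} → A ≈ₘ B → mapₘ ⟦ σ ⟧ A ≈ₘ mapₘ ⟦ σ ⟧ B
    mapₘ-cong σ (eqs p q r s) = eqs (⟦⟧-cong σ p) (⟦⟧-cong σ q) (⟦⟧-cong σ r) (⟦⟧-cong σ s)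

    map : RingAutomorphism commutativeRing → InvertibleMatrix → InvertibleMatrix
    map σ (inv A A′ l r) = inv (mapₘ ⟦ σ ⟧ A) (mapₘ ⟦ σ ⟧ A′) (image l) (image r)
      where
      image : ∀ {B C} → B *ₘ C ≈ₘ 1ₘ → mapₘ ⟦ σ ⟧ B *ₘ mapₘ ⟦ σ ⟧ C ≈ₘ 1ₘ
      image {B} {C} BC≈1 = ≈ₘ-trans (≈ₘ-sym (mapₘ-* σ B C)) (≈ₘ-trans (mapₘ-cong σ BC≈1) (mapₘ-1 σ))

module ProjectiveSemilinear {p : ℕ} (n : ℕ) (pr : Prime p) (F : FiniteField c ℓ (p ℕ.^ n)) where
  open FiniteField F using (commutativeRing)
  open LinearGroups F public using (PGL; PSL)
  open LinearGroups F using (entrywise)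

  ⟨φ⟩ : Subgroup (automorphismGroup commutativeRing) (c ⊔ ℓ)
  ⟨φ⟩ = cyclic _ (Frobenius.frobenius n pr F)

  PΓL : Group (c ⊔ ℓ) (c ⊔ ℓ)
  PΓL = semidirectProduct PGL (subgroupGroup _ ⟨φ⟩) (entrywise ⟨φ⟩)

  -- PGL(2,q) and PSL(2,q), regarded as subgroups of PΓL(2,q).
  PGL-subgroup PSL-subgroup : Subgroup PΓL (c ⊔ ℓ)
  PGL-subgroup = normalFactor PGL (subgroupGroup _ ⟨φ⟩) (entrywise ⟨φ⟩) (whole PGL)
  PSL-subgroup = normalFactor PGL (subgroupGroup _ ⟨φ⟩) (entrywise ⟨φ⟩) PSL

{-# OPTIONS --safe #-}
-- The identity is dominating, so a claw has a centre v ≠ 1 with two leaves u, w such that ⟨v, u⟩ and ⟨v, w⟩ are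
-- cyclic but ⟨u, w⟩ is not.
--
-- Let G ≤ PGL(2, q). Lifted to matrices, u and w commute with the nonscalar matrix V of v, so they lie in F[V]. If V^p
-- is scalar, then F[V]ˣ/Fˣ has exponent p and both u and w lie in ⟨v⟩. Otherwise F[V]ˣ/Fˣ has no p-torsion, and it
-- has at most d solutions of x^d = 1 for d prime to p, because the coefficient of V in (t + V)^d is a polynomial in t
-- of degree d − 1 with leading coefficient d. Hence ⟨u, w⟩ is cyclic, and adjacency is transitive.
--
-- Conversely let (A, σ) ∈ G with σ ≠ 1. Then (A, σ)² has square determinant, so (1, σ²) ∈ G, and repeated squaring
-- reduces to the following cases, where in each claw the centre is a power of every leaf.
--   * (1, σ) ∈ G with σ of odd order: centre σ, leaves tσ for three involutions t of PSL(2, p).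
--   * σ² = 1, p odd, det A a square: centre σ, leaves uσ for three unipotents u of PSL(2, p).
--   * σ² = 1 otherwise: a claw in the group Fˣ ⋊ ⟨σ⟩ of diagonal matrices. For p = 2 it comes from an element a with
--     σ(a) ≠ a whose norm a σ(a) is not 1. For p odd and det A a nonsquare its centre is −1, which by Hilbert 90 is a
--     power of the norm of every nonsquare.
module Submission where

open import Defs
open import Algebra.Bundles using (Group; CommutativeRing; Semiring)
import Algebra.Properties.AbelianGroup as AbelianGroupProperties
import Algebra.Properties.CommutativeSemiring.Exp as Exp
import Algebra.Properties.Group as GroupProperties
import Algebra.Properties.Monoid.Mult as MonoidMult
import Algebra.Properties.Ring as RingProperties
import Algebra.Properties.Semiring.Binomial as Binomial
import Algebra.Properties.Semiring.Exp as SemiringExp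
import Algebra.Properties.Semiring.Mult as Mult
import Algebra.Properties.Semiring.Mult.TCOptimised as MultTC
import Algebra.Properties.Semiring.Sum as SemiringSum
import Algebra.Solver.Ring
open import Algebra.Solver.Ring.AlmostCommutativeRing using (fromCommutativeRing; _-Raw-AlmostCommutative⟶_)
open import Data.Empty using (⊥; ⊥-elim)
open import Data.Fin.Base as Fin using (Fin; fromℕ; inject₁)
open import Data.Fin.Patterns using (0F; 1F; 2F; 3F)
import Data.Fin.Properties as Fin
open import Data.Integer.Base as ℤ using (ℤ; +_; -[1+_]; _⊖_)
import Data.Integer.Properties as ℤ
open import Data.Maybe.Base as Maybe using (Maybe)
open import Data.Nat.Base as ℕ using (ℕ)
open import Data.Nat.Combinatorics using (_C_; nCn≡1; nC1≡n; nCk+nC[k+1]≡[n+1]C[k+1])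
open import Data.Nat.Coprimality as Coprime using (Coprime)
open import Data.Nat.DivMod using (_%_; _/_; m≡m%n+[m/n]*n; m%n<n)
open import Data.Nat.Divisibility
  using (_∣_; divides; ∣-refl; ∣-trans; 0∣⇒≡0; ∣m+n∣m⇒∣n; ∣n⇒∣m*n; m∣m*n; ∣⇒≤; _∣?_; m≤n⇒m!∣n!)
import Data.Nat.GCD as GCD
open import Data.Nat.Induction using (<-wellFounded)
open import Data.Nat.Primality using (Prime; euclidsLemma; prime⇒nonTrivial; prime⇒nonZero; prime⇒irreducible)
import Data.Nat.Properties as ℕ
open import Data.Nat.Tactic.RingSolver using (solve-∀)
open import Data.Product.Base using (∃; ∃₂; _×_; _,_; proj₁; proj₂)
open import Data.Sum.Base using (_⊎_; inj₁; inj₂; [_,_]; [_,_]′)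
open import Data.Unit.Base using (tt)
open import Function.Base using (_∘_; case_of_; id)
open import Function.Bundles using (mk⇔; Equivalence; Inverse; _⇔_)
open import Induction.WellFounded using (Acc; acc)
open import Level using (Level; _⊔_)
open import Relation.Binary.Definitions using (Decidable; tri<; tri≈; tri>)
open import Relation.Binary.PropositionalEquality as ≡ using (_≡_)
import Relation.Binary.Reasoning.Setoid as SetoidReasoning
open import Relation.Nullary using (¬_; Dec; yes; no)
open import Relation.Nullary.Decidable using (dec⇒maybe; _×-dec_; map′; ¬?; decidable-stable)
open import Relation.Unary using (Pred; _∈_; _⊆_)

-- The case split over σ follows which elements still have the intended centre among their powers.
-- If σ² = 1, then tσ has order 2 for every involution t fixed by σ, so involutions are used for σ
-- of odd order. A unipotent u fixed by σ gives (uσ)^p = σ when p is odd, but for p = 2 this power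
-- is trivial. When det A is not a square, (1, σ) itself may lie outside G, so the semilinear leaves
-- have to be sought in the determinant class of A. Diagonal matrices serve in both remaining cases:
-- the square of diag(1, a) σ is again diagonal, with the norm a σ(a) as its entry, so reaching the
-- centre becomes a question about norms. In the other direction the obstacle is that elements
-- commuting in PGL(2, q) need not have commuting matrices. Adjacency gives more than commutation:
-- up to scalars both matrices are powers of one matrix, and these commute exactly.

private
  variable
    a c ℓ s t : Level

-- Coprimality and minimal witnesses in ℕ

gcd-cofactors : ∀ i j .{{_ : ℕ.NonZero i}} →
                ∃ λ d → ∃₂ λ i′ j′ → i ≡ i′ ℕ.* d × j ≡ j′ ℕ.* d × Coprime i′ j′
gcd-cofactors i j with GCD.mkGCD i j
... | d , g with GCD.GCD.commonDivisor g
...   | divides i′ ≡.refl , divides j′ ≡.refl = d , i′ , j′ , ≡.refl , ≡.refl ,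
  Coprime.GCD≡1⇒coprime (GCD.GCD-* {{ℕ.m*n≢0⇒n≢0 i′}}
    (≡.subst (GCD.GCD (i′ ℕ.* d) (j′ ℕ.* d)) (≡.sym (ℕ.*-identityˡ d)) g))

-- k is the part of b that is coprime to a.
coprime-part : ∀ a b .{{_ : ℕ.NonZero b}} → ∃ λ k → Coprime k a ×
               (∀ c → c ∣ b → Coprime c a → Coprime c k → c ≡ 1)
coprime-part a b = go b (<-wellFounded b)
  where
  go : ∀ b → Acc ℕ._<_ b → .{{_ : ℕ.NonZero b}} → ∃ λ k → Coprime k a ×
       (∀ c → c ∣ b → Coprime c a → Coprime c k → c ≡ 1)
  go b (acc rec) with GCD.mkGCD b a
  ... | 0 , g = ⊥-elim (ℕ.≢-nonZero⁻¹ b (0∣⇒≡0 (proj₁ (GCD.GCD.commonDivisor g))))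
  ... | 1 , g = b , Coprime.GCD≡1⇒coprime g , λ c c∣b _ c⊥b → c⊥b (∣-refl , c∣b)
  ... | d@(ℕ.suc (ℕ.suc _)) , g with GCD.GCD.commonDivisor g
  ...   | divides b′ ≡.refl , d∣a =
    let instance b′≢0 = ℕ.m*n≢0⇒m≢0 b′ {d}
        (k , k⊥a , small) = go b′ (rec (ℕ.m<m*n b′ d (ℕ.s≤s (ℕ.s≤s ℕ.z≤n))))
    -- A divisor of `b′ ℕ.* d` coprime to a is coprime to d, which divides a, and hence divides b′.
    in k , k⊥a , λ c c∣b c⊥a c⊥k → small c
         (Coprime.coprime-divisor (λ (e∣c , e∣d) → c⊥a (e∣c , ∣-trans e∣d d∣a))
           (≡.subst (c ∣_) (ℕ.*-comm b′ d) c∣b)) c⊥a c⊥k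

-- An elementary stand-in for Dirichlet's theorem, with k the part of β coprime to α. Let c divide
-- the sum and β. What c shares with α divides `a ℕ.* k`, hence a, and is 1 by hypothesis; what c
-- shares with k divides α, and is 1 because k is coprime to α. So c is 1 by the choice of k.
coprime-in-progression : ∀ α a β .{{_ : ℕ.NonZero β}} → (∀ d → d ∣ α → d ∣ a → d ∣ β → d ≡ 1) →
                         ∃ λ k → Coprime (α ℕ.+ a ℕ.* k) β
coprime-in-progression α a β triv =
  let (k , k⊥α , small) = coprime-part α β in
  k , λ {c} (c∣sum , c∣β) →
    let c⊥α : Coprime c α
        c⊥α {e} (e∣c , e∣α) = triv e e∣α
          (Coprime.coprime-divisor (λ (f∣e , f∣k) → k⊥α (f∣k , ∣-trans f∣e e∣α))
            (≡.subst (e ∣_) (ℕ.*-comm a k) (∣m+n∣m⇒∣n (∣-trans e∣c c∣sum) e∣α)))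
          (∣-trans e∣c c∣β)
    in small c c∣β c⊥α (λ {e} (e∣c , e∣k) → k⊥α (e∣k ,
         ∣m+n∣m⇒∣n (≡.subst (e ∣_) (ℕ.+-comm α (a ℕ.* k)) (∣-trans e∣c c∣sum)) (∣n⇒∣m*n a e∣k)))

least : ∀ {P : ℕ → Set ℓ} → (∀ k → Dec (P k)) → ∀ n → P n → ∃ λ m → P m × (∀ k → k ℕ.< m → ¬ P k)
least {P = P} P? n p = go 0 (λ _ ()) n (≡.subst P (≡.sym (ℕ.+-identityʳ n)) p)
  where
  go : ∀ m → (∀ k → k ℕ.< m → ¬ P k) → ∀ n → P (n ℕ.+ m) → ∃ λ m → P m × (∀ k → k ℕ.< m → ¬ P k)
  go m below ℕ.zero    p = m , p , below
  go m below (ℕ.suc n) p with P? m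
  ... | yes q = m , q , below
  ... | no ¬q = go (ℕ.suc m)
        (λ k k<1+m → [ below k , (λ { ≡.refl → ¬q }) ] (ℕ.m≤n⇒m<n∨m≡n (ℕ.≤-pred k<1+m)))
        n (≡.subst P (≡.sym (ℕ.+-suc n m)) p)

-- Powers, cyclic subgroups and claws in a group

module GroupPowers (G : Group a ℓ) where
  open Group G
  open MonoidMult monoid public using ()
    renaming ( _×_ to _·_; ×-congʳ to ·-congʳ; ×-congˡ to ·-congˡ; ×-homo-+ to ·-homo-+
             ; ×-homo-1 to ·-homo-1; ×-assocˡ to ·-assocˡ)
  open GroupProperties G using (∙-cancelˡ; inverseʳ-unique)
  open SetoidReasoning setoid

  Commute : Carrier → Carrier → Set ℓ
  Commute x y = x ∙ y ≈ y ∙ x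

  ·-ε : ∀ k → k · ε ≈ ε
  ·-ε ℕ.zero    = refl
  ·-ε (ℕ.suc k) = trans (identityˡ _) (·-ε k)

  ·-swap : ∀ x m n → m · (n · x) ≈ n · (m · x)
  ·-swap x m n = trans (·-assocˡ x m n) (trans (·-congˡ (ℕ.*-comm m n)) (sym (·-assocˡ x n m)))

  commute-·ʳ : ∀ {x y} k → Commute x y → Commute x (k · y)
  commute-·ʳ ℕ.zero xy = trans (identityʳ _) (sym (identityˡ _))
  commute-·ʳ {x} {y} (ℕ.suc k) xy = begin
    x ∙ (y ∙ k · y)  ≈⟨ assoc _ _ _ ⟨
    x ∙ y ∙ k · y    ≈⟨ ∙-congʳ xy ⟩
    y ∙ x ∙ k · y    ≈⟨ assoc _ _ _ ⟩
    y ∙ (x ∙ k · y)  ≈⟨ ∙-congˡ (commute-·ʳ k xy) ⟩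
    y ∙ (k · y ∙ x)  ≈⟨ assoc _ _ _ ⟨
    y ∙ k · y ∙ x    ∎

  commute-⁻¹ʳ : ∀ {x y} → Commute x y → Commute x (y ⁻¹)
  commute-⁻¹ʳ {x} {y} xy = ∙-cancelˡ y _ _ (begin
    y ∙ (x ∙ y ⁻¹)    ≈⟨ assoc _ _ _ ⟨
    y ∙ x ∙ y ⁻¹      ≈⟨ ∙-congʳ xy ⟨
    x ∙ y ∙ y ⁻¹      ≈⟨ assoc _ _ _ ⟩
    x ∙ (y ∙ y ⁻¹)    ≈⟨ ∙-congˡ (inverseʳ y) ⟩
    x ∙ ε             ≈⟨ identityʳ x ⟩
    x                 ≈⟨ identityˡ x ⟨
    ε ∙ x             ≈⟨ ∙-congʳ (inverseʳ y) ⟨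
    y ∙ y ⁻¹ ∙ x      ≈⟨ assoc _ _ _ ⟩
    y ∙ (y ⁻¹ ∙ x)    ∎)

  commute-∙ʳ : ∀ {x y z} → Commute x y → Commute x z → Commute x (y ∙ z)
  commute-∙ʳ {x} {y} {z} xy xz = begin
    x ∙ (y ∙ z)  ≈⟨ assoc _ _ _ ⟨
    x ∙ y ∙ z    ≈⟨ ∙-congʳ xy ⟩
    y ∙ x ∙ z    ≈⟨ assoc _ _ _ ⟩
    y ∙ (x ∙ z)  ≈⟨ ∙-congˡ xz ⟩
    y ∙ (z ∙ x)  ≈⟨ assoc _ _ _ ⟨
    y ∙ z ∙ x    ∎

  ∙-interchange : ∀ x {y z} w → Commute y z → (x ∙ y) ∙ (z ∙ w) ≈ (x ∙ z) ∙ (y ∙ w)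
  ∙-interchange x {y} {z} w yz = begin
    (x ∙ y) ∙ (z ∙ w)  ≈⟨ assoc _ _ _ ⟩
    x ∙ (y ∙ (z ∙ w))  ≈⟨ ∙-congˡ (assoc _ _ _) ⟨
    x ∙ (y ∙ z ∙ w)    ≈⟨ ∙-congˡ (∙-congʳ yz) ⟩
    x ∙ (z ∙ y ∙ w)    ≈⟨ ∙-congˡ (assoc _ _ _) ⟩
    x ∙ (z ∙ (y ∙ w))  ≈⟨ assoc _ _ _ ⟨
    (x ∙ z) ∙ (y ∙ w)  ∎

  ·-distrib-∙ : ∀ {x y} k → Commute x y → k · (x ∙ y) ≈ k · x ∙ k · y
  ·-distrib-∙ ℕ.zero xy = sym (identityˡ ε)
  ·-distrib-∙ {x} {y} (ℕ.suc k) xy = begin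
    (x ∙ y) ∙ k · (x ∙ y)          ≈⟨ ∙-congˡ (·-distrib-∙ k xy) ⟩
    (x ∙ y) ∙ (k · x ∙ k · y)      ≈⟨ ∙-interchange x (k · y) (commute-·ʳ k (sym xy)) ⟩
    (x ∙ k · x) ∙ (y ∙ k · y)      ∎

  ·-⁻¹ : ∀ k x → k · (x ⁻¹) ≈ (k · x) ⁻¹
  ·-⁻¹ k x = inverseʳ-unique (k · x) (k · (x ⁻¹)) (begin
    k · x ∙ k · (x ⁻¹)  ≈⟨ ·-distrib-∙ k (commute-⁻¹ʳ refl) ⟨
    k · (x ∙ x ⁻¹)      ≈⟨ ·-congʳ k (inverseʳ x) ⟩
    k · ε               ≈⟨ ·-ε k ⟩
    ε                   ∎)

  Generated-least : ∀ {X : Pred Carrier s} {Y : Pred Carrier t} →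
                    X ⊆ Generated G Y → Generated G X ⊆ Generated G Y
  Generated-least X⊆ (gen x∈X)    = X⊆ x∈X
  Generated-least X⊆ (gen-≈ eq p) = gen-≈ eq (Generated-least X⊆ p)
  Generated-least X⊆ gen-ε        = gen-ε
  Generated-least X⊆ (gen-∙ p q)  = gen-∙ (Generated-least X⊆ p) (Generated-least X⊆ q)
  Generated-least X⊆ (gen-⁻¹ p)   = gen-⁻¹ (Generated-least X⊆ p)

  generated-commute : ∀ {X : Pred Carrier s} {z} → (∀ {x} → x ∈ X → Commute z x) →
                      ∀ {x} → x ∈ Generated G X → Commute z x
  generated-commute zX (gen x∈X)    = zX x∈X
  generated-commute zX (gen-≈ eq p) = trans (∙-congˡ (sym eq)) (trans (generated-commute zX p) (∙-congʳ eq))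
  generated-commute zX gen-ε        = trans (identityʳ _) (sym (identityˡ _))
  generated-commute zX (gen-∙ p q)  = commute-∙ʳ (generated-commute zX p) (generated-commute zX q)
  generated-commute zX (gen-⁻¹ p)   = commute-⁻¹ʳ (generated-commute zX p)

  Generated-· : ∀ {X : Pred Carrier s} {x} k → x ∈ Generated G X → k · x ∈ Generated G X
  Generated-· ℕ.zero    p = gen-ε
  Generated-· (ℕ.suc k) p = gen-∙ p (Generated-· k p)

  ∈cyclic-refl : ∀ {x} → x ∈ Generated G (_≈ x)
  ∈cyclic-refl = gen refl

  cyclic-commute : ∀ {g x y} → x ∈ Generated G (_≈ g) → y ∈ Generated G (_≈ g) → Commute x y
  cyclic-commute x∈ y∈ = generated-commute
    (λ y≈g → sym (generated-commute (λ x≈g → trans (∙-cong y≈g x≈g) (sym (∙-cong x≈g y≈g))) x∈)) y∈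

  pair-⊆ : ∀ {u v} {Y : Pred Carrier s} → u ∈ Generated G Y → v ∈ Generated G Y →
           Generated G (λ z → z ≈ u ⊎ z ≈ v) ⊆ Generated G Y
  pair-⊆ u∈ v∈ = Generated-least
    λ { (inj₁ z≈u) → gen-≈ (sym z≈u) u∈ ; (inj₂ z≈v) → gen-≈ (sym z≈v) v∈ }

  cyclic-⊆ : ∀ {g} {Y : Pred Carrier s} → g ∈ Generated G Y → Generated G (_≈ g) ⊆ Generated G Y
  cyclic-⊆ g∈ = Generated-least (λ z≈g → gen-≈ (sym z≈g) g∈)

  isCyclic : ∀ {u v g} → g ∈ Generated G (λ z → z ≈ u ⊎ z ≈ v) →
             u ∈ Generated G (_≈ g) → v ∈ Generated G (_≈ g) → IsCyclic G (⟨_,_⟩ G u v)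
  isCyclic {g = g} g∈ u∈ v∈ = g , pair-⊆ u∈ v∈ , cyclic-⊆ g∈

  pairˡ : ∀ {u v} → u ∈ Generated G (λ z → z ≈ u ⊎ z ≈ v)
  pairˡ = gen (inj₁ refl)

  pairʳ : ∀ {u v} → v ∈ Generated G (λ z → z ≈ u ⊎ z ≈ v)
  pairʳ = gen (inj₂ refl)

  power-isCyclic : ∀ {c x} k → k · x ≈ c → IsCyclic G (⟨_,_⟩ G c x)
  power-isCyclic k kx≈c = isCyclic pairʳ (gen-≈ kx≈c (Generated-· k ∈cyclic-refl)) ∈cyclic-refl

  isCyclic-sym : ∀ {u v} → IsCyclic G (⟨_,_⟩ G u v) → IsCyclic G (⟨_,_⟩ G v u)
  isCyclic-sym (g , to , from) = isCyclic (pair-⊆ pairʳ pairˡ (from ∈cyclic-refl)) (to pairʳ) (to pairˡ)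

  isCyclic⇒commute : ∀ {u v} → IsCyclic G (⟨_,_⟩ G u v) → Commute u v
  isCyclic⇒commute (g , to , _) = cyclic-commute (to pairˡ) (to pairʳ)

  ·-torsion-closed : ∀ {X : Pred Carrier s} k → (∀ {x y} → x ∈ X → y ∈ X → Commute x y) →
                     (∀ {x} → x ∈ X → k · x ≈ ε) → ∀ {x} → x ∈ Generated G X → k · x ≈ ε
  ·-torsion-closed {X = X} k comm tors = go
    where
    commute : ∀ {x y} → x ∈ Generated G X → y ∈ Generated G X → Commute x y
    commute x∈ y∈ = generated-commute (λ y∈X → sym (generated-commute (λ x∈X → comm y∈X x∈X) x∈)) y∈

    go : ∀ {x} → x ∈ Generated G X → k · x ≈ ε
    go (gen x∈X)    = tors x∈X
    go (gen-≈ eq p) = trans (·-congʳ k (sym eq)) (go p)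
    go gen-ε        = ·-ε k
    go (gen-∙ p q)  = trans (·-distrib-∙ k (commute p q)) (trans (∙-cong (go p) (go q)) (identityˡ ε))
    go (gen-⁻¹ {x} p) = begin
      k · (x ⁻¹)         ≈⟨ identityˡ _ ⟨
      ε ∙ k · (x ⁻¹)     ≈⟨ ∙-congʳ (go p) ⟨
      k · x ∙ k · (x ⁻¹) ≈⟨ ·-distrib-∙ k (commute-⁻¹ʳ refl) ⟨
      k · (x ∙ x ⁻¹)     ≈⟨ ·-congʳ k (inverseʳ x) ⟩
      k · ε              ≈⟨ ·-ε k ⟩
      ε                  ∎

  pair-torsion : ∀ {u v x} k → Commute u v → k · u ≈ ε → k · v ≈ ε →
                 x ∈ Generated G (λ z → z ≈ u ⊎ z ≈ v) → k · x ≈ ε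
  pair-torsion {u} {v} k uv ku kv = ·-torsion-closed k
    (λ { (inj₁ p) (inj₁ q) → trans (∙-cong p q) (sym (∙-cong q p))
       ; (inj₁ p) (inj₂ q) → trans (∙-cong p q) (trans uv (sym (∙-cong q p)))
       ; (inj₂ p) (inj₁ q) → trans (∙-cong p q) (trans (sym uv) (sym (∙-cong q p)))
       ; (inj₂ p) (inj₂ q) → trans (∙-cong p q) (sym (∙-cong q p)) })
    (λ { (inj₁ p) → trans (·-congʳ k p) ku ; (inj₂ p) → trans (·-congʳ k p) kv })

  -- Finite order makes natural exponents suffice: `(N ℕ.* k) · g` is the inverse of `k · g`.
  ∈cyclic⇒power : ∀ {g x} N → ℕ.suc N · g ≈ ε → x ∈ Generated G (_≈ g) → ∃ λ k → x ≈ k · g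
  ∈cyclic⇒power {g} N Ng = go
    where
    go : ∀ {x} → x ∈ Generated G (_≈ g) → ∃ λ k → x ≈ k · g
    go (gen x≈g)    = 1 , trans x≈g (sym (·-homo-1 g))
    go (gen-≈ eq p) = let (k , q) = go p in k , trans (sym eq) q
    go gen-ε        = 0 , refl
    go (gen-∙ p q)  = let (k , p′) = go p ; (l , q′) = go q in
      k ℕ.+ l , trans (∙-cong p′ q′) (sym (·-homo-+ g k l))
    go (gen-⁻¹ {x} p) = let (k , x≈kg) = go p in N ℕ.* k , sym (inverseʳ-unique x _ (begin
      x ∙ (N ℕ.* k) · g      ≈⟨ ∙-congʳ x≈kg ⟩
      k · g ∙ (N ℕ.* k) · g  ≈⟨ ·-homo-+ g k (N ℕ.* k) ⟨
      (ℕ.suc N ℕ.* k) · g    ≈⟨ ·-congˡ (ℕ.*-comm (ℕ.suc N) k) ⟩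
      (k ℕ.* ℕ.suc N) · g    ≈⟨ ·-assocˡ g k (ℕ.suc N) ⟨
      k · (ℕ.suc N · g)      ≈⟨ ·-congʳ k Ng ⟩
      k · ε                  ≈⟨ ·-ε k ⟩
      ε                      ∎))

  -- If g generates, then `(2 ℕ.* l) · g` is trivial, so the only nontrivial multiple of `l · g` is
  -- `l · g` itself. Two leaves with different involutions among their powers are therefore
  -- nonadjacent.
  cyclic-involution-unique : ∀ {u v} l → IsCyclic G (⟨_,_⟩ G u v) → (2 ℕ.* l) · u ≈ ε → (2 ℕ.* l) · v ≈ ε →
                             ¬ (l · u ≈ ε) → ¬ (l · v ≈ ε) → l · u ≈ l · v
  cyclic-involution-unique {u} {v} ℕ.zero _ _ _ lu _ = ⊥-elim (lu refl)
  cyclic-involution-unique {u} {v} l@(ℕ.suc l′) cyc@(g , to , from) 2lu 2lv lu lv =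
    trans (is-h (to pairˡ) lu) (sym (is-h (to pairʳ) lv))
    where
    g-torsion : (2 ℕ.* l) · g ≈ ε
    g-torsion = pair-torsion (2 ℕ.* l) (isCyclic⇒commute cyc) 2lu 2lv (from ∈cyclic-refl)

    parity : ∀ k → k · (l · g) ≈ ε ⊎ k · (l · g) ≈ l · g
    parity 0 = inj₁ refl
    parity 1 = inj₂ (·-homo-1 _)
    parity (ℕ.suc (ℕ.suc k)) = [ inj₁ ∘ trans step , inj₂ ∘ trans step ] (parity k)
      where
      step : (2 ℕ.+ k) · (l · g) ≈ k · (l · g)
      step = begin
        (2 ℕ.+ k) · (l · g)          ≈⟨ ·-homo-+ (l · g) 2 k ⟩
        2 · (l · g) ∙ k · (l · g)    ≈⟨ ∙-congʳ (trans (·-assocˡ g 2 l) g-torsion) ⟩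
        ε ∙ k · (l · g)              ≈⟨ identityˡ _ ⟩
        k · (l · g)                  ∎

    is-h : ∀ {w} → w ∈ Generated G (_≈ g) → ¬ (l · w ≈ ε) → l · w ≈ l · g
    is-h {w} w∈ lw with ∈cyclic⇒power (l′ ℕ.+ (l ℕ.+ 0)) g-torsion w∈
    ... | k , w≈kg with parity k
    ...   | inj₁ eq = ⊥-elim (lw (trans (·-congʳ l w≈kg) (trans (·-swap g l k) eq)))
    ...   | inj₂ eq = trans (·-congʳ l w≈kg) (trans (·-swap g l k) eq)

  private
    -- Additively, g = x w - y u is a generator. From β w = α u and x α - y β = 1 follow α g = w and
    -- β g = u.
    bezout-isCyclic : ∀ {u w} α β x y → Commute u w → β · w ≈ α · u → 1 ℕ.+ y ℕ.* β ≡ x ℕ.* α →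
                      IsCyclic G (⟨_,_⟩ G u w)
    bezout-isCyclic {u} {w} α β x y uw rel bez = isCyclic
      (gen-∙ (Generated-· x pairʳ) (Generated-· y (gen-⁻¹ pairˡ)))
      (gen-≈ βg (Generated-· β ∈cyclic-refl)) (gen-≈ αg (Generated-· α ∈cyclic-refl))
      where
      g = x · w ∙ y · (u ⁻¹)
      split : ∀ k → k · g ≈ (k ℕ.* x) · w ∙ ((k ℕ.* y) · u) ⁻¹
      split k = begin
        k · g
          ≈⟨ ·-distrib-∙ k (commute-·ʳ y (commute-⁻¹ʳ (sym (commute-·ʳ x uw)))) ⟩
        k · (x · w) ∙ k · (y · (u ⁻¹))
          ≈⟨ ∙-cong (·-assocˡ w k x) (trans (·-assocˡ (u ⁻¹) k y) (·-⁻¹ (k ℕ.* y) u)) ⟩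
        (k ℕ.* x) · w ∙ ((k ℕ.* y) · u) ⁻¹ ∎

      αg : α · g ≈ w
      αg = begin
        α · g                                    ≈⟨ split α ⟩
        (α ℕ.* x) · w ∙ ((α ℕ.* y) · u) ⁻¹
          ≈⟨ ∙-cong (·-congˡ (≡.trans (ℕ.*-comm α x) (≡.sym bez)))
                    (⁻¹-cong (trans (·-congˡ (ℕ.*-comm α y)) (sym (·-assocˡ u y α)))) ⟩
        w ∙ (y ℕ.* β) · w ∙ (y · (α · u)) ⁻¹
          ≈⟨ ∙-congˡ (⁻¹-cong (trans (·-congʳ y (sym rel)) (·-assocˡ w y β))) ⟩
        w ∙ (y ℕ.* β) · w ∙ ((y ℕ.* β) · w) ⁻¹   ≈⟨ assoc _ _ _ ⟩
        w ∙ ((y ℕ.* β) · w ∙ ((y ℕ.* β) · w) ⁻¹) ≈⟨ ∙-congˡ (inverseʳ _) ⟩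
        w ∙ ε                                    ≈⟨ identityʳ w ⟩
        w                                        ∎

      βg : β · g ≈ u
      βg = begin
        β · g                                    ≈⟨ split β ⟩
        (β ℕ.* x) · w ∙ ((β ℕ.* y) · u) ⁻¹
          ≈⟨ ∙-cong (trans (·-congˡ (ℕ.*-comm β x)) (trans (sym (·-assocˡ w x β))
                      (trans (·-congʳ x rel) (·-assocˡ u x α))))
                    (⁻¹-cong (·-congˡ (ℕ.*-comm β y))) ⟩
        (x ℕ.* α) · u ∙ ((y ℕ.* β) · u) ⁻¹       ≈⟨ ∙-congʳ (·-congˡ (≡.sym bez)) ⟩
        u ∙ (y ℕ.* β) · u ∙ ((y ℕ.* β) · u) ⁻¹   ≈⟨ assoc _ _ _ ⟩
        u ∙ ((y ℕ.* β) · u ∙ ((y ℕ.* β) · u) ⁻¹) ≈⟨ ∙-congˡ (inverseʳ _) ⟩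
        u ∙ ε                                    ≈⟨ identityʳ u ⟩
        u                                        ∎

  coprime-relation-isCyclic : ∀ {u w} α β → Coprime α β → Commute u w → β · w ≈ α · u →
                              IsCyclic G (⟨_,_⟩ G u w)
  coprime-relation-isCyclic α β cop uw rel with Coprime.coprime-Bézout cop
  ... | GCD.Bézout.Identity.+- x y eq = bezout-isCyclic α β x y uw rel eq
  -- The opposite sign of the Bézout identity exchanges the roles of u and w.
  ... | GCD.Bézout.Identity.-+ x y eq = isCyclic-sym (bezout-isCyclic β α y x (sym uw) (sym rel) eq)

  -- Dividing i and j by their gcd leaves a relation between u and w with coprime coefficients. The
  -- gcd is nonzero because u ≠ ε forces i ≠ 0.
  powers-isCyclic : ∀ {v u w} i j → ¬ (u ≈ ε) → u ≈ i · v → w ≈ j · v → IsCyclic G (⟨_,_⟩ G u w)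
  powers-isCyclic ℕ.zero j u≉ε u≈iv w≈jv = ⊥-elim (u≉ε u≈iv)
  powers-isCyclic {v} {u} {w} i@(ℕ.suc _) j u≉ε u≈iv w≈jv =
    let (d , i′ , j′ , i≡ , j≡ , cop) = gcd-cofactors i j in
    coprime-relation-isCyclic j′ i′ (Coprime.sym cop)
      (cyclic-commute (gen-≈ (sym u≈iv) (Generated-· i ∈cyclic-refl)) (gen-≈ (sym w≈jv) (Generated-· j ∈cyclic-refl)))
      (begin
        i′ · w              ≈⟨ ·-congʳ i′ (trans w≈jv (trans (·-congˡ j≡) (sym (·-assocˡ v j′ d)))) ⟩
        i′ · (j′ · (d · v)) ≈⟨ ·-swap (d · v) i′ j′ ⟩
        j′ · (i′ · (d · v)) ≈⟨ ·-congʳ j′ (trans u≈iv (trans (·-congˡ i≡) (sym (·-assocˡ v i′ d)))) ⟨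
        j′ · u              ∎)

  coprime-power-generates : ∀ {g v} N i → Coprime i N → N · g ≈ ε → v ≈ i · g → g ∈ Generated G (_≈ v)
  coprime-power-generates {g} {v} N i cop Ng v≈ig with Coprime.coprime-Bézout cop
  ... | GCD.Bézout.Identity.+- x y eq = gen-≈ (begin
      x · v                ≈⟨ trans (·-congʳ x v≈ig) (·-assocˡ g x i) ⟩
      (x ℕ.* i) · g        ≈⟨ ·-congˡ (≡.sym eq) ⟩
      g ∙ (y ℕ.* N) · g    ≈⟨ ∙-congˡ (trans (sym (·-assocˡ g y N)) (trans (·-congʳ y Ng) (·-ε y))) ⟩
      g ∙ ε                ≈⟨ identityʳ g ⟩
      g                    ∎) (Generated-· x ∈cyclic-refl)
  ... | GCD.Bézout.Identity.-+ x y eq = gen-≈ (sym (GroupProperties.inverseˡ-unique G g (x · v) (begin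
      g ∙ x · v            ≈⟨ ∙-congˡ (trans (·-congʳ x v≈ig) (·-assocˡ g x i)) ⟩
      (1 ℕ.+ x ℕ.* i) · g  ≈⟨ ·-congˡ eq ⟩
      (y ℕ.* N) · g        ≈⟨ trans (sym (·-assocˡ g y N)) (trans (·-congʳ y Ng) (·-ε y)) ⟩
      ε                    ∎))) (gen-⁻¹ (Generated-· x ∈cyclic-refl))

  -- If w has order b modulo ⟨u⟩ with w^b = u^α, a prime dividing a = ord u, b and α would give a torsion
  -- element outside ⟨u⟩; hence α can be chosen coprime to b.
  torsion⇒isCyclic : Decidable _≈_ → ∀ {u w} N M → Commute u w → ℕ.suc N · u ≈ ε → ℕ.suc M · w ≈ ε →
    (∀ d e → (∀ k → 0 ℕ.< k → k ℕ.< d ℕ.* e → ¬ (k · u ≈ ε)) → (d ℕ.* e) · u ≈ ε → 0 ℕ.< d ℕ.* e →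
     ∀ {y} → y ∈ Generated G (λ z → z ≈ u ⊎ z ≈ w) → d · y ≈ ε → ∃ λ i → y ≈ i · (e · u)) →
    IsCyclic G (⟨_,_⟩ G u w)
  torsion⇒isCyclic _≟_ {u} {w} N M uw Nu Mw tors
    -- Both minima run over positive exponents `ℕ.suc k`: the order of u, and the least exponent
    -- that brings w into ⟨u⟩.
    with least (λ k → (ℕ.suc k · u) ≟ ε) N Nu
  ... | a′ , au , a-min
    with least (λ k → Fin.any? (λ (i : Fin (ℕ.suc a′)) → (ℕ.suc k · w) ≟ (Fin.toℕ i · u))) M (Fin.zero , Mw)
  ...   | β′ , (i , rel) , β-min = finish (coprime-in-progression α A β trivial)
    where
    A = ℕ.suc a′
    β = ℕ.suc β′
    α = Fin.toℕ i

    order-min : ∀ k → 0 ℕ.< k → k ℕ.< A → ¬ (k · u ≈ ε)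
    order-min (ℕ.suc k) _ k<A = a-min k (ℕ.≤-pred k<A)

    shift : ∀ m k → (m ℕ.+ A ℕ.* k) · u ≈ m · u
    shift m k = begin
      (m ℕ.+ A ℕ.* k) · u       ≈⟨ ·-homo-+ u m (A ℕ.* k) ⟩
      m · u ∙ (A ℕ.* k) · u     ≈⟨ ∙-congˡ (trans (·-congˡ (ℕ.*-comm A k)) (sym (·-assocˡ u k A))) ⟩
      m · u ∙ k · (A · u)       ≈⟨ ∙-congˡ (trans (·-congʳ k au) (·-ε k)) ⟩
      m · u ∙ ε                 ≈⟨ identityʳ _ ⟩
      m · u                     ∎

    finish : (∃ λ k → Coprime (α ℕ.+ A ℕ.* k) β) → IsCyclic G (⟨_,_⟩ G u w)
    finish (k , cop) = coprime-relation-isCyclic (α ℕ.+ A ℕ.* k) β cop uw (trans rel (sym (shift α k)))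

    minimal : ∀ k m → ℕ.suc k · w ≈ m · u → ¬ (k ℕ.< β′)
    minimal k m eq k<β′ = β-min k k<β′ (Fin.fromℕ< (m%n<n m A) , (begin
      ℕ.suc k · w                          ≈⟨ eq ⟩
      m · u
          ≈⟨ ·-congˡ (≡.trans (m≡m%n+[m/n]*n m A) (≡.cong (m % A ℕ.+_) (ℕ.*-comm (m / A) A))) ⟩
      (m % A ℕ.+ A ℕ.* (m / A)) · u        ≈⟨ shift (m % A) (m / A) ⟩
      (m % A) · u                          ≡⟨ ≡.cong (_· u) (Fin.toℕ-fromℕ< (m%n<n m A)) ⟨
      Fin.toℕ (Fin.fromℕ< (m%n<n m A)) · u ∎))

    trivial : ∀ d → d ∣ α → d ∣ A → d ∣ β → d ≡ 1
    trivial 1 _ _ _ = ≡.refl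
    trivial d (divides α₀ α≡) (divides a₀ a≡) (divides 0 ())
    trivial 0 (divides α₀ α≡) (divides a₀ a≡) (divides (ℕ.suc b) β≡) with () ← ≡.trans β≡ (ℕ.*-zeroʳ (ℕ.suc b))
    trivial d@(ℕ.suc (ℕ.suc _)) (divides α₀ α≡) (divides a₀ a≡) (divides (ℕ.suc b) β≡) =
      ⊥-elim (minimal b (α₀ ℕ.+ j ℕ.* a₀) relation smaller)
      where
      -- Additively y = (β/d) w - (α/d) u, which d kills by `rel`. Once `tors` places y in ⟨u⟩, the
      -- multiple (β/d) w lies there too, against the minimality of β.
      y = ℕ.suc b · w ∙ α₀ · (u ⁻¹)
      comm : Commute (ℕ.suc b · w) (α₀ · (u ⁻¹))
      comm = commute-·ʳ α₀ (commute-⁻¹ʳ (sym (commute-·ʳ (ℕ.suc b) uw)))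
      dy : d · y ≈ ε
      dy = begin
        d · y                                        ≈⟨ ·-distrib-∙ d comm ⟩
        d · (ℕ.suc b · w) ∙ d · (α₀ · (u ⁻¹))        ≈⟨ ∙-cong (·-assocˡ w d (ℕ.suc b)) (·-assocˡ (u ⁻¹) d α₀) ⟩
        (d ℕ.* ℕ.suc b) · w ∙ (d ℕ.* α₀) · (u ⁻¹)
          ≈⟨ ∙-cong (·-congˡ (≡.trans (ℕ.*-comm d (ℕ.suc b)) (≡.sym β≡)))
                    (trans (·-congˡ (≡.trans (ℕ.*-comm d α₀) (≡.sym α≡))) (·-⁻¹ α u)) ⟩
        β · w ∙ (α · u) ⁻¹                           ≈⟨ ∙-congʳ rel ⟩
        α · u ∙ (α · u) ⁻¹                           ≈⟨ inverseʳ _ ⟩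
        ε                                            ∎
      a≡′ : d ℕ.* a₀ ≡ A
      a≡′ = ≡.trans (ℕ.*-comm d a₀) (≡.sym a≡)
      found = tors d a₀ (λ k 0<k k< → order-min k 0<k (≡.subst (k ℕ.<_) a≡′ k<))
                (trans (·-congˡ a≡′) au) (≡.subst (0 ℕ.<_) (≡.sym a≡′) (ℕ.s≤s ℕ.z≤n))
                (gen-∙ (Generated-· (ℕ.suc b) pairʳ) (Generated-· α₀ (gen-⁻¹ pairˡ))) dy
      j = proj₁ found
      relation : ℕ.suc b · w ≈ (α₀ ℕ.+ j ℕ.* a₀) · u
      relation = begin
        ℕ.suc b · w                                  ≈⟨ identityʳ _ ⟨
        ℕ.suc b · w ∙ ε                              ≈⟨ ∙-congˡ (trans (∙-congʳ (·-⁻¹ α₀ u)) (inverseˡ _)) ⟨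
        ℕ.suc b · w ∙ (α₀ · (u ⁻¹) ∙ α₀ · u)         ≈⟨ assoc _ _ _ ⟨
        y ∙ α₀ · u                                   ≈⟨ ∙-congʳ (trans (proj₂ found) (·-assocˡ u j a₀)) ⟩
        (j ℕ.* a₀) · u ∙ α₀ · u                      ≈⟨ ·-homo-+ u (j ℕ.* a₀) α₀ ⟨
        (j ℕ.* a₀ ℕ.+ α₀) · u                        ≈⟨ ·-congˡ (ℕ.+-comm (j ℕ.* a₀) α₀) ⟩
        (α₀ ℕ.+ j ℕ.* a₀) · u                        ∎
      smaller : b ℕ.< β′
      smaller = ℕ.≤-pred (≡.subst (ℕ.suc b ℕ.<_) (≡.sym β≡) (ℕ.m<m*n (ℕ.suc b) d (ℕ.s≤s (ℕ.s≤s ℕ.z≤n))))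

  private
    E = enhancedPowerGraph G

  identity-dominating : ∀ {x} → x ≈ ε → IsDominating E x
  identity-dominating x≈ε v v≉x = (λ x≈v → v≉x (sym x≈v)) , power-isCyclic 0 (sym x≈ε)

  -- The vertices are nontrivial because ε is dominating. Transitivity then makes the graph a
  -- disjoint union of complete graphs, where no vertex has two distinct nonadjacent neighbours.
  transitive⇒clawFree : (∀ {v u w} → ¬ (v ≈ ε) → ¬ (u ≈ ε) → IsCyclic G (⟨_,_⟩ G v u) →
                         IsCyclic G (⟨_,_⟩ G v w) → IsCyclic G (⟨_,_⟩ G u w)) →
                        ClawFree (properEnhancedPowerGraph G)
  transitive⇒clawFree transitive P iso = Equivalence.from (adjacency (leaf 0F) (leaf 1F))
    ( (λ eq → case to-injective eq of λ ())
    , transitive (nontrivial (inj₁ 0F)) (nontrivial (leaf 0F)) (edge 0F) (edge 1F))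
    where
    open _≅_ iso
    open Inverse bijection using (from-cong; strictlyInverseʳ)
    to-injective : ∀ {x y} → proj₁ (proj₁ (to x)) ≈ proj₁ (proj₁ (to y)) → x ≡ y
    to-injective eq = ≡.trans (≡.sym (strictlyInverseʳ _)) (≡.trans (from-cong eq) (strictlyInverseʳ _))
    leaf : Fin 3 → Fin 1 ⊎ Fin 3
    leaf = inj₂
    edge : ∀ i → IsCyclic G (⟨_,_⟩ G (proj₁ (proj₁ (to (inj₁ 0F)))) (proj₁ (proj₁ (to (leaf i)))))
    edge i = proj₂ (Equivalence.to (adjacency (inj₁ 0F) (leaf i)) tt)
    nontrivial : ∀ x → ¬ (proj₁ (proj₁ (to x)) ≈ ε)
    nontrivial x eq = proj₂ (proj₁ (to x)) (identity-dominating eq)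

  -- The element `d` shows that the centre is not dominating; for a leaf, any other leaf shows it. A
  -- centre equal to some leaf would be a power of another leaf and would make the two leaves
  -- adjacent.
  claw : ∀ c d → ¬ Commute c d → (l : Fin 3 → Carrier) → (∀ i → ∃ λ k → k · l i ≈ c) →
         (∀ i j → ¬ (i ≡ j) → ¬ IsCyclic G (⟨_,_⟩ G (l i) (l j))) →
         ¬ ClawFree (properEnhancedPowerGraph G)
  claw c d c≁d l power distinct clawFree = clawFree P record
    { bijection = record
      { to        = λ x → f x , x , refl
      ; from      = λ y → proj₁ (proj₂ y)
      ; to-cong   = λ { ≡.refl → refl }
      ; from-cong = λ {y} {y′} y≈y′ → f-injective _ _
          (trans (proj₂ (proj₂ y)) (trans y≈y′ (sym (proj₂ (proj₂ y′)))))
      ; inverse   = (λ { {y} ≡.refl → proj₂ (proj₂ y) })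
                  , (λ {x} {y} y≈ → f-injective _ _ (trans (proj₂ (proj₂ y)) y≈))
      }
    ; adjacency = adjacent
    }
    where
    other : (i : Fin 3) → ∃ λ j → ¬ (j ≡ i)
    other 0F = 1F , λ ()
    other 1F = 0F , λ ()
    other 2F = 0F , λ ()

    element : Fin 1 ⊎ Fin 3 → Carrier
    element (inj₁ _) = c
    element (inj₂ i) = l i

    l-distinct : ∀ i j → ¬ (i ≡ j) → ¬ (l i ≈ l j)
    l-distinct i j i≢j eq = distinct i j i≢j (power-isCyclic 1 (trans (·-homo-1 _) (sym eq)))

    c≉l : ∀ i → ¬ (c ≈ l i)
    c≉l i c≈l = let (j , j≢i) = other i ; (k , eq) = power j in
      distinct i j (j≢i ∘ ≡.sym) (power-isCyclic k (trans eq c≈l))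

    nondominating : ∀ x → ¬ IsDominating E (element x)
    nondominating (inj₁ _) dom =
      c≁d (isCyclic⇒commute (proj₂ (dom d (λ d≈c → c≁d (trans (∙-congˡ d≈c) (∙-congʳ (sym d≈c)))))))
    nondominating (inj₂ i) dom = let (j , j≢i) = other i in
      distinct i j (j≢i ∘ ≡.sym) (proj₂ (dom (l j) (l-distinct j i j≢i)))

    f : Fin 1 ⊎ Fin 3 → Graph.Vertex (properEnhancedPowerGraph G)
    f x = element x , nondominating x

    P : Pred (Graph.Vertex (properEnhancedPowerGraph G)) _
    P y = ∃ λ x → element x ≈ proj₁ y

    f-injective : ∀ x y → element x ≈ element y → x ≡ y
    f-injective (inj₁ 0F) (inj₁ 0F) _  = ≡.refl
    f-injective (inj₁ 0F) (inj₂ j)  eq = ⊥-elim (c≉l j eq)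
    f-injective (inj₂ i)  (inj₁ 0F) eq = ⊥-elim (c≉l i (sym eq))
    f-injective (inj₂ i)  (inj₂ j)  eq with i Fin.≟ j
    ... | yes i≡j = ≡.cong inj₂ i≡j
    ... | no  i≢j = ⊥-elim (l-distinct i j i≢j eq)

    adjacent : ∀ x y → Graph._~_ (K 1 3) x y ⇔ Graph._~_ E (element x) (element y)
    adjacent (inj₁ 0F) (inj₁ 0F) = mk⇔ (λ ()) (λ (c≉c , _) → c≉c refl)
    adjacent (inj₁ 0F) (inj₂ j)  = mk⇔ (λ _ → c≉l j , let (k , eq) = power j in power-isCyclic k eq) (λ _ → tt)
    adjacent (inj₂ i)  (inj₁ 0F) = mk⇔
      (λ _ → (λ eq → c≉l i (sym eq)) , let (k , eq) = power i in isCyclic-sym (power-isCyclic k eq)) (λ _ → tt)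
    adjacent (inj₂ i)  (inj₂ j)  with i Fin.≟ j
    ... | yes ≡.refl = mk⇔ (λ ()) (λ (l≉l , _) → l≉l refl)
    ... | no  i≢j    = mk⇔ (λ ()) (λ (_ , cyc) → distinct i j i≢j cyc)

-- Polynomial functions and 2 × 2 matrices

-- The identities to be solved contain subtraction and integral constants, so coefficients are taken
-- in ℤ and interpreted through the canonical homomorphism to R.
module IntegerSolver (R : CommutativeRing c ℓ) where
  open CommutativeRing R
  -- With this multiplication `1 · 1#` reduces to `1#`, so that `con (+ 1)` denotes `1#` itself and
  -- `con -[1+ 0 ]` denotes `- 1#`.
  open MultTC semiring using (×-homo-+; ×1-homo-*) renaming (_×_ to _·_)
  open RingProperties ring
    using (-0#≈0#; -‿distribˡ-*; -‿distribʳ-*; -‿involutive)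
  open AbelianGroupProperties +-abelianGroup using (⁻¹-∙-comm)
  open SetoidReasoning setoid

  private
    1·_ : ℕ → Carrier
    1· n = n · 1#

    ⟦_⟧ : ℤ → Carrier
    ⟦ + n ⟧      = 1· n
    ⟦ -[1+ n ] ⟧ = - (1· ℕ.suc n)

    ⊖-homo : ∀ m n → ⟦ m ⊖ n ⟧ ≈ 1· m - 1· n
    ⊖-homo ℕ.zero    ℕ.zero    = sym (-‿inverseʳ 0#)
    ⊖-homo ℕ.zero    (ℕ.suc n) = sym (+-identityˡ _)
    ⊖-homo (ℕ.suc m) ℕ.zero    = sym (trans (+-congˡ -0#≈0#) (+-identityʳ _))
    ⊖-homo (ℕ.suc m) (ℕ.suc n) = begin
      ⟦ ℕ.suc m ⊖ ℕ.suc n ⟧               ≡⟨ ≡.cong ⟦_⟧ (ℤ.[1+m]⊖[1+n]≡m⊖n m n) ⟩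
      ⟦ m ⊖ n ⟧                           ≈⟨ ⊖-homo m n ⟩
      1· m - 1· n                         ≈⟨ +-identityˡ _ ⟨
      0# + (1· m - 1· n)                  ≈⟨ +-congʳ (-‿inverseʳ 1#) ⟨
      (1# - 1#) + (1· m - 1· n)           ≈⟨ +-assoc _ _ _ ⟩
      1# + (- 1# + (1· m - 1· n))
          ≈⟨ +-congˡ (trans (sym (+-assoc _ _ _)) (trans (+-congʳ (+-comm _ _)) (+-assoc _ _ _))) ⟩
      1# + (1· m + (- 1# - 1· n))         ≈⟨ +-assoc _ _ _ ⟨
      (1# + 1· m) + (- 1# - 1· n)
          ≈⟨ +-cong (×-homo-+ 1# 1 m) (trans (-‿cong (×-homo-+ 1# 1 n)) (sym (⁻¹-∙-comm 1# (1· n)))) ⟨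
      1· ℕ.suc m - 1· ℕ.suc n             ∎

    -‿homo′ : ∀ i → ⟦ ℤ.- i ⟧ ≈ - ⟦ i ⟧
    -‿homo′ (+ 0)            = sym -0#≈0#
    -‿homo′ (+ (ℕ.suc n))    = refl
    -‿homo′ -[1+ n ]         = sym (-‿involutive _)

    +-homo′ : ∀ i j → ⟦ i ℤ.+ j ⟧ ≈ ⟦ i ⟧ + ⟦ j ⟧
    +-homo′ (+ m)    (+ n)    = ×-homo-+ 1# m n
    +-homo′ (+ m)    -[1+ n ] = ⊖-homo m (ℕ.suc n)
    +-homo′ -[1+ m ] (+ n)    = trans (⊖-homo n (ℕ.suc m)) (+-comm _ _)
    +-homo′ -[1+ m ] -[1+ n ] = begin
      - (1· ℕ.suc (ℕ.suc (m ℕ.+ n)))     ≈⟨ -‿cong (reflexive (≡.cong (λ k → 1· ℕ.suc k) (ℕ.+-suc m n))) ⟨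
      - (1· (ℕ.suc m ℕ.+ ℕ.suc n))       ≈⟨ -‿cong (×-homo-+ 1# (ℕ.suc m) (ℕ.suc n)) ⟩
      - (1· ℕ.suc m + 1· ℕ.suc n)        ≈⟨ ⁻¹-∙-comm _ _ ⟨
      - 1· ℕ.suc m - 1· ℕ.suc n          ∎
      where import Data.Nat.Properties as ℕ

    *-homo⁺ : ∀ m j → ⟦ + m ℤ.* j ⟧ ≈ 1· m * ⟦ j ⟧
    *-homo⁺ m (+ n) = trans (reflexive (≡.cong ⟦_⟧ (≡.sym (ℤ.pos-* m n)))) (×1-homo-* m n)
    *-homo⁺ m -[1+ n ] = begin
      ⟦ + m ℤ.* ℤ.- (+ ℕ.suc n) ⟧        ≡⟨ ≡.cong ⟦_⟧ (ℤ.neg-distribʳ-* (+ m) (+ ℕ.suc n)) ⟨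
      ⟦ ℤ.- (+ m ℤ.* + ℕ.suc n) ⟧        ≈⟨ -‿homo′ (+ m ℤ.* + ℕ.suc n) ⟩
      - ⟦ + m ℤ.* + ℕ.suc n ⟧            ≈⟨ -‿cong (*-homo⁺ m (+ ℕ.suc n)) ⟩
      - (1· m * 1· ℕ.suc n)              ≈⟨ -‿distribʳ-* _ _ ⟩
      1· m * - 1· ℕ.suc n                ∎

    *-homo′ : ∀ i j → ⟦ i ℤ.* j ⟧ ≈ ⟦ i ⟧ * ⟦ j ⟧
    *-homo′ (+ m)    j = *-homo⁺ m j
    *-homo′ -[1+ m ] j = begin
      ⟦ ℤ.- (+ ℕ.suc m) ℤ.* j ⟧          ≡⟨ ≡.cong ⟦_⟧ (ℤ.neg-distribˡ-* (+ ℕ.suc m) j) ⟨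
      ⟦ ℤ.- (+ ℕ.suc m ℤ.* j) ⟧          ≈⟨ -‿homo′ (+ ℕ.suc m ℤ.* j) ⟩
      - ⟦ + ℕ.suc m ℤ.* j ⟧              ≈⟨ -‿cong (*-homo⁺ (ℕ.suc m) j) ⟩
      - (1· ℕ.suc m * ⟦ j ⟧)             ≈⟨ -‿distribˡ-* _ _ ⟩
      - 1· ℕ.suc m * ⟦ j ⟧               ∎

    morphism : ℤ.+-*-rawRing -Raw-AlmostCommutative⟶ fromCommutativeRing R
    morphism = record
      { ⟦_⟧    = ⟦_⟧
      ; +-homo = +-homo′
      ; *-homo = *-homo′
      ; -‿homo = -‿homo′
      ; 0-homo = refl
      ; 1-homo = refl
      }

    _coeff≟_ : ∀ i j → Maybe (⟦ i ⟧ ≈ ⟦ j ⟧)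
    i coeff≟ j = Maybe.map (λ eq → reflexive (≡.cong ⟦_⟧ eq)) (dec⇒maybe (i ℤ.≟ j))

  open Algebra.Solver.Ring ℤ.+-*-rawRing (fromCommutativeRing R) morphism _coeff≟_ public
    using (Polynomial; solve; _:+_; _:*_; _:-_; :-_; _:=_; con)

module Polynomials (R : CommutativeRing c ℓ) where
  open CommutativeRing R
  open IntegerSolver R
  open RingProperties ring using (x∙y⁻¹≈ε⇒x≈y)
  open SetoidReasoning setoid

  -- f is a polynomial function of degree at most m, and a is its coefficient of degree m.
  data IsPolynomial : ℕ → Carrier → (Carrier → Carrier) → Set (c ⊔ ℓ) where
    constant : ∀ {a f} → (∀ t → f t ≈ a) → IsPolynomial 0 a f
    horner   : ∀ {m a f g} b → IsPolynomial m a g → (∀ t → f t ≈ t * g t + b) → IsPolynomial (ℕ.suc m) a f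

  IsPolynomial-resp : ∀ {m a b f g} → a ≈ b → (∀ t → f t ≈ g t) → IsPolynomial m a f → IsPolynomial m b g
  IsPolynomial-resp a≈b f≈g (constant f≈a)  = constant (λ t → trans (sym (f≈g t)) (trans (f≈a t) a≈b))
  IsPolynomial-resp a≈b f≈g (horner e p eq) = horner e (IsPolynomial-resp a≈b (λ _ → refl) p) (λ t → trans (sym (f≈g t)) (eq t))

  IsPolynomial-+ : ∀ {m a b f g} → IsPolynomial m a f → IsPolynomial m b g → IsPolynomial m (a + b) (λ t → f t + g t)
  IsPolynomial-+ (constant p) (constant q) = constant (λ t → +-cong (p t) (q t))
  IsPolynomial-+ (horner {g = f} d p p≈) (horner {g = g} e q q≈) = horner (d + e) (IsPolynomial-+ p q) (λ t →
    trans (+-cong (p≈ t) (q≈ t))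
      (solve 5 (λ t f g d e → (t :* f :+ d) :+ (t :* g :+ e) := t :* (f :+ g) :+ (d :+ e)) refl t (f t) (g t) d e))

  IsPolynomial-scale : ∀ {m a f} k → IsPolynomial m a f → IsPolynomial m (k * a) (λ t → k * f t)
  IsPolynomial-scale k (constant p) = constant (λ t → *-congˡ (p t))
  IsPolynomial-scale k (horner {g = g} e p p≈) = horner (k * e) (IsPolynomial-scale k p) (λ t →
    trans (*-congˡ (p≈ t)) (solve 4 (λ t k g e → k :* (t :* g :+ e) := t :* (k :* g) :+ k :* e) refl t k (g t) e))

  -- Sums are formed at a common degree bound; this pads the summand of lower degree.
  IsPolynomial-raise : ∀ {m a f} → IsPolynomial m a f → IsPolynomial (ℕ.suc m) 0# f
  IsPolynomial-raise {a = a} (constant p) = horner a (constant {a = 0#} {f = λ _ → 0#} (λ _ → refl)) (λ t →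
    trans (p t) (sym (trans (+-congʳ (zeroʳ t)) (+-identityˡ a))))
  IsPolynomial-raise (horner e p p≈) = horner e (IsPolynomial-raise p) p≈

  IsPolynomial-*t : ∀ {m a f} → IsPolynomial m a f → IsPolynomial (ℕ.suc m) a (λ t → t * f t)
  IsPolynomial-*t p = horner 0# p (λ t → sym (+-identityʳ _))

  -- From f = t g + e one gets f(t) - f(r) = (t - r) g(t) + r (g(t) - g(r)), so the quotient is g +
  -- r h with h the quotient for g. The term r h has lower degree, so the leading coefficient is
  -- that of g.
  factor : ∀ {m a f} r → IsPolynomial (ℕ.suc m) a f →
           ∃ λ h → IsPolynomial m a h × (∀ t → f t - f r ≈ (t - r) * h t)
  factor {ℕ.zero} {a} r (horner {g = g} e (constant p) p≈) = (λ _ → a) , constant (λ _ → refl) , λ t → begin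
    _
        ≈⟨ +-cong (trans (p≈ t) (+-congʳ (*-congˡ (p t)))) (-‿cong (trans (p≈ r) (+-congʳ (*-congˡ (p r))))) ⟩
    (t * a + e) - (r * a + e)
        ≈⟨ solve 4 (λ t r a e → (t :* a :+ e) :- (r :* a :+ e) := (t :- r) :* a) refl t r a e ⟩
    (t - r) * a              ∎
  factor {ℕ.suc m} {a} r (horner {g = g} e p p≈) =
    let (h , q , h≈) = factor r p in
    (λ t → g t + r * h t) ,
    IsPolynomial-resp (trans (+-congˡ (zeroʳ r)) (+-identityʳ a)) (λ _ → refl)
      (IsPolynomial-+ p (IsPolynomial-scale r (IsPolynomial-raise q))) , λ t → begin
    _                                        ≈⟨ +-cong (p≈ t) (-‿cong (p≈ r)) ⟩
    (t * g t + e) - (r * g r + e)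
      ≈⟨ solve 5 (λ t r g g′ e → (t :* g :+ e) :- (r :* g′ :+ e) :=
          (t :- r) :* g :+ r :* (g :- g′)) refl t r (g t) (g r) e ⟩
    (t - r) * g t + r * (g t - g r)          ≈⟨ +-congˡ (*-congˡ (h≈ t)) ⟩
    (t - r) * g t + r * ((t - r) * h t)
      ≈⟨ solve 4 (λ t r g h → (t :- r) :* g :+ r :* ((t :- r) :* h) :=
          (t :- r) :* (g :+ r :* h)) refl t r (g t) (h t) ⟩
    (t - r) * (g t + r * h t)                ∎

  module _ (integral : ∀ x y → x * y ≈ 0# → x ≈ 0# ⊎ y ≈ 0#) where
    -- Splitting off one root leaves the others as roots of a quotient with the same leading
    -- coefficient; a constant with a root is zero.
    roots-bound : ∀ {m a f} → IsPolynomial m a f → (r : Fin (ℕ.suc m) → Carrier) →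
                  (∀ i j → r i ≈ r j → i ≡ j) → (∀ i → f (r i) ≈ 0#) → a ≈ 0#
    roots-bound (constant p) r inj root = trans (sym (p (r Fin.zero))) (root Fin.zero)
    roots-bound {ℕ.suc m} {f = f} p r inj root = let (h , q , h≈) = factor (r Fin.zero) p in
      roots-bound q (λ i → r (Fin.suc i)) (λ i j eq → suc-inj (inj _ _ eq)) λ i →
        case-root i (integral _ _ (trans (sym (h≈ (r (Fin.suc i))))
          (trans (+-cong (root (Fin.suc i)) (-‿cong (root Fin.zero))) (-‿inverseʳ 0#))))
      where
      suc-inj : ∀ {k} {i j : Fin k} → Fin.suc i ≡ Fin.suc j → i ≡ j
      suc-inj ≡.refl = ≡.refl
      case-root : ∀ {y} i → r (Fin.suc i) - r Fin.zero ≈ 0# ⊎ y ≈ 0# → y ≈ 0#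
      case-root i (inj₂ y≈0) = y≈0
      case-root i (inj₁ eq) with () ← inj _ _ (x∙y⁻¹≈ε⇒x≈y _ _ eq)

-- Binomial coefficients modulo p and p-th powers of sums

absorption : ∀ n k → ℕ.suc k ℕ.* (ℕ.suc n C ℕ.suc k) ≡ ℕ.suc n ℕ.* (n C k)
absorption ℕ.zero    ℕ.zero    = ≡.refl
absorption ℕ.zero    (ℕ.suc k) = ℕ.*-zeroʳ (ℕ.suc (ℕ.suc k))
absorption (ℕ.suc n) ℕ.zero    = ≡.trans (ℕ.+-identityʳ _)
  (≡.trans (nC1≡n (ℕ.suc (ℕ.suc n))) (≡.sym (ℕ.*-identityʳ (ℕ.suc (ℕ.suc n)))))
absorption (ℕ.suc n) (ℕ.suc k) = begin
  (2 ℕ.+ k) ℕ.* ((2 ℕ.+ n) C (2 ℕ.+ k))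
      ≡⟨ ≡.cong ((2 ℕ.+ k) ℕ.*_) (nCk+nC[k+1]≡[n+1]C[k+1] (ℕ.suc n) (ℕ.suc k)) ⟨
  (2 ℕ.+ k) ℕ.* (x ℕ.+ y)                     ≡⟨ rearrange k x y ⟩
  x ℕ.+ (ℕ.suc k ℕ.* x ℕ.+ (2 ℕ.+ k) ℕ.* y)
      ≡⟨ ≡.cong₂ (λ u v → x ℕ.+ (u ℕ.+ v)) (absorption n k) (absorption n (ℕ.suc k)) ⟩
  x ℕ.+ (ℕ.suc n ℕ.* (n C k) ℕ.+ ℕ.suc n ℕ.* (n C ℕ.suc k))
    ≡⟨ ≡.cong (x ℕ.+_) (ℕ.*-distribˡ-+ (ℕ.suc n) (n C k) (n C ℕ.suc k)) ⟨
  x ℕ.+ ℕ.suc n ℕ.* (n C k ℕ.+ n C ℕ.suc k)   ≡⟨ ≡.cong (λ u → x ℕ.+ ℕ.suc n ℕ.* u) (nCk+nC[k+1]≡[n+1]C[k+1] n k) ⟩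
  (2 ℕ.+ n) ℕ.* x                             ∎
  where
  open ≡.≡-Reasoning
  x = ℕ.suc n C ℕ.suc k
  y = ℕ.suc n C (2 ℕ.+ k)
  rearrange : ∀ k x y → (2 ℕ.+ k) ℕ.* (x ℕ.+ y) ≡ x ℕ.+ (ℕ.suc k ℕ.* x ℕ.+ (2 ℕ.+ k) ℕ.* y)
  rearrange = solve-∀

-- By `absorption` p divides the coefficient times `ℕ.suc k`, and 0 < k + 1 < p.
prime∣C : ∀ {r} → Prime (ℕ.suc r) → ∀ k → k ℕ.< r → ℕ.suc r ∣ ℕ.suc r C ℕ.suc k
prime∣C {r} pr k k<r
  with euclidsLemma (ℕ.suc k) (ℕ.suc r C ℕ.suc k) pr (≡.subst (ℕ.suc r ∣_) (≡.sym (absorption r k)) (m∣m*n (r C k)))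
... | inj₁ p∣k = ⊥-elim (ℕ.<⇒≱ k<r (ℕ.≤-pred (∣⇒≤ p∣k)))
... | inj₂ p∣C = p∣C

module _ (S : Semiring c ℓ) where
  open Semiring S
  open SemiringExp S using (_^_)
  open Mult S using () renaming (_×_ to _·_)
  open SemiringSum S using (sum; sum-cong-≋; sum-replicate-zero; sum-init-last)
  open SetoidReasoning setoid

  -- Only x and y are asked to commute, because the ambient semiring will be that of 2 × 2 matrices,
  -- with x a scalar matrix.
  commuting-freshman : ∀ {p} → Prime p → (∀ {m} x → p ∣ m → m · x ≈ 0#) →
             ∀ x y → x * y ≈ y * x → (x + y) ^ p ≈ x ^ p + y ^ p
  commuting-freshman {ℕ.suc r} pr char x y xy = begin
    (x + y) ^ ℕ.suc r
      ≈⟨ theorem xy (ℕ.suc r) ⟩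
    f Fin.zero + sum (f ∘ Fin.suc)
      ≈⟨ +-congˡ (sum-init-last (f ∘ Fin.suc)) ⟩
    f Fin.zero + (sum (λ i → f (Fin.suc (inject₁ i))) + f (Fin.suc (fromℕ r)))
      ≈⟨ +-cong first (+-cong middle last) ⟩
    y ^ ℕ.suc r + (0# + x ^ ℕ.suc r)
      ≈⟨ +-congˡ (+-identityˡ _) ⟩
    y ^ ℕ.suc r + x ^ ℕ.suc r
      ≈⟨ +-comm _ _ ⟩
    x ^ ℕ.suc r + y ^ ℕ.suc r ∎
    where
    open Binomial S x y using (theorem; binomialTerm)
    f : Fin (ℕ.suc (ℕ.suc r)) → Carrier
    f = binomialTerm (ℕ.suc r)

    first : f Fin.zero ≈ y ^ ℕ.suc r
    first = trans (+-identityʳ _) (*-identityˡ _)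

    middle : sum (λ i → f (Fin.suc (inject₁ i))) ≈ 0#
    middle = trans (sum-cong-≋ λ i → char _ (prime∣C pr _ (≡.subst (ℕ._< r) (≡.sym (Fin.toℕ-inject₁ i)) (Fin.toℕ<n i))))
      (sum-replicate-zero r)

    last : f (Fin.suc (fromℕ r)) ≈ x ^ ℕ.suc r
    last rewrite Fin.toℕ-fromℕ r | nCn≡1 (ℕ.suc r) | ℕ.n∸n≡0 r =
      trans (+-identityʳ _) (*-identityʳ _)

-- The semiring of 2 × 2 matrices and its scalars

module MatrixRing (R : CommutativeRing c ℓ) where
  open CommutativeRing R
  open Matrices R
  open IntegerSolver R

  infixl 6 _+ₘ_

  _+ₘ_ : M₂ → M₂ → M₂
  mat a b c d +ₘ mat e f g h = mat (a + e) (b + f) (c + g) (d + h)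

  scalarₘ : Carrier → M₂
  scalarₘ x = mat x 0# 0# x

  private
    dist : ∀ x y a b c d → x * (a + b) + y * (c + d) ≈ (x * a + y * c) + (x * b + y * d)
    dist = solve 6 (λ x y a b c d → x :* (a :+ b) :+ y :* (c :+ d) := (x :* a :+ y :* c) :+ (x :* b :+ y :* d)) refl
    dist′ : ∀ x y a b c d → (a + b) * x + (c + d) * y ≈ (a * x + c * y) + (b * x + d * y)
    dist′ = solve 6 (λ x y a b c d → (a :+ b) :* x :+ (c :+ d) :* y :=
        (a :* x :+ c :* y) :+ (b :* x :+ d :* y)) refl
    zero-row : ∀ x y → 0# * x + 0# * y ≈ 0#
    zero-row x y = trans (+-cong (zeroˡ x) (zeroˡ y)) (+-identityˡ 0#)
    zero-col : ∀ x y → x * 0# + y * 0# ≈ 0#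
    zero-col x y = trans (+-cong (zeroʳ x) (zeroʳ y)) (+-identityˡ 0#)

  matrixSemiring : Semiring c ℓ
  matrixSemiring = record
    { Carrier = M₂ ; _≈_ = _≈ₘ_ ; _+_ = _+ₘ_ ; _*_ = _*ₘ_ ; 0# = scalarₘ 0# ; 1# = 1ₘ
    ; isSemiring = record
      { isSemiringWithoutAnnihilatingZero = record
        { +-isCommutativeMonoid = record
          { isMonoid = record
            { isSemigroup = record
              { isMagma = record
                { isEquivalence = record { refl = ≈ₘ-refl ; sym = ≈ₘ-sym ; trans = ≈ₘ-trans }
                ; ∙-cong = λ (eqs p q r s) (eqs p′ q′ r′ s′) →
                    eqs (+-cong p p′) (+-cong q q′) (+-cong r r′) (+-cong s s′)
                }
              ; assoc = λ _ _ _ → eqs (+-assoc _ _ _) (+-assoc _ _ _) (+-assoc _ _ _) (+-assoc _ _ _)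
              }
            ; identity = (λ _ → eqs (+-identityˡ _) (+-identityˡ _) (+-identityˡ _) (+-identityˡ _))
                       , (λ _ → eqs (+-identityʳ _) (+-identityʳ _) (+-identityʳ _) (+-identityʳ _))
            }
          ; comm = λ _ _ → eqs (+-comm _ _) (+-comm _ _) (+-comm _ _) (+-comm _ _)
          }
        ; *-cong = *ₘ-cong
        ; *-assoc = *ₘ-assoc
        ; *-identity = *ₘ-identityˡ , *ₘ-identityʳ
        ; distrib = (λ _ _ _ → eqs (dist _ _ _ _ _ _) (dist _ _ _ _ _ _) (dist _ _ _ _ _ _) (dist _ _ _ _ _ _))
                  , (λ _ _ _ → eqs (dist′ _ _ _ _ _ _) (dist′ _ _ _ _ _ _) (dist′ _ _ _ _ _ _) (dist′ _ _ _ _ _ _))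
        }
      ; zero = (λ _ → eqs (zero-row _ _) (zero-row _ _) (zero-row _ _) (zero-row _ _))
             , (λ _ → eqs (zero-col _ _) (zero-col _ _) (zero-col _ _) (zero-col _ _))
      }
    }

  module M = Semiring matrixSemiring
  open SemiringExp matrixSemiring public using () renaming (_^_ to _^ₘ_; ^-congˡ to ^ₘ-congˡ)
  open Exp commutativeSemiring using (_^_)

  Commuteₘ : M₂ → M₂ → Set ℓ
  Commuteₘ A B = A *ₘ B ≈ₘ B *ₘ A

  scalarₘ-* : ∀ x A → scalarₘ x *ₘ A ≈ₘ x • A
  scalarₘ-* x (mat a b c d) = eqs (left a c) (left b d) (right a c) (right b d)
    where
    left : ∀ a c → x * a + 0# * c ≈ x * a
    left a c = trans (+-congˡ (zeroˡ c)) (+-identityʳ _)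
    right : ∀ a c → 0# * a + x * c ≈ x * c
    right a c = trans (+-congʳ (zeroˡ a)) (+-identityˡ _)

  *-scalarₘ : ∀ x A → A *ₘ scalarₘ x ≈ₘ x • A
  *-scalarₘ x (mat a b c d) = eqs (left a b) (right a b) (left c d) (right c d)
    where
    left : ∀ a b → a * x + b * 0# ≈ x * a
    left a b = trans (+-cong (*-comm a x) (zeroʳ b)) (+-identityʳ _)
    right : ∀ a b → a * 0# + b * x ≈ x * b
    right a b = trans (+-cong (zeroʳ a) (*-comm b x)) (+-identityˡ _)

  scalarₘ-commute : ∀ x A → Commuteₘ (scalarₘ x) A
  scalarₘ-commute x A = ≈ₘ-trans (scalarₘ-* x A) (≈ₘ-sym (*-scalarₘ x A))

  scalarₘ-^ : ∀ x k → scalarₘ x ^ₘ k ≈ₘ scalarₘ (x ^ k)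
  scalarₘ-^ x ℕ.zero    = ≈ₘ-refl
  scalarₘ-^ x (ℕ.suc k) = ≈ₘ-trans (*ₘ-cong ≈ₘ-refl (scalarₘ-^ x k)) (≈ₘ-trans (scalarₘ-* x _)
    (eqs refl (zeroʳ x) (zeroʳ x) refl))

  •-^ : ∀ x A k → (x • A) ^ₘ k ≈ₘ (x ^ k) • (A ^ₘ k)
  •-^ x A ℕ.zero    = ≈ₘ-sym (•-identity 1ₘ)
  •-^ x A (ℕ.suc k) = ≈ₘ-trans (*ₘ-cong ≈ₘ-refl (•-^ x A k)) (•-*ₘ x (x ^ k) A (A ^ₘ k))

  -- For invertible matrices this is triviality in PGL.
  record IsScalar (A : M₂) : Set ℓ where
    constructor scalar
    field
      s₁₂ : m₁₂ A ≈ 0#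
      s₂₁ : m₂₁ A ≈ 0#
      s₁₁ : m₁₁ A ≈ m₂₂ A
  open IsScalar public

  IsScalar-resp : ∀ {A B} → A ≈ₘ B → IsScalar A → IsScalar B
  IsScalar-resp (eqs p q r s) (scalar x y z) =
    scalar (trans (sym q) x) (trans (sym r) y) (trans (sym p) (trans z s))

  IsScalar-• : ∀ k {A} → IsScalar A → IsScalar (k • A)
  IsScalar-• k (scalar x y z) = scalar (trans (*-congˡ x) (zeroʳ k)) (trans (*-congˡ y) (zeroʳ k)) (*-congˡ z)

  scalarₘ-isScalar : ∀ x → IsScalar (scalarₘ x)
  scalarₘ-isScalar x = scalar refl refl refl

  isScalar⇒≈ : ∀ {A} → IsScalar A → A ≈ₘ scalarₘ (m₁₁ A)
  isScalar⇒≈ (scalar x y z) = eqs refl x y (sym z)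

-- Centralizers of matrices and subgroups of PGL(2, q)

module Centralizer {p : ℕ} (n : ℕ) (pr : Prime p) (F : FiniteField c ℓ (p ℕ.^ n)) where
  open FiniteField F
  open Frobenius n pr F using (_≟_; integral; ^-zero; p∣m⇒m·x≈0)
  open LinearGroups F using (unit≉0; *≉0)
  open Matrices commutativeRing
  open MatrixRing commutativeRing
  open Polynomials commutativeRing
  open IntegerSolver commutativeRing
  open Exp commutativeSemiring using (_^_)
  open Mult semiring using () renaming (_×_ to _·_)
  open Mult matrixSemiring using () renaming (_×_ to _·ₘ_)
  open RingProperties ring using (x∙y⁻¹≈ε⇒x≈y)
  open SetoidReasoning setoid

  isScalar? : ∀ A → Dec (IsScalar A)
  isScalar? A = map′ (λ (x , y , z) → scalar x y z) (λ (scalar x y z) → x , y , z)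
    ((m₁₂ A ≟ 0#) ×-dec (m₂₁ A ≟ 0#) ×-dec (m₁₁ A ≟ m₂₂ A))

  cancel : ∀ {x y z} → ¬ (x ≈ 0#) → x * y ≈ x * z → y ≈ z
  cancel {x} {y} {z} x≉0 eq = let (w , xw≈1) = invertible x x≉0 in begin
    y              ≈⟨ *-identityˡ y ⟨
    1# * y         ≈⟨ *-congʳ (trans (*-comm w x) xw≈1) ⟨
    (w * x) * y    ≈⟨ *-assoc w x y ⟩
    w * (x * y)    ≈⟨ *-congˡ eq ⟩
    w * (x * z)    ≈⟨ *-assoc w x z ⟨
    (w * x) * z    ≈⟨ *-congʳ (trans (*-comm w x) xw≈1) ⟩
    1# * z         ≈⟨ *-identityˡ z ⟩
    z              ∎

  cancel-0 : ∀ {x y} → ¬ (x ≈ 0#) → x * y ≈ 0# → y ≈ 0#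
  cancel-0 x≉0 eq = cancel x≉0 (trans eq (sym (zeroʳ _)))

  ^≉0 : ∀ {x} k → ¬ (x ≈ 0#) → ¬ (x ^ k ≈ 0#)
  ^≉0 {x} k x≉0 eq = x≉0 (^-zero x k eq)

  IsScalar-•⁻ : ∀ {k A} → ¬ (k ≈ 0#) → IsScalar (k • A) → IsScalar A
  IsScalar-•⁻ k≉0 (scalar x y z) = scalar (cancel-0 k≉0 x) (cancel-0 k≉0 y) (cancel k≉0 z)

  affine-scalar : ∀ {x y V} → ¬ IsScalar V → IsScalar (scalarₘ x +ₘ y • V) → y ≈ 0#
  affine-scalar {x} {y} {V} ¬V (scalar p q r) with y ≟ 0#
  ... | yes y≈0 = y≈0
  ... | no  y≉0 = ⊥-elim (¬V (scalar
    (cancel-0 y≉0 (trans (sym (+-identityˡ _)) p)) (cancel-0 y≉0 (trans (sym (+-identityˡ _)) q))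
    (cancel y≉0 (RingProperties.+-cancelˡ ring x _ _ r))))

  -- A nonscalar 2 × 2 matrix has centralizer F[V]. The coefficient y is read off where V is visibly
  -- nonscalar: f / b, or h / c, or (e - k) / (a - d) for diagonal V. Then x is fixed by the upper
  -- left entry, and the commutation equations give the rest.
  centralizer : ∀ {U V} → ¬ IsScalar V → Commuteₘ U V → ∃₂ λ x y → U ≈ₘ scalarₘ x +ₘ y • V
  centralizer {mat e f h k} {mat a b c d} ¬V (eqs E₁₁ E₁₂ E₂₁ E₂₂) with b ≟ 0# | c ≟ 0#
  ... | no b≉0 | _ = let (b′ , bb′≈1) = invertible b b≉0 ; y = f * b′ in
    e - y * a , y , eqs
      (solve 2 (λ e z → e := (e :- z) :+ z) refl e (y * a))
      (begin
        f                   ≈⟨ *-identityʳ f ⟨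
        f * 1#              ≈⟨ *-congˡ bb′≈1 ⟨
        f * (b * b′)        ≈⟨ solve 3 (λ f b b′ → f :* (b :* b′) := con (+ 0) :+ (f :* b′) :* b) refl f b b′ ⟩
        0# + (f * b′) * b   ∎)
      (begin
        h                   ≈⟨ *-identityʳ h ⟨
        h * 1#              ≈⟨ *-congˡ bb′≈1 ⟨
        h * (b * b′)
            ≈⟨ solve 5 (λ h b b′ e a → h :* (b :* b′) := (a :* e :+ b :* h :- e :* a) :* b′) refl h b b′ e a ⟩
        (a * e + b * h - e * a) * b′ ≈⟨ *-congʳ (+-congʳ E₁₁) ⟨
        (e * a + f * c - e * a) * b′
            ≈⟨ solve 5 (λ e a f c b′ → (e :* a :+ f :* c :- e :* a) :* b′ :=
                con (+ 0) :+ (f :* b′) :* c) refl e a f c b′ ⟩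
        0# + (f * b′) * c   ∎)
      (begin
        k                                                ≈⟨ *-identityʳ k ⟨
        k * 1#                                           ≈⟨ *-congˡ bb′≈1 ⟨
        k * (b * b′)
            ≈⟨ solve 5 (λ k b b′ a f → k :* (b :* b′) := (a :* f :+ b :* k :- a :* f) :* b′) refl k b b′ a f ⟩
        (a * f + b * k - a * f) * b′                     ≈⟨ *-congʳ (+-congʳ E₁₂) ⟨
        (e * b + f * d - a * f) * b′
            ≈⟨ solve 6 (λ e b f d a b′ → (e :* b :+ f :* d :- a :* f) :* b′ :=
                e :* (b :* b′) :- (f :* b′) :* a :+ (f :* b′) :* d) refl e b f d a b′ ⟩
        e * (b * b′) - (f * b′) * a + (f * b′) * d
            ≈⟨ +-congʳ (+-congʳ (trans (*-congˡ bb′≈1) (*-identityʳ e))) ⟩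
        e - (f * b′) * a + (f * b′) * d                  ∎)
  ... | yes b≈0 | no c≉0 = let (c′ , cc′≈1) = invertible c c≉0 ; y = h * c′ in
    e - y * a , y , eqs
      (solve 2 (λ e z → e := (e :- z) :+ z) refl e (y * a))
      (begin
        f                            ≈⟨ *-identityʳ f ⟨
        f * 1#                       ≈⟨ *-congˡ cc′≈1 ⟨
        f * (c * c′)
            ≈⟨ solve 5 (λ f c c′ e a → f :* (c :* c′) := (e :* a :+ f :* c :- e :* a) :* c′) refl f c c′ e a ⟩
        (e * a + f * c - e * a) * c′ ≈⟨ *-congʳ (+-congʳ E₁₁) ⟩
        (a * e + b * h - e * a) * c′
            ≈⟨ solve 5 (λ e a b h c′ → (a :* e :+ b :* h :- e :* a) :* c′ :=
                con (+ 0) :+ (h :* c′) :* b) refl e a b h c′ ⟩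
        0# + (h * c′) * b            ∎)
      (begin
        h                   ≈⟨ *-identityʳ h ⟨
        h * 1#              ≈⟨ *-congˡ cc′≈1 ⟨
        h * (c * c′)        ≈⟨ solve 3 (λ f b b′ → f :* (b :* b′) := con (+ 0) :+ (f :* b′) :* b) refl h c c′ ⟩
        0# + (h * c′) * c   ∎)
      (begin
        k                                                ≈⟨ *-identityʳ k ⟨
        k * 1#                                           ≈⟨ *-congˡ cc′≈1 ⟨
        k * (c * c′)
            ≈⟨ solve 5 (λ k c c′ a h → k :* (c :* c′) := (h :* a :+ k :* c :- h :* a) :* c′) refl k c c′ a h ⟩
        (h * a + k * c - h * a) * c′                     ≈⟨ *-congʳ (+-congʳ E₂₁) ⟩
        (c * e + d * h - h * a) * c′
            ≈⟨ solve 6 (λ e c h d a c′ → (c :* e :+ d :* h :- h :* a) :* c′ :=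
                e :* (c :* c′) :- (h :* c′) :* a :+ (h :* c′) :* d) refl e c h d a c′ ⟩
        e * (c * c′) - (h * c′) * a + (h * c′) * d
            ≈⟨ +-congʳ (+-congʳ (trans (*-congˡ cc′≈1) (*-identityʳ e))) ⟩
        e - (h * c′) * a + (h * c′) * d                  ∎)
  ... | yes b≈0 | yes c≈0 = let (δ , δδ≈1) = invertible (a - d) a-d≉0 ; y = (e - k) * δ in
    e - y * a , y , eqs
      (solve 2 (λ e z → e := (e :- z) :+ z) refl e (y * a))
      (trans f≈0 (sym (trans (+-identityˡ _) (trans (*-congˡ b≈0) (zeroʳ _)))))
      (trans h≈0 (sym (trans (+-identityˡ _) (trans (*-congˡ c≈0) (zeroʳ _)))))
      (begin
        k                                       ≈⟨ solve 2 (λ e k → k := e :- (e :- k) :* con (+ 1)) refl e k ⟩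
        e - (e - k) * 1#                        ≈⟨ +-congˡ (-‿cong (*-congˡ δδ≈1)) ⟨
        e - (e - k) * ((a - d) * δ)
            ≈⟨ solve 5 (λ e k a d δ → e :- (e :- k) :* ((a :- d) :* δ) :=
                e :- ((e :- k) :* δ) :* a :+ ((e :- k) :* δ) :* d) refl e k a d δ ⟩
        e - y * a + y * d                       ∎)
    where
    a-d≉0 : ¬ (a - d ≈ 0#)
    a-d≉0 eq = ¬V (scalar b≈0 c≈0 (x∙y⁻¹≈ε⇒x≈y a d eq))
    f≈0 : f ≈ 0#
    f≈0 = cancel-0 a-d≉0 (begin
      (a - d) * f
          ≈⟨ solve 5 (λ a d f e k → (a :- d) :* f :=
              (a :* f :+ con (+ 0) :* k) :- (e :* con (+ 0) :+ f :* d)) refl a d f e k ⟩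
      (a * f + 0# * k) - (e * 0# + f * d) ≈⟨ +-cong (+-congˡ (*-congʳ b≈0)) (-‿cong (+-congʳ (*-congˡ b≈0))) ⟨
      (a * f + b * k) - (e * b + f * d)   ≈⟨ +-congˡ (-‿cong E₁₂) ⟩
      (a * f + b * k) - (a * f + b * k)   ≈⟨ -‿inverseʳ _ ⟩
      0#                               ∎)
    h≈0 : h ≈ 0#
    h≈0 = cancel-0 a-d≉0 (begin
      (a - d) * h
          ≈⟨ solve 5 (λ a d h e k → (a :- d) :* h :=
              (h :* a :+ k :* con (+ 0)) :- (con (+ 0) :* e :+ d :* h)) refl a d h e k ⟩
      (h * a + k * 0#) - (0# * e + d * h) ≈⟨ +-cong (+-congˡ (*-congˡ c≈0)) (-‿cong (+-congʳ (*-congʳ c≈0))) ⟨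
      (h * a + k * c) - (c * e + d * h)   ≈⟨ +-congˡ (-‿cong E₂₁) ⟨
      (h * a + k * c) - (h * a + k * c)   ≈⟨ -‿inverseʳ _ ⟩
      0#                               ∎)

  -- Here t is an affine coordinate on the nonscalar elements of F[V] modulo scalars, a projective
  -- line without the point of the scalars.
  OnLine : M₂ → M₂ → Set _
  OnLine V U = ∃₂ λ y t → ¬ (y ≈ 0#) × U ≈ₘ y • (scalarₘ t +ₘ V)

  centralizer-line : ∀ {U V} → ¬ IsScalar V → ¬ IsScalar U → Commuteₘ U V → OnLine V U
  centralizer-line {U} {V} ¬V ¬U UV = go (centralizer ¬V UV)
    where
    go : (∃₂ λ x y → U ≈ₘ scalarₘ x +ₘ y • V) → OnLine V U
    go (x , y , U≈) = let (y′ , yy′≈1) = invertible y y≉0 in y , x * y′ , y≉0 , ≈ₘ-trans U≈ (eqs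
        (trans (+-congʳ (on x y′ yy′≈1)) (sym (distribˡ y _ _))) off off
        (trans (+-congʳ (on x y′ yy′≈1)) (sym (distribˡ y _ _))))
      where
      on : ∀ x y′ → y * y′ ≈ 1# → x ≈ y * (x * y′)
      on x y′ yy′≈1 = begin
        x              ≈⟨ *-identityʳ x ⟨
        x * 1#         ≈⟨ *-congˡ yy′≈1 ⟨
        x * (y * y′)   ≈⟨ solve 3 (λ x y z → x :* (y :* z) := y :* (x :* z)) refl x y y′ ⟩
        y * (x * y′)   ∎
      off : ∀ {b} → 0# + y * b ≈ y * (0# + b)
      off = trans (+-identityˡ _) (*-congˡ (sym (+-identityˡ _)))
      y≉0 : ¬ (y ≈ 0#)
      y≉0 y≈0 = ¬U (IsScalar-resp (≈ₘ-sym U≈) (scalar (zero-off y≈0) (zero-off y≈0)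
        (+-congˡ (trans (*-congʳ y≈0) (trans (trans (zeroˡ _) (sym (zeroˡ _))) (*-congʳ (sym y≈0)))))))
        where
        zero-off : ∀ {b} → y ≈ 0# → 0# + y * b ≈ 0#
        zero-off y≈0 = trans (+-identityˡ _) (trans (*-congʳ y≈0) (zeroˡ _))

  ·ₘ-entries : ∀ m A → m ·ₘ A ≈ₘ mat (m · m₁₁ A) (m · m₁₂ A) (m · m₂₁ A) (m · m₂₂ A)
  ·ₘ-entries ℕ.zero    A = ≈ₘ-refl
  ·ₘ-entries (ℕ.suc m) A = M.+-congˡ (·ₘ-entries m A)

  frobenius-affine : ∀ t V → (scalarₘ t +ₘ V) ^ₘ p ≈ₘ scalarₘ (t ^ p) +ₘ V ^ₘ p
  frobenius-affine t V = ≈ₘ-trans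
    (commuting-freshman matrixSemiring pr
      (λ {m} A p∣m → ≈ₘ-trans (·ₘ-entries m A)
        (eqs (p∣m⇒m·x≈0 _ p∣m) (p∣m⇒m·x≈0 _ p∣m) (p∣m⇒m·x≈0 _ p∣m) (p∣m⇒m·x≈0 _ p∣m)))
      (scalarₘ t) V (scalarₘ-commute t V))
    (M.+-congʳ (scalarₘ-^ t p))

  IsScalar-+ : ∀ x {A} → IsScalar A → IsScalar (scalarₘ x +ₘ A)
  IsScalar-+ x (scalar p q r) = scalar (trans (+-identityˡ _) p) (trans (+-identityˡ _) q) (+-congˡ r)

  IsScalar-+⁻ : ∀ x {A} → IsScalar (scalarₘ x +ₘ A) → IsScalar A
  IsScalar-+⁻ x (scalar p q r) = scalar (trans (sym (+-identityˡ _)) p) (trans (sym (+-identityˡ _)) q)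
    (RingProperties.+-cancelˡ ring x _ _ r)

  -- Either all of F[V]ˣ/Fˣ has exponent p, or it has no p-torsion.
  p-torsion : ∀ {U V} → ¬ IsScalar V → ¬ IsScalar U → Commuteₘ U V → IsScalar (U ^ₘ p) → IsScalar (V ^ₘ p)
  p-torsion {U} {V} ¬V ¬U UV Uᵖ = go (centralizer-line ¬V ¬U UV)
    where
    go : OnLine V U → IsScalar (V ^ₘ p)
    go (y , t , y≉0 , U≈) = IsScalar-+⁻ (t ^ p) {V ^ₘ p} (IsScalar-resp (frobenius-affine t V)
      (IsScalar-•⁻ {y ^ p} (^≉0 p y≉0)
      (IsScalar-resp (≈ₘ-trans (^ₘ-congˡ p U≈) (•-^ y (scalarₘ t +ₘ V) p)) Uᵖ)))

  p-exponent : ∀ {U V} → ¬ IsScalar V → Commuteₘ U V → IsScalar (V ^ₘ p) → IsScalar (U ^ₘ p)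
  p-exponent {U} {V} ¬V UV Vᵖ with isScalar? U
  ... | yes U-scalar = IsScalar-resp (≈ₘ-sym (≈ₘ-trans (^ₘ-congˡ p (isScalar⇒≈ U-scalar)) (scalarₘ-^ (m₁₁ U) p)))
                         (scalarₘ-isScalar (m₁₁ U ^ p))
  ... | no ¬U = go (centralizer-line ¬V ¬U UV)
    where
    go : OnLine V U → IsScalar (U ^ₘ p)
    go (y , t , y≉0 , U≈) = IsScalar-resp
      (≈ₘ-sym (≈ₘ-trans (^ₘ-congˡ p U≈) (•-^ y (scalarₘ t +ₘ V) p)))
      (IsScalar-• (y ^ p) (IsScalar-resp (≈ₘ-sym (frobenius-affine t V)) (IsScalar-+ (t ^ p) {V ^ₘ p} Vᵖ)))

  module _ (V : M₂) where
    private
      τ δ : Carrier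
      τ = m₁₁ V + m₂₂ V
      δ = det V

    -- Coordinates of (t + V)^k in the basis 1, V of F[V]; the recursion is Cayley-Hamilton, V² = τ
    -- V - δ.
    mutual
      P Q : ℕ → Carrier → Carrier
      P ℕ.zero    t = 1#
      P (ℕ.suc k) t = t * P k t + - δ * Q k t
      Q ℕ.zero    t = 0#
      Q (ℕ.suc k) t = P k t + (t * Q k t + τ * Q k t)

    affine-^ : ∀ t k → (scalarₘ t +ₘ V) ^ₘ k ≈ₘ scalarₘ (P k t) +ₘ Q k t • V
    affine-^ t ℕ.zero    = eqs one null null one
      where
      one : ∀ {x} → 1# ≈ 1# + 0# * x
      one = sym (trans (+-congˡ (zeroˡ _)) (+-identityʳ _))
      null : ∀ {x} → 0# ≈ 0# + 0# * x
      null = sym (trans (+-congˡ (zeroˡ _)) (+-identityʳ _))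
    affine-^ t (ℕ.suc k) = ≈ₘ-trans (*ₘ-cong ≈ₘ-refl (affine-^ t k)) (eqs
      (solve 7 (λ a b c d t x y → (t :+ a) :* (x :+ y :* a) :+ (con (+ 0) :+ b) :* (con (+ 0) :+ y :* c) :=
        (t :* x :+ (:- (a :* d :- b :* c)) :* y) :+ (x :+ (t :* y :+ (a :+ d) :* y)) :* a)
        refl (m₁₁ V) (m₁₂ V) (m₂₁ V) (m₂₂ V) t (P k t) (Q k t))
      (solve 7 (λ a b c d t x y → (t :+ a) :* (con (+ 0) :+ y :* b) :+ (con (+ 0) :+ b) :* (x :+ y :* d) :=
        con (+ 0) :+ (x :+ (t :* y :+ (a :+ d) :* y)) :* b)
        refl (m₁₁ V) (m₁₂ V) (m₂₁ V) (m₂₂ V) t (P k t) (Q k t))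
      (solve 7 (λ a b c d t x y → (con (+ 0) :+ c) :* (x :+ y :* a) :+ (t :+ d) :* (con (+ 0) :+ y :* c) :=
        con (+ 0) :+ (x :+ (t :* y :+ (a :+ d) :* y)) :* c)
        refl (m₁₁ V) (m₁₂ V) (m₂₁ V) (m₂₂ V) t (P k t) (Q k t))
      (solve 7 (λ a b c d t x y → (con (+ 0) :+ c) :* (con (+ 0) :+ y :* b) :+ (t :+ d) :* (x :+ y :* d) :=
        (t :* x :+ (:- (a :* d :- b :* c)) :* y) :+ (x :+ (t :* y :+ (a :+ d) :* y)) :* d)
        refl (m₁₁ V) (m₁₂ V) (m₂₁ V) (m₂₂ V) t (P k t) (Q k t)))

    -- At each step the leading coefficient of `Q` gains the 1 contributed by `P`, which makes it k
    -- + 1 in degree k; the terms with τ and δ are of lower degree.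
    mutual
      P-polynomial : ∀ k → IsPolynomial (ℕ.suc k) 1# (P (ℕ.suc k))
      P-polynomial ℕ.zero    = IsPolynomial-resp (trans (+-congˡ (zeroʳ _)) (+-identityʳ 1#)) (λ _ → refl)
        (IsPolynomial-+ (IsPolynomial-*t {a = 1#} (constant (λ _ → refl)))
          (IsPolynomial-scale (- δ) (IsPolynomial-raise {a = 0#} (constant (λ _ → refl)))))
      P-polynomial (ℕ.suc k) = IsPolynomial-resp (trans (+-congˡ (zeroʳ _)) (+-identityʳ 1#)) (λ _ → refl)
        (IsPolynomial-+ (IsPolynomial-*t (P-polynomial k))
          (IsPolynomial-scale (- δ) (IsPolynomial-raise (IsPolynomial-raise (Q-polynomial k)))))

      Q-polynomial : ∀ k → IsPolynomial k (ℕ.suc k · 1#) (Q (ℕ.suc k))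
      Q-polynomial ℕ.zero    = constant (λ t → +-congˡ (trans (+-cong (zeroʳ t) (zeroʳ τ)) (+-identityˡ 0#)))
      Q-polynomial (ℕ.suc k) = IsPolynomial-resp (+-congˡ (trans (+-congˡ (zeroʳ τ)) (+-identityʳ _))) (λ _ → refl)
        (IsPolynomial-+ (P-polynomial k) (IsPolynomial-+ (IsPolynomial-*t (Q-polynomial k))
          (IsPolynomial-scale τ (IsPolynomial-raise (Q-polynomial k)))))

    -- d-torsion of F[V]ˣ/Fˣ other than 1: roots of the polynomial Q d of degree d − 1.
    torsion-bound : ¬ IsScalar V → ∀ k → ¬ (ℕ.suc k · 1# ≈ 0#) → (Z : Fin (ℕ.suc k) → M₂) →
      (∀ i → Commuteₘ (Z i) V) → (∀ i → ¬ IsScalar (Z i)) → (∀ i → IsScalar (Z i ^ₘ ℕ.suc k)) →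
      (∀ i j x → ¬ (x ≈ 0#) → Z i ≈ₘ x • Z j → i ≡ j) → ⊥
    torsion-bound ¬V k k≉0 Z ZV ¬Z Zᵏ distinct =
      k≉0 (roots-bound integral (Q-polynomial k) root injective vanishes)
      where
      line : ∀ i → OnLine V (Z i)
      line i = centralizer-line ¬V (¬Z i) (ZV i)
      root : Fin (ℕ.suc k) → Carrier
      root i = proj₁ (proj₂ (line i))
      vanish : ∀ {W} → IsScalar (W ^ₘ ℕ.suc k) → (l : OnLine V W) → Q (ℕ.suc k) (proj₁ (proj₂ l)) ≈ 0#
      vanish Wᵏ (y , t , y≉0 , W≈) = affine-scalar {P (ℕ.suc k) t} {Q (ℕ.suc k) t} ¬V
        (IsScalar-resp (affine-^ t (ℕ.suc k))
          (IsScalar-•⁻ {y ^ ℕ.suc k} {(scalarₘ t +ₘ V) ^ₘ ℕ.suc k} (^≉0 (ℕ.suc k) y≉0)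
            (IsScalar-resp (≈ₘ-trans (^ₘ-congˡ (ℕ.suc k) W≈) (•-^ y (scalarₘ t +ₘ V) (ℕ.suc k))) Wᵏ)))
      vanishes : ∀ i → Q (ℕ.suc k) (root i) ≈ 0#
      vanishes i = vanish (Zᵏ i) (line i)
      proportional : ∀ {W W′} (l : OnLine V W) (l′ : OnLine V W′) → proj₁ (proj₂ l) ≈ proj₁ (proj₂ l′) →
                     ∃ λ x → ¬ (x ≈ 0#) × W ≈ₘ x • W′
      proportional (y , t , y≉0 , W≈) (y′ , t′ , y′≉0 , W′≈) t≈t′ =
        let (w , y′w≈1) = invertible y′ y′≉0
            w≉0 = unit≉0 (trans (*-comm w y′) y′w≈1)
        in y * w , *≉0 y≉0 w≉0 , ≈ₘ-trans W≈
          (≈ₘ-trans (•-cong refl (M.+-congʳ (eqs t≈t′ refl refl t≈t′)))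
          (≈ₘ-sym (≈ₘ-trans (•-cong refl W′≈) (≈ₘ-trans (≈ₘ-sym (•-assoc (y * w) y′ _))
            (•-cong (trans (*-assoc y w y′) (trans (*-congˡ (trans (*-comm w y′) y′w≈1)) (*-identityʳ y))) ≈ₘ-refl)))))
      injective : ∀ i j → root i ≈ root j → i ≡ j
      injective i j t≈t′ = let (x , x≉0 , eq) = proportional (line i) (line j) t≈t′ in distinct i j x x≉0 eq

-- Groups embedded in PGL(2, q): transitivity of adjacency

prime∤⇒coprime : ∀ {p m} → Prime p → ¬ (p ∣ m) → Coprime m p
prime∤⇒coprime pr p∤m (d∣m , d∣p) with prime⇒irreducible pr d∣p
... | inj₁ d≡1    = d≡1
... | inj₂ ≡.refl = ⊥-elim (p∤m d∣m)

module _ {p : ℕ} (n : ℕ) (pr : Prime p) (F : FiniteField c ℓ (p ℕ.^ n)) where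
  open FiniteField F
  open Frobenius n pr F using (to-injective; p∣m⇒m·x≈0)
  open Matrices commutativeRing
  open MatrixRing commutativeRing
  open Centralizer n pr F
  open LinearGroups F using (InvertibleMatrix; matrix; _∼_; scaled)
  open Mult semiring using (×-assocˡ; ×-congˡ; ×-congʳ) renaming (_×_ to _·′_)
  open Inverse enumeration using (to)

  -- The group is only assumed to embed, since elements of G also carry an automorphism component.
  -- Products and inverses are matched exactly by matrices and equality only modulo scalars, so
  -- powers in the group can be compared with powers of matrices.
  module Embedded {a h} (H : Group a h) (embed : Group.Carrier H → InvertibleMatrix)
    (embed-∙ : ∀ x y → matrix (embed (Group._∙_ H x y)) ≈ₘ matrix (embed x) *ₘ matrix (embed y))
    (embed-ε : matrix (embed (Group.ε H)) ≈ₘ 1ₘ)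
    (embed-⁻¹ : ∀ x → matrix (embed (Group._⁻¹ H x)) ≈ₘ InvertibleMatrix.inverse (embed x))
    (embed-cong : ∀ {x y} → Group._≈_ H x y → embed x ∼ embed y)
    (embed-injective : ∀ {x y} → embed x ∼ embed y → Group._≈_ H x y)
    where
    private
      module H = Group H
    open GroupPowers H

    matrixOf : H.Carrier → M₂
    matrixOf x = matrix (embed x)

    matrixOf-· : ∀ k x → matrixOf (k · x) ≈ₘ matrixOf x ^ₘ k
    matrixOf-· ℕ.zero    x = embed-ε
    matrixOf-· (ℕ.suc k) x = ≈ₘ-trans (embed-∙ x (k · x)) (*ₘ-cong ≈ₘ-refl (matrixOf-· k x))

    ∝⇒≈ : ∀ {x y} k → ¬ (k ≈ 0#) → matrixOf x ≈ₘ k • matrixOf y → x H.≈ y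
    ∝⇒≈ k k≉0 eq = embed-injective (scaled k k≉0 eq)

    ≈ₘ⇒≈ : ∀ {x y} → matrixOf x ≈ₘ matrixOf y → x H.≈ y
    ≈ₘ⇒≈ eq = ∝⇒≈ 1# 1≉0 (≈ₘ-trans eq (≈ₘ-sym (•-identity _)))

    ≈ε⇒scalar : ∀ {x} → x H.≈ H.ε → IsScalar (matrixOf x)
    ≈ε⇒scalar {x} x≈ε = go (embed-cong x≈ε)
      where
      go : embed x ∼ embed H.ε → IsScalar (matrixOf x)
      go (scaled k k≉0 eq) = IsScalar-resp (≈ₘ-sym (≈ₘ-trans eq (•-cong refl embed-ε)))
        (IsScalar-• k {1ₘ} (scalar refl refl refl))

    scalar⇒≈ε : ∀ x → IsScalar (matrixOf x) → x H.≈ H.ε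
    scalar⇒≈ε x X-scalar = ∝⇒≈ (m₁₁ (matrixOf x)) m≉0 (≈ₘ-trans (isScalar⇒≈ X-scalar)
      (≈ₘ-trans (eqs (sym (*-identityʳ _)) (sym (zeroʳ _)) (sym (zeroʳ _)) (sym (*-identityʳ _)))
        (•-cong refl (≈ₘ-sym embed-ε))))
      where
      m≉0 : ¬ (m₁₁ (matrixOf x) ≈ 0#)
      m≉0 m≈0 = 1≉0 (trans (sym (_≈ₘ_.e₁₁ (InvertibleMatrix.inverseʳ (embed x))))
        (trans (+-cong (trans (*-congʳ m≈0) (zeroˡ _)) (trans (*-congʳ (s₁₂ X-scalar)) (zeroˡ _))) (+-identityˡ 0#)))

    _≟ε : ∀ x → Dec (x H.≈ H.ε)
    x ≟ε = map′ (scalar⇒≈ε x) ≈ε⇒scalar (isScalar? (matrixOf x))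

    _≟H_ : Decidable H._≈_
    x ≟H y = map′ (GroupProperties.x∙y⁻¹≈ε⇒x≈y H x y) (GroupProperties.x≈y⇒x∙y⁻¹≈ε H) ((x H.∙ y H.⁻¹) ≟ε)

    commute-•ʳ : ∀ {M A} k → Commuteₘ M A → Commuteₘ M (k • A)
    commute-•ʳ {M} {A} k MA = M.trans (M.*-congˡ {M} (≈ₘ-sym (scalarₘ-* k A)))
      (M.trans (M.sym (M.*-assoc M (scalarₘ k) A))
      (M.trans (M.*-congʳ {A} (M.sym (scalarₘ-commute k M)))
      (M.trans (M.*-assoc (scalarₘ k) M A)
      (M.trans (M.*-congˡ {scalarₘ k} MA)
      (M.trans (M.sym (M.*-assoc (scalarₘ k) A M)) (M.*-congʳ {M} (scalarₘ-* k A)))))))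

    commute-resp : ∀ {M A B} → A ≈ₘ B → Commuteₘ M A → Commuteₘ M B
    commute-resp {M} eq MA = M.trans (M.*-congˡ {M} (M.sym eq)) (M.trans MA (M.*-congʳ {M} eq))

    commute-*ʳ : ∀ {M A B} → Commuteₘ M A → Commuteₘ M B → Commuteₘ M (A *ₘ B)
    commute-*ʳ {M} {A} {B} MA MB = M.trans (M.sym (M.*-assoc M A B)) (M.trans (M.*-congʳ {B} MA)
      (M.trans (M.*-assoc A M B) (M.trans (M.*-congˡ {A} MB) (M.sym (M.*-assoc A B M)))))

    commute-inverse : ∀ {M A A′} → A *ₘ A′ ≈ₘ 1ₘ → A′ *ₘ A ≈ₘ 1ₘ → Commuteₘ M A → Commuteₘ M A′
    commute-inverse {M} {A} {A′} AA′ A′A MA = M.sym (M.trans (M.sym (M.*-identityʳ _))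
      (M.trans (M.*-congˡ {A′ *ₘ M} (M.sym AA′)) (M.trans (M.sym (M.*-assoc (A′ *ₘ M) A A′))
      (M.*-congʳ {A′} (M.trans (M.*-assoc A′ M A) (M.trans (M.*-congˡ {A′} MA)
        (M.trans (M.sym (M.*-assoc A′ A M)) (M.trans (M.*-congʳ {M} A′A) (M.*-identityˡ M)))))))))

    commute-affine : ∀ {M V x y} → Commuteₘ M V → Commuteₘ M (scalarₘ x +ₘ y • V)
    commute-affine {M} {V} {x} {y} MV = M.trans (M.distribˡ M (scalarₘ x) (y • V))
      (M.trans (M.+-cong (M.sym (scalarₘ-commute x M)) (commute-•ʳ y MV)) (M.sym (M.distribʳ M (scalarₘ x) (y • V))))

    commute-≈ : ∀ {M x g} → Commuteₘ M (matrixOf g) → x H.≈ g → Commuteₘ M (matrixOf x)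
    commute-≈ {M} {x} {g} Mg x≈g = go (embed-cong x≈g)
      where
      go : embed x ∼ embed g → Commuteₘ M (matrixOf x)
      go (scaled k _ eq) = commute-resp (≈ₘ-sym eq) (commute-•ʳ k Mg)

    generated-commuteₘ : ∀ {X : Pred H.Carrier t} {M} → (∀ {x} → x ∈ X → Commuteₘ M (matrixOf x)) →
                         ∀ {x} → x ∈ Generated H X → Commuteₘ M (matrixOf x)
    generated-commuteₘ MX (gen x∈X) = MX x∈X
    generated-commuteₘ MX (gen-≈ x≈y p) = commute-≈ (generated-commuteₘ MX p) (H.sym x≈y)
    generated-commuteₘ {M = M} MX gen-ε = commute-resp (≈ₘ-sym embed-ε) (M.trans (*ₘ-identityʳ M) (M.sym (*ₘ-identityˡ M)))
    generated-commuteₘ MX (gen-∙ {x} {y} p q) =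
      commute-resp (≈ₘ-sym (embed-∙ x y)) (commute-*ʳ (generated-commuteₘ MX p) (generated-commuteₘ MX q))
    generated-commuteₘ MX (gen-⁻¹ {x} p) = commute-resp (≈ₘ-sym (embed-⁻¹ x))
      (commute-inverse (InvertibleMatrix.inverseʳ (embed x)) (InvertibleMatrix.inverseˡ (embed x))
        (generated-commuteₘ MX p))

    -- This lifts commutation from PGL to matrices: members of ⟨g⟩ are powers of the matrix of g up
    -- to scalars, and scalars commute with everything.
    cyclic-commuteₘ : ∀ {M g x} → Commuteₘ M (matrixOf g) → x ∈ Generated H (H._≈ g) → Commuteₘ M (matrixOf x)
    cyclic-commuteₘ Mg = generated-commuteₘ (commute-≈ Mg)

    -- The four entries encode a matrix over the finite field, so two powers of x have the same
    -- matrix by the pigeonhole principle.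
    finite-order : ∀ x → ∃ λ N → ℕ.suc N · x H.≈ H.ε
    finite-order x = go (Fin.pigeonhole (ℕ.n<1+n _) (λ i → code (matrixOf (Fin.toℕ i · x))))
      where
      code : M₂ → Fin _
      code A = Fin.combine (Fin.combine (to (m₁₁ A)) (to (m₁₂ A))) (Fin.combine (to (m₂₁ A)) (to (m₂₂ A)))
      code-injective : ∀ A B → code A ≡ code B → A ≈ₘ B
      code-injective A B eq = let (p , q) = Fin.combine-injective _ _ _ _ eq
                                  (e₁ , e₂) = Fin.combine-injective _ _ _ _ p
                                  (e₃ , e₄) = Fin.combine-injective _ _ _ _ q
        in eqs (to-injective e₁) (to-injective e₂) (to-injective e₃) (to-injective e₄)
      go : (∃₂ λ i j → i Fin.< j × code (matrixOf (Fin.toℕ i · x)) ≡ code (matrixOf (Fin.toℕ j · x))) →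
           ∃ λ N → ℕ.suc N · x H.≈ H.ε
      go (i , j , i<j , eq) with ℕ.m≤n⇒∃[o]m+o≡n i<j
      ... | o , 1+i+o≡j = o , GroupProperties.∙-cancelˡ H (Fin.toℕ i · x) (ℕ.suc o · x) H.ε
        (H.trans (H.sym (·-homo-+ x (Fin.toℕ i) (ℕ.suc o)))
        (H.trans (·-congˡ (≡.trans (ℕ.+-suc (Fin.toℕ i) o) 1+i+o≡j))
        (H.trans (≈ₘ⇒≈ (≈ₘ-sym (code-injective _ _ eq))) (H.sym (H.identityʳ _)))))

    private
      ·′-0 : ∀ k → k ·′ 0# ≈ 0#
      ·′-0 ℕ.zero    = refl
      ·′-0 (ℕ.suc k) = trans (+-identityˡ _) (·′-0 k)

    -- An element y of order dividing d outside ⟨u^e⟩ would, with the nontrivial powers of u^e, give d nontrivial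
    -- solutions of y^d = 1 in F[V]ˣ/Fˣ.
    torsion-in-cyclic : ∀ {V u} → ¬ IsScalar V → ¬ IsScalar (V ^ₘ p) → Commuteₘ (matrixOf u) V → ∀ d e →
      (∀ k → 0 ℕ.< k → k ℕ.< d ℕ.* e → ¬ (k · u H.≈ H.ε)) → (d ℕ.* e) · u H.≈ H.ε → 0 ℕ.< d ℕ.* e →
      ∀ {y} → Commuteₘ (matrixOf y) V → d · y H.≈ H.ε → ∃ λ i → y H.≈ i · (e · u)
    torsion-in-cyclic {V} {u} ¬V ¬Vᵖ uV d@(ℕ.suc d′) ℕ.zero min eu 0< yV dy =
      ⊥-elim (ℕ.<-irrefl ≡.refl (≡.subst (0 ℕ.<_) (ℕ.*-zeroʳ d) 0<))
    torsion-in-cyclic {V} {u} ¬V ¬Vᵖ uV d@(ℕ.suc d′) e@(ℕ.suc _) min deu _ {y} yV dy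
      with Fin.any? (λ (i : Fin d) → y ≟H (Fin.toℕ i · (e · u)))
    ... | yes (i , eq) = Fin.toℕ i , eq
    ... | no none = ⊥-elim (torsion-bound V ¬V d′ d≉0 (matrixOf ∘ z) zV nontrivial torsion distinct)
      where
      -- The leading coefficient of the torsion polynomial. If p divides d = q p, then
      -- `(q ℕ.* e) · u` is nontrivial and killed by p, and `p-torsion` makes V^p scalar. Otherwise
      -- d and p are coprime and cannot both vanish in F.
      d≉0 : ¬ (d ·′ 1# ≈ 0#)
      d≉0 d·1≈0 with p ∣? d
      ... | yes (divides q d≡qp) = ¬Vᵖ (p-torsion ¬V (min′ ∘ scalar⇒≈ε _) (powers (q ℕ.* e) u uV)
            (IsScalar-resp (matrixOf-· p ((q ℕ.* e) · u)) (≈ε⇒scalar (H.trans (·-assocˡ u p (q ℕ.* e))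
              (H.trans (·-congˡ p*qe≡) deu)))))
        where
        p*qe≡ : p ℕ.* (q ℕ.* e) ≡ d ℕ.* e
        p*qe≡ = ≡.trans (≡.sym (ℕ.*-assoc p q e)) (≡.cong (ℕ._* e) (≡.trans (ℕ.*-comm p q) (≡.sym d≡qp)))
        powers : ∀ k x → Commuteₘ (matrixOf x) V → Commuteₘ (matrixOf (k · x)) V
        powers k x xV = M.sym (cyclic-commuteₘ (M.sym xV) (Generated-· k ∈cyclic-refl))
        q*e≢0 : 0 ℕ.< q ℕ.* e
        q*e≢0 = ℕ.n≢0⇒n>0 λ qe≡0 → case ≡.trans (≡.sym p*qe≡) (≡.trans (≡.cong (p ℕ.*_) qe≡0) (ℕ.*-zeroʳ p)) of λ ()
        min′ : ¬ ((q ℕ.* e) · u H.≈ H.ε)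
        min′ = min (q ℕ.* e) q*e≢0 (≡.subst (q ℕ.* e ℕ.<_) (≡.trans (ℕ.*-comm (q ℕ.* e) p) p*qe≡)
          (ℕ.m<m*n (q ℕ.* e) p {{ℕ.>-nonZero q*e≢0}} (ℕ.nonTrivial⇒n>1 p {{prime⇒nonTrivial pr}})))
      ... | no p∤d with Coprime.coprime-Bézout (prime∤⇒coprime pr p∤d)
      ...   | GCD.Bézout.Identity.+- x y eq = 1≉0
              (trans (sym (trans (+-congˡ (p∣m⇒m·x≈0 1# (divides y ≡.refl))) (+-identityʳ 1#)))
              (trans (×-congˡ eq) (trans (sym (×-assocˡ 1# x d)) (trans (×-congʳ x d·1≈0) (·′-0 x)))))
      ...   | GCD.Bézout.Identity.-+ x y eq = 1≉0 (trans (sym (trans (+-congˡ (trans (sym (×-assocˡ 1# x d))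
              (trans (×-congʳ x d·1≈0) (·′-0 x)))) (+-identityʳ 1#)))
              (trans (×-congˡ eq) (p∣m⇒m·x≈0 1# (divides y ≡.refl))))

      z : Fin d → H.Carrier
      z Fin.zero    = y
      z (Fin.suc i) = ℕ.suc (Fin.toℕ i) · (e · u)

      zV : ∀ i → Commuteₘ (matrixOf (z i)) V
      zV Fin.zero    = yV
      zV (Fin.suc i) = M.sym (cyclic-commuteₘ (M.sym uV) (Generated-· (ℕ.suc (Fin.toℕ i)) (Generated-· e ∈cyclic-refl)))

      injective-< : ∀ i j → i ℕ.< j → j ℕ.< d → ¬ (i · (e · u) H.≈ j · (e · u))
      injective-< i j i<j j<d eq with ℕ.m≤n⇒∃[o]m+o≡n i<j
      ... | o , 1+i+o≡j = min (ℕ.suc o ℕ.* e) (ℕ.s≤s ℕ.z≤n)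
        (ℕ.*-monoˡ-< e (ℕ.≤-<-trans (ℕ.≤-trans (ℕ.m≤n+m (ℕ.suc o) i) (ℕ.≤-reflexive i+1+o≡j)) j<d))
        (H.trans (H.sym (·-assocˡ u (ℕ.suc o) e)) (GroupProperties.∙-cancelˡ H (i · (e · u)) _ _
          (H.trans (H.sym (·-homo-+ (e · u) i (ℕ.suc o)))
            (H.trans (·-congˡ i+1+o≡j) (H.trans (H.sym eq) (H.sym (H.identityʳ _)))))))
        where i+1+o≡j = ≡.trans (ℕ.+-suc i o) 1+i+o≡j

      injective : ∀ i j → i ℕ.< d → j ℕ.< d → i · (e · u) H.≈ j · (e · u) → i ≡ j
      injective i j i<d j<d eq with ℕ.<-cmp i j
      ... | tri< i<j _ _ = ⊥-elim (injective-< i j i<j j<d eq)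
      ... | tri≈ _ i≡j _ = i≡j
      ... | tri> _ _ j<i = ⊥-elim (injective-< j i j<i i<d (H.sym eq))

      nontrivial : ∀ i → ¬ IsScalar (matrixOf (z i))
      nontrivial Fin.zero    sc = none (Fin.zero , scalar⇒≈ε y sc)
      nontrivial (Fin.suc i) sc =
        case injective (ℕ.suc (Fin.toℕ i)) 0 (ℕ.s≤s (Fin.toℕ<n i)) (ℕ.s≤s ℕ.z≤n) (scalar⇒≈ε _ sc) of λ ()

      z-torsion : ∀ i → d · z i H.≈ H.ε
      z-torsion Fin.zero    = dy
      z-torsion (Fin.suc i) = H.trans (·-swap (e · u) d (ℕ.suc (Fin.toℕ i)))
        (H.trans (·-congʳ (ℕ.suc (Fin.toℕ i)) (H.trans (·-assocˡ u d e) deu)) (·-ε (ℕ.suc (Fin.toℕ i))))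

      torsion : ∀ i → IsScalar (matrixOf (z i) ^ₘ d)
      torsion i = IsScalar-resp (matrixOf-· d (z i)) (≈ε⇒scalar (z-torsion i))

      distinct′ : ∀ i j → z i H.≈ z j → i ≡ j
      distinct′ Fin.zero    Fin.zero    _  = ≡.refl
      distinct′ Fin.zero    (Fin.suc j) eq = ⊥-elim (none (Fin.suc j , eq))
      distinct′ (Fin.suc i) Fin.zero    eq = ⊥-elim (none (Fin.suc i , H.sym eq))
      distinct′ (Fin.suc i) (Fin.suc j) eq =
        Fin.toℕ-injective (injective _ _ (ℕ.s≤s (Fin.toℕ<n i)) (ℕ.s≤s (Fin.toℕ<n j)) eq)

      distinct : ∀ i j x → ¬ (x ≈ 0#) → matrixOf (z i) ≈ₘ x • matrixOf (z j) → i ≡ j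
      distinct i j x x≉0 eq = distinct′ i j (∝⇒≈ x x≉0 eq)

    adjacency-transitive : ∀ {v u w} → ¬ (v H.≈ H.ε) → ¬ (u H.≈ H.ε) → IsCyclic H (⟨_,_⟩ H v u) →
                           IsCyclic H (⟨_,_⟩ H v w) → IsCyclic H (⟨_,_⟩ H u w)
    adjacency-transitive {v} {u} {w} v≉ε u≉ε vu vw with isScalar? (matrixOf v ^ₘ p)
    ... | no ¬Vᵖ = torsion⇒isCyclic _≟H_ (proj₁ (finite-order u)) (proj₁ (finite-order w)) uw
          (proj₂ (finite-order u)) (proj₂ (finite-order w))
          λ d e min deu 0< y∈ dy → torsion-in-cyclic {matrixOf v} ¬V ¬Vᵖ (adjacent vu) d e min deu 0<
            (M.sym (generated-commuteₘ (λ { (inj₁ z≈u) → commute-≈ (M.sym (adjacent vu)) z≈u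
                                          ; (inj₂ z≈w) → commute-≈ (M.sym (adjacent vw)) z≈w }) y∈)) dy
      where
      ¬V : ¬ IsScalar (matrixOf v)
      ¬V = v≉ε ∘ scalar⇒≈ε v
      adjacent : ∀ {x} → IsCyclic H (⟨_,_⟩ H v x) → Commuteₘ (matrixOf x) (matrixOf v)
      adjacent (g , to , from) = M.sym (cyclic-commuteₘ (M.sym (cyclic-commuteₘ M.refl (to pairˡ))) (to pairʳ))
      -- u is a polynomial in V, and w commutes with V.
      uw : Commute u w
      uw = go (centralizer ¬V (adjacent vu))
        where
        go : (∃₂ λ x y → matrixOf u ≈ₘ scalarₘ x +ₘ y • matrixOf v) → Commute u w
        go (x , y , u≈) = ≈ₘ⇒≈ (≈ₘ-trans (embed-∙ u w) (≈ₘ-trans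
          (M.sym (commute-resp (M.sym u≈) (commute-affine (adjacent vw)))) (≈ₘ-sym (embed-∙ w u))))
    ... | yes Vᵖ = powers-isCyclic (proj₁ (power vu)) (proj₁ (power vw)) u≉ε (proj₂ (power vu)) (proj₂ (power vw))
      where
      exponent : ∀ {x} → Commuteₘ (matrixOf x) (matrixOf v) → p · x H.≈ H.ε
      exponent {x} xV = scalar⇒≈ε (p · x) (IsScalar-resp (≈ₘ-sym (matrixOf-· p x)) (p-exponent (v≉ε ∘ scalar⇒≈ε v) xV Vᵖ))
      suc-pred-p : ℕ.suc (ℕ.pred p) ≡ p
      suc-pred-p = ℕ.suc-pred p {{prime⇒nonZero pr}}
      -- The common generator g commutes with V, so it is killed by p. As v = i · g is nontrivial, p
      -- does not divide i, and v generates ⟨g⟩.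
      power : ∀ {x} → IsCyclic H (⟨_,_⟩ H v x) → ∃ λ k → x H.≈ k · v
      power {x} (g , to , from) = go (∈cyclic⇒power (ℕ.pred p) (H.trans (·-congˡ suc-pred-p) pg) (to pairˡ))
        where
        pg : p · g H.≈ H.ε
        pg = exponent (cyclic-commuteₘ M.refl (to pairˡ))
        go : (∃ λ i → v H.≈ i · g) → ∃ λ k → x H.≈ k · v
        go (i , v≈ig) = ∈cyclic⇒power (ℕ.pred p) (H.trans (·-congˡ suc-pred-p) (exponent M.refl))
          (cyclic-⊆ (coprime-power-generates p i (prime∤⇒coprime pr p∤i) pg v≈ig) (to pairʳ))
          where
          p∤i : ¬ (p ∣ i)
          p∤i (divides q ≡.refl) = v≉ε (H.trans v≈ig (H.trans (H.sym (·-assocˡ g q p)) (H.trans (·-congʳ q pg) (·-ε q))))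

-- Squares, norms and field automorphisms

parity : ∀ m → (∃ λ k → m ≡ k ℕ.* 2) ⊎ (∃ λ k → m ≡ 1 ℕ.+ k ℕ.* 2)
parity ℕ.zero = inj₁ (0 , ≡.refl)
parity (ℕ.suc m) = [ (λ (k , eq) → inj₂ (k , ≡.cong ℕ.suc eq))
                   , (λ (k , eq) → inj₁ (ℕ.suc k , ≡.cong ℕ.suc eq)) ]′ (parity m)

prime-parity : ∀ {p} → Prime p → p ≡ 2 ⊎ (∃ λ k → p ≡ 1 ℕ.+ k ℕ.* 2)
prime-parity {p} pr with parity p
... | inj₂ odd = inj₂ odd
... | inj₁ (k , p≡k2) with prime⇒irreducible pr (divides k p≡k2)
...   | inj₂ 2≡p = inj₁ (≡.sym 2≡p)

odd-* : ∀ m k → (1 ℕ.+ m ℕ.* 2) ℕ.* (1 ℕ.+ k ℕ.* 2) ≡ 1 ℕ.+ (m ℕ.+ k ℕ.+ m ℕ.* k ℕ.* 2) ℕ.* 2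
odd-* = solve-∀

odd-part : ∀ n .{{_ : ℕ.NonZero n}} → ∃₂ λ l e → n ≡ (1 ℕ.+ l ℕ.* 2) ℕ.* 2 ℕ.^ e
odd-part n = go n (<-wellFounded n)
  where
  go : ∀ n → Acc ℕ._<_ n → .{{_ : ℕ.NonZero n}} → ∃₂ λ l e → n ≡ (1 ℕ.+ l ℕ.* 2) ℕ.* 2 ℕ.^ e
  go n (acc rec) with parity n
  ... | inj₂ (l , eq) = l , 0 , ≡.trans eq (≡.sym (ℕ.*-identityʳ _))
  ... | inj₁ (ℕ.suc k , ≡.refl) with go (ℕ.suc k) (rec (ℕ.m<m*n (ℕ.suc k) 2 (ℕ.s≤s (ℕ.s≤s ℕ.z≤n))))
  ...   | l , e , eq = l , ℕ.suc e , ≡.trans (≡.cong (ℕ._* 2) eq)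
          (≡.trans (ℕ.*-assoc (1 ℕ.+ l ℕ.* 2) (2 ℕ.^ e) 2) (≡.cong ((1 ℕ.+ l ℕ.* 2) ℕ.*_) (ℕ.*-comm (2 ℕ.^ e) 2)))

iterate : ∀ {a} {A : Set a} → (A → A) → ℕ → A → A
iterate f ℕ.zero    x = x
iterate f (ℕ.suc k) x = f (iterate f k x)

iterate-+ : ∀ {a} {A : Set a} (f : A → A) m n x → iterate f (m ℕ.+ n) x ≡ iterate f m (iterate f n x)
iterate-+ f ℕ.zero    n x = ≡.refl
iterate-+ f (ℕ.suc m) n x = ≡.cong f (iterate-+ f m n x)

module FieldFacts {p : ℕ} (n : ℕ) (pr : Prime p) (F : FiniteField c ℓ (p ℕ.^ n)) where
  open FiniteField F
  open Frobenius n pr F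
    using (_≟_; integral; p·1≈0; one^; to-injective; ^p-surjective)
  open LinearGroups F using (*≉0)
  open Centralizer n pr F using (cancel; ^≉0)
  open ProjectiveSemilinear n pr F using (⟨φ⟩)
  open IntegerSolver commutativeRing
  open Exp commutativeSemiring using (_^_; ^-congˡ; ^-congʳ; ^-distrib-*; ^-assocʳ)
  open Mult semiring using (×-assocˡ; ×-congˡ; ×-congʳ) renaming (_×_ to _·_)
  open RingProperties ring using (x∙y⁻¹≈ε⇒x≈y; -‿involutive; -0#≈0#; +-inverseʳ-unique)
  open Inverse enumeration using (to; from; strictlyInverseˡ)
  open RingAutomorphism
  open SetoidReasoning setoid

  Aut : Set _
  Aut = RingAutomorphism commutativeRing

  module _ (f : Carrier → Carrier) (f-cong : ∀ {x y} → x ≈ y → f x ≈ f y)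
           (f-injective : ∀ {x y} → f x ≈ f y → x ≈ y) where
    iterate-cong : ∀ k {x y} → x ≈ y → iterate f k x ≈ iterate f k y
    iterate-cong ℕ.zero    eq = eq
    iterate-cong (ℕ.suc k) eq = f-cong (iterate-cong k eq)

    iterate-injective : ∀ k {x y} → iterate f k x ≈ iterate f k y → x ≈ y
    iterate-injective ℕ.zero    eq = eq
    iterate-injective (ℕ.suc k) eq = iterate-injective k (f-injective eq)

    iterate-multiple : ∀ k m {x} → iterate f k x ≈ x → iterate f (m ℕ.* k) x ≈ x
    iterate-multiple k ℕ.zero    eq = refl
    iterate-multiple k (ℕ.suc m) {x} eq = begin
      iterate f (k ℕ.+ m ℕ.* k) x            ≡⟨ iterate-+ f k (m ℕ.* k) x ⟩
      iterate f k (iterate f (m ℕ.* k) x)    ≈⟨ iterate-cong k (iterate-multiple k m eq) ⟩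
      iterate f k x                          ≈⟨ eq ⟩
      x                                      ∎

    period : ∀ x → ∃ λ k → k ℕ.< p ℕ.^ n × iterate f (ℕ.suc k) x ≈ x
    period x with Fin.pigeonhole (ℕ.n<1+n (p ℕ.^ n)) (λ i → to (iterate f (Fin.toℕ i) x))
    ... | i , j , i<j , eq with ℕ.m≤n⇒∃[o]m+o≡n i<j
    ...   | o , 1+i+o≡j = o
          , ℕ.≤-trans (ℕ.s≤s (ℕ.m≤n+m o (Fin.toℕ i))) (ℕ.≤-trans (ℕ.≤-reflexive 1+i+o≡j) (Fin.toℕ≤pred[n] j))
          , iterate-injective (Fin.toℕ i) (begin
              iterate f (Fin.toℕ i) (iterate f (ℕ.suc o) x)  ≡⟨ iterate-+ f (Fin.toℕ i) (ℕ.suc o) x ⟨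
              iterate f (Fin.toℕ i ℕ.+ ℕ.suc o) x
                ≡⟨ ≡.cong (λ k → iterate f k x) (≡.trans (ℕ.+-suc (Fin.toℕ i) o) 1+i+o≡j) ⟩
              iterate f (Fin.toℕ j) x                        ≈⟨ to-injective eq ⟨
              iterate f (Fin.toℕ i) x                        ∎)

    -- Each point has a period at most q, so q! is a period of all of them.
    uniform-period : ∃ λ N → ∀ x → iterate f (ℕ.suc N) x ≈ x
    uniform-period = ℕ.pred ((p ℕ.^ n) ℕ.!) , λ x → go x (period x)
      where
      go : ∀ x → (∃ λ k → k ℕ.< p ℕ.^ n × iterate f (ℕ.suc k) x ≈ x) → iterate f (ℕ.suc (ℕ.pred ((p ℕ.^ n) ℕ.!))) x ≈ x
      go x (k , k<q , eq) with ∣-trans (m∣m*n (k ℕ.!)) (m≤n⇒m!∣n! k<q)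
      ... | divides m q!≡ = trans
        (reflexive (≡.cong (λ j → iterate f j x) (≡.trans (ℕ.suc-pred _ {{(p ℕ.^ n) ℕ.!≢0}}) q!≡)))
        (iterate-multiple (ℕ.suc k) m eq)

  ^-pow-iterate : ∀ f s → (∀ x → f x ≈ x ^ s) → ∀ k x → iterate f k x ≈ x ^ (s ℕ.^ k)
  ^-pow-iterate f s f≈ ℕ.zero    x = sym (*-identityʳ x)
  ^-pow-iterate f s f≈ (ℕ.suc k) x = begin
    f (iterate f k x)      ≈⟨ f≈ _ ⟩
    iterate f k x ^ s      ≈⟨ ^-congˡ s (^-pow-iterate f s f≈ k x) ⟩
    (x ^ (s ℕ.^ k)) ^ s    ≈⟨ ^-assocʳ x (s ℕ.^ k) s ⟩
    x ^ (s ℕ.^ k ℕ.* s)    ≈⟨ ^-congʳ x (ℕ.*-comm (s ℕ.^ k) s) ⟩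
    x ^ (s ℕ.^ ℕ.suc k)    ∎

  -- The explicit exponent p^j allows σ(x) to be compared with x up to squares. An inverse is
  -- written as the N-th iterate, where N + 1 is a uniform period.
  frobenius-power : ∀ {σ : Aut} → Subgroup.Member ⟨φ⟩ σ → ∃ λ j → ∀ x → ⟦ σ ⟧ x ≈ x ^ (p ℕ.^ j)
  frobenius-power (gen σ≈φ)     = 1 , λ x → trans (σ≈φ x) (^-congʳ x (≡.sym (ℕ.*-identityʳ p)))
  frobenius-power (gen-≈ eq σ∈) = let (j , σ≈) = frobenius-power σ∈ in j , λ x → trans (sym (eq x)) (σ≈ x)
  frobenius-power gen-ε         = 0 , λ x → sym (*-identityʳ x)
  frobenius-power (gen-∙ {σ} {τ} σ∈ τ∈) =
    let (j , σ≈) = frobenius-power σ∈ ; (k , τ≈) = frobenius-power τ∈ in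
    k ℕ.+ j , λ x → begin
      ⟦ σ ⟧ (⟦ τ ⟧ x)                ≈⟨ σ≈ _ ⟩
      ⟦ τ ⟧ x ^ (p ℕ.^ j)            ≈⟨ ^-congˡ (p ℕ.^ j) (τ≈ x) ⟩
      (x ^ (p ℕ.^ k)) ^ (p ℕ.^ j)    ≈⟨ ^-assocʳ x (p ℕ.^ k) (p ℕ.^ j) ⟩
      x ^ (p ℕ.^ k ℕ.* p ℕ.^ j)      ≈⟨ ^-congʳ x (ℕ.^-distribˡ-+-* p k j) ⟨
      x ^ (p ℕ.^ (k ℕ.+ j))          ∎
  frobenius-power (gen-⁻¹ {σ} σ∈) =
    let (j , σ≈) = frobenius-power σ∈
        (N , per) = uniform-period ⟦ σ ⟧ (⟦⟧-cong σ) (injective σ) in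
    j ℕ.* N , λ x → injective σ (begin
      ⟦ σ ⟧ _                        ≈⟨ Group.inverseʳ (automorphismGroup commutativeRing) σ x ⟩
      x                              ≈⟨ per x ⟨
      ⟦ σ ⟧ (iterate ⟦ σ ⟧ N x)
        ≈⟨ ⟦⟧-cong σ (trans (^-pow-iterate ⟦ σ ⟧ (p ℕ.^ j) σ≈ N x) (^-congʳ x (ℕ.^-*-assoc p j N))) ⟩
      ⟦ σ ⟧ (x ^ (p ℕ.^ (j ℕ.* N)))  ∎)

  multiplicative-order : ∀ {x} → ¬ (x ≈ 0#) → ∃ λ N → x ^ ℕ.suc N ≈ 1#
  multiplicative-order {x} x≉0 =
    let (k , _ , eq) = period (x *_) *-congˡ (cancel x≉0) 1# in k , trans (sym (iterate-* (ℕ.suc k))) eq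
    where
    iterate-* : ∀ k → iterate (x *_) k 1# ≈ x ^ k
    iterate-* ℕ.zero    = refl
    iterate-* (ℕ.suc k) = *-congˡ (iterate-* k)

  Square : Carrier → Set _
  Square x = ∃ λ r → x ≈ r * r

  square? : ∀ x → Dec (Square x)
  square? x = map′ (λ (i , eq) → from i , eq)
    (λ (r , eq) → to r , trans eq (sym (*-cong (from-to r) (from-to r))))
    (Fin.any? (λ i → x ≟ (from i * from i)))
    where
    from-to : ∀ r → from (to r) ≈ r
    from-to = Inverse.strictlyInverseʳ enumeration

  square-root≉0 : ∀ {x r} → ¬ (x ≈ 0#) → x ≈ r * r → ¬ (r ≈ 0#)
  square-root≉0 x≉0 x≈rr r≈0 = x≉0 (trans x≈rr (trans (*-congʳ r≈0) (zeroˡ _)))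

  Square-cancel : ∀ {x y} → ¬ (y ≈ 0#) → Square (x * (y * y)) → Square x
  Square-cancel {x} {y} y≉0 (r , eq) = let (w , yw≈1) = invertible y y≉0 in r * w , (begin
    x                        ≈⟨ solve 1 (λ x → x := x :* (con (+ 1) :* con (+ 1))) refl x ⟩
    x * (1# * 1#)            ≈⟨ *-congˡ (*-cong yw≈1 yw≈1) ⟨
    x * ((y * w) * (y * w))
        ≈⟨ solve 3 (λ x y w → x :* ((y :* w) :* (y :* w)) := (x :* (y :* y)) :* (w :* w)) refl x y w ⟩
    x * (y * y) * (w * w)    ≈⟨ *-congʳ eq ⟩
    r * r * (w * w)          ≈⟨ solve 2 (λ r w → r :* r :* (w :* w) := (r :* w) :* (r :* w)) refl r w ⟩
    r * w * (r * w)          ∎)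

  ^-odd : ∀ x m → x ^ (1 ℕ.+ m ℕ.* 2) ≈ x * (x ^ m * x ^ m)
  ^-odd x m = *-congˡ (trans (sym (^-assocʳ x m 2)) (*-congˡ (*-identityʳ _)))

  Square-odd-power : ∀ {x} m → ¬ (x ≈ 0#) → Square (x ^ (1 ℕ.+ m ℕ.* 2)) → Square x
  Square-odd-power {x} m x≉0 (r , eq) = Square-cancel (^≉0 m x≉0) (r , trans (sym (^-odd x m)) eq)

  square-root-of-one : ∀ {x} → x * x ≈ 1# → x ≈ 1# ⊎ x ≈ - 1#
  square-root-of-one {x} xx≈1 with integral (x - 1#) (x + 1#) (begin
      (x - 1#) * (x + 1#)  ≈⟨ solve 1 (λ x → (x :- con (+ 1)) :* (x :+ con (+ 1)) := x :* x :- con (+ 1)) refl x ⟩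
      x * x - 1#           ≈⟨ +-congʳ xx≈1 ⟩
      1# - 1#              ≈⟨ -‿inverseʳ 1# ⟩
      0#                   ∎)
  ... | inj₁ eq = inj₁ (x∙y⁻¹≈ε⇒x≈y x 1# eq)
  ... | inj₂ eq = inj₂ (RingProperties.+-inverseˡ-unique ring x 1# eq)

  -- Halve an even exponent that kills x: the half power is 1, and the halving continues, or it is
  -- -1.
  odd-order-or-−1 : ∀ {x} → ¬ (x ≈ 0#) → (∃ λ k → x ^ k ≈ - 1#) ⊎ (∃ λ m → x ^ (1 ℕ.+ m ℕ.* 2) ≈ 1#)
  odd-order-or-−1 {x} x≉0 = let (N , eq) = multiplicative-order x≉0 in go N eq (<-wellFounded N)
    where
    go : ∀ N → x ^ ℕ.suc N ≈ 1# → Acc ℕ._<_ N → (∃ λ k → x ^ k ≈ - 1#) ⊎ (∃ λ m → x ^ (1 ℕ.+ m ℕ.* 2) ≈ 1#)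
    go N eq (acc rec) with parity (ℕ.suc N)
    ... | inj₂ (m , N≡) = inj₂ (m , trans (^-congʳ x (≡.sym N≡)) eq)
    ... | inj₁ (ℕ.suc k , ≡.refl)
      with square-root-of-one (trans (*-congˡ (sym (*-identityʳ _))) (trans (^-assocʳ x (ℕ.suc k) 2) eq))
    ...   | inj₁ xᵏ≈1  = go k xᵏ≈1 (rec (ℕ.s≤s (ℕ.m≤m*n k 2)))
    ...   | inj₂ xᵏ≈-1 = inj₁ (ℕ.suc k , xᵏ≈-1)

  ⟦⟧≉0 : ∀ (σ : Aut) {x} → ¬ (x ≈ 0#) → ¬ (⟦ σ ⟧ x ≈ 0#)
  ⟦⟧≉0 σ x≉0 σx≈0 = x≉0 (injective σ (trans σx≈0 (sym (0#-homo σ))))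

  ⟦⟧-^ : ∀ (σ : Aut) x k → ⟦ σ ⟧ (x ^ k) ≈ ⟦ σ ⟧ x ^ k
  ⟦⟧-^ σ x ℕ.zero    = 1#-homo σ
  ⟦⟧-^ σ x (ℕ.suc k) = trans (*-homo σ x (x ^ k)) (*-congˡ (⟦⟧-^ σ x k))

  -- The data of a claw inside Fˣ ⋊ ⟨σ⟩: its centre is diag(1, z), its leaves are diag(1, a₀), diag(1, a₁) σ and
  -- diag(1, a₂) σ. The rᵢ witness that these lie in PSL and in its coset of determinant α.
  record TorusClaw (σ : Aut) (α : Carrier) : Set (c ⊔ ℓ) where
    field
      {z a₀ a₁ a₂ r₀ r₁ r₂} : Carrier
      a₀≈      : a₀ ≈ r₀ * r₀
      a₁≈      : a₁ ≈ α * (r₁ * r₁)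
      a₂≈      : a₂ ≈ α * (r₂ * r₂)
      a₀≉0     : ¬ (a₀ ≈ 0#)
      a₁≉0     : ¬ (a₁ ≈ 0#)
      a₂≉0     : ¬ (a₂ ≈ 0#)
      z≉1      : ¬ (z ≈ 1#)
      power₀   : ∃ λ k → a₀ ^ k ≈ z
      -- The square of diag(1, a) σ is diag(1, a σ(a)) when σ² = 1, so the two semilinear leaves
      -- reach the centre through their norms.
      power₁   : ∃ λ k → (a₁ * ⟦ σ ⟧ a₁) ^ k ≈ z
      power₂   : ∃ λ k → (a₂ * ⟦ σ ⟧ a₂) ^ k ≈ z
      -- The last two conditions keep the leaves from commuting: the linear leaf with a semilinear
      -- one, and the two semilinear leaves with each other.
      a₀-moved : ¬ (⟦ σ ⟧ a₀ ≈ a₀)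
      a₁a₂     : ¬ (a₁ * ⟦ σ ⟧ a₂ ≈ a₂ * ⟦ σ ⟧ a₁)

  module _ (m : ℕ) (p-odd : p ≡ 1 ℕ.+ m ℕ.* 2) where
    2≉0 : ¬ (1# + 1# ≈ 0#)
    2≉0 2≈0 = 1≉0 (begin
      1#                            ≈⟨ +-identityʳ 1# ⟨
      1# + 0#                       ≈⟨ +-congˡ (·0 m) ⟨
      1# + m · 0#                   ≈⟨ +-congˡ (×-congʳ m (trans (+-congˡ (+-identityʳ 1#)) 2≈0)) ⟨
      1# + m · (2 · 1#)             ≈⟨ +-congˡ (×-assocˡ 1# m 2) ⟩
      (1 ℕ.+ m ℕ.* 2) · 1#          ≈⟨ ×-congˡ p-odd ⟨
      p · 1#                        ≈⟨ p·1≈0 ⟩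
      0#                            ∎)
      where
      ·0 : ∀ k → k · 0# ≈ 0#
      ·0 ℕ.zero    = refl
      ·0 (ℕ.suc k) = trans (+-identityˡ _) (·0 k)

    p^-odd : ∀ j → ∃ λ k → p ℕ.^ j ≡ 1 ℕ.+ k ℕ.* 2
    p^-odd ℕ.zero    = 0 , ≡.refl
    p^-odd (ℕ.suc j) = let (k , eq) = p^-odd j in m ℕ.+ k ℕ.+ m ℕ.* k ℕ.* 2 , ≡.trans (≡.cong₂ ℕ._*_ p-odd eq) (odd-* m k)

    module _ (σ : Aut) (j : ℕ) (σ≈ : ∀ x → ⟦ σ ⟧ x ≈ x ^ (p ℕ.^ j)) where
      -- p^j is odd, so σ(x) / x = x^(p^j - 1) is a square for nonzero x.
      power-odd : ∀ x → ∃ λ y → ⟦ σ ⟧ x ≈ x * (y * y) × (¬ (x ≈ 0#) → ¬ (y ≈ 0#))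
      power-odd x = let (k , eq) = p^-odd j in
        x ^ k , trans (σ≈ x) (trans (^-congʳ x eq) (^-odd x k)) , ^≉0 k

      Square-norm : ∀ x → Square (x * ⟦ σ ⟧ x)
      Square-norm x = let (y , σx≈ , _) = power-odd x in x * y ,
        trans (*-congˡ σx≈) (solve 2 (λ x y → x :* (x :* (y :* y)) := (x :* y) :* (x :* y)) refl x y)

      module _ (σσ : ∀ x → ⟦ σ ⟧ (⟦ σ ⟧ x) ≈ x) (x₀ : Carrier) (x₀-moved : ¬ (⟦ σ ⟧ x₀ ≈ x₀)) where
        private
          -- σ negates x and sends h to 1 - x. Hence h² is a square moved by σ: the difference h² -
          -- σ(h²) is 4x.
          x = x₀ - ⟦ σ ⟧ x₀
          h = 1# + x

        σx : ⟦ σ ⟧ x ≈ - x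
        σx = begin
          ⟦ σ ⟧ (x₀ - ⟦ σ ⟧ x₀)           ≈⟨ +-homo σ _ _ ⟩
          ⟦ σ ⟧ x₀ + ⟦ σ ⟧ (- ⟦ σ ⟧ x₀)   ≈⟨ +-congˡ (trans (-‿homo σ _) (-‿cong (σσ x₀))) ⟩
          ⟦ σ ⟧ x₀ - x₀                   ≈⟨ solve 2 (λ a b → b :- a := :- (a :- b)) refl x₀ (⟦ σ ⟧ x₀) ⟩
          - x                             ∎

        x≉0 : ¬ (x ≈ 0#)
        x≉0 x≈0 = x₀-moved (sym (x∙y⁻¹≈ε⇒x≈y _ _ x≈0))

        σh : ⟦ σ ⟧ h ≈ 1# - x
        σh = trans (+-homo σ 1# x) (+-cong (1#-homo σ) σx)

        h≉0 : ¬ (h ≈ 0#)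
        h≉0 h≈0 = 2≉0 (begin
          1# + 1#
              ≈⟨ solve 1 (λ x → con (+ 1) :+ con (+ 1) := (con (+ 1) :+ x) :+ (con (+ 1) :- x)) refl x ⟩
          h + (1# - x)          ≈⟨ +-cong h≈0 (trans (sym σh) (trans (⟦⟧-cong σ h≈0) (0#-homo σ))) ⟩
          0# + 0#               ≈⟨ +-identityˡ 0# ⟩
          0#                    ∎)

        -- -1 is σ(x) / x for the x negated by σ, and such quotients are squares by `power-odd`.
        -1-square : Square (- 1#)
        -1-square = let (y , σx≈ , _) = power-odd x in y , cancel x≉0 (begin
          x * - 1#              ≈⟨ solve 1 (λ x → x :* con -[1+ 0 ] := :- x) refl x ⟩
          - x                   ≈⟨ σx ⟨
          ⟦ σ ⟧ x               ≈⟨ σx≈ ⟩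
          x * (y * y)           ∎)

        -- Hilbert 90: an element b of norm 1 is y / σ(y) = y ^ (1 − p ^ j).
        norm-one⇒square : ∀ {b} → ¬ (b ≈ 0#) → b * ⟦ σ ⟧ b ≈ 1# → Square b
        norm-one⇒square {b} b≉0 norm = go ((1# + b) ≟ 0#)
         where
         go : Dec (1# + b ≈ 0#) → Square b
         -- b = -1 is the case in which the Hilbert 90 element 1 + b vanishes.
         go (yes 1+b≈0) = let (i , eq) = -1-square in i , trans (+-inverseʳ-unique 1# b 1+b≈0) eq
         go (no  1+b≉0) = let (y , σ≈y , y≉0) = power-odd (1# + b) in
          Square-cancel (y≉0 1+b≉0) (1# , trans (cancel 1+b≉0 (begin
            (1# + b) * (b * (y * y))
                ≈⟨ solve 3 (λ u b y → u :* (b :* (y :* y)) := b :* (u :* (y :* y))) refl (1# + b) b y ⟩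
            b * ((1# + b) * (y * y))    ≈⟨ *-congˡ σ≈y ⟨
            b * ⟦ σ ⟧ (1# + b)          ≈⟨ *-congˡ (trans (+-homo σ 1# b) (+-congʳ (1#-homo σ))) ⟩
            b * (1# + ⟦ σ ⟧ b)          ≈⟨ solve 2 (λ b c → b :* (con (+ 1) :+ c) := b :+ b :* c) refl b (⟦ σ ⟧ b) ⟩
            b + b * ⟦ σ ⟧ b             ≈⟨ +-congˡ norm ⟩
            b + 1#                      ≈⟨ trans (+-comm b 1#) (sym (*-identityʳ _)) ⟩
            (1# + b) * 1#               ∎)) (sym (*-identityʳ 1#)))

        -- If an odd power of the norm were 1, the same power of a would have norm 1 and be a
        -- square, and then a would be a square itself.
        nonsquare-norm : ∀ {a} → ¬ (a ≈ 0#) → ¬ Square a → ∃ λ k → (a * ⟦ σ ⟧ a) ^ k ≈ - 1#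
        nonsquare-norm {a} a≉0 ¬sq = [ id , odd ]′ (odd-order-or-−1 (*≉0 a≉0 (⟦⟧≉0 σ a≉0)))
         where
         odd : (∃ λ k → (a * ⟦ σ ⟧ a) ^ (1 ℕ.+ k ℕ.* 2) ≈ 1#) → ∃ λ k → (a * ⟦ σ ⟧ a) ^ k ≈ - 1#
         odd (k , eq) = ⊥-elim (¬sq (Square-odd-power k a≉0 (norm-one⇒square (^≉0 (1 ℕ.+ k ℕ.* 2) a≉0) (begin
          a ^ (1 ℕ.+ k ℕ.* 2) * ⟦ σ ⟧ (a ^ (1 ℕ.+ k ℕ.* 2))   ≈⟨ *-congˡ (⟦⟧-^ σ a (1 ℕ.+ k ℕ.* 2)) ⟩
          a ^ (1 ℕ.+ k ℕ.* 2) * ⟦ σ ⟧ a ^ (1 ℕ.+ k ℕ.* 2)     ≈⟨ ^-distrib-* a (⟦ σ ⟧ a) (1 ℕ.+ k ℕ.* 2) ⟨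
          (a * ⟦ σ ⟧ a) ^ (1 ℕ.+ k ℕ.* 2)                     ≈⟨ eq ⟩
          1#                                                  ∎))))

        hh-moved : ¬ (⟦ σ ⟧ (h * h) ≈ h * h)
        hh-moved eq = *≉0 (*≉0 2≉0 2≉0) x≉0 (begin
          (1# + 1#) * (1# + 1#) * x
            ≈⟨ solve 1 (λ x → (con (+ 1) :+ con (+ 1)) :* (con (+ 1) :+ con (+ 1)) :* x :=
                 (con (+ 1) :+ x) :* (con (+ 1) :+ x) :- (con (+ 1) :- x) :* (con (+ 1) :- x)) refl x ⟩
          h * h - (1# - x) * (1# - x)   ≈⟨ +-congˡ (-‿cong (trans (*-homo σ h h) (*-cong σh σh))) ⟨
          h * h - ⟦ σ ⟧ (h * h)         ≈⟨ +-congˡ (-‿cong eq) ⟩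
          h * h - h * h                 ≈⟨ -‿inverseʳ _ ⟩
          0#                            ∎)

        -- h² serves unless it has odd order. In that case -h² serves: it is a square because -1 is,
        -- and a suitable odd power of it is -1.
        even-square-moved : ∃₂ λ a r → a ≈ r * r × ¬ (a ≈ 0#) × (∃ λ k → a ^ k ≈ - 1#) × ¬ (⟦ σ ⟧ a ≈ a)
        even-square-moved = [ (λ found → h * h , h , refl , *≉0 h≉0 h≉0 , found , hh-moved) , odd ]′
                              (odd-order-or-−1 (*≉0 h≉0 h≉0))
         where
         odd : (∃ λ k → (h * h) ^ (1 ℕ.+ k ℕ.* 2) ≈ 1#) →
               ∃₂ λ a r → a ≈ r * r × ¬ (a ≈ 0#) × (∃ λ k → a ^ k ≈ - 1#) × ¬ (⟦ σ ⟧ a ≈ a)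
         odd (k , eq) = let (i , ii≈) = -1-square in
          - 1# * (h * h) , i * h
          , trans (*-congʳ ii≈) (solve 2 (λ i h → i :* i :* (h :* h) := i :* h :* (i :* h)) refl i h)
          , *≉0 -1≉0 (*≉0 h≉0 h≉0)
          , (1 ℕ.+ k ℕ.* 2 , (begin
              (- 1# * (h * h)) ^ (1 ℕ.+ k ℕ.* 2)                     ≈⟨ ^-distrib-* (- 1#) (h * h) (1 ℕ.+ k ℕ.* 2) ⟩
              (- 1#) ^ (1 ℕ.+ k ℕ.* 2) * (h * h) ^ (1 ℕ.+ k ℕ.* 2)   ≈⟨ *-cong -1^odd eq ⟩
              - 1# * 1#                                              ≈⟨ *-identityʳ _ ⟩
              - 1#                                                   ∎))
          , λ moved → hh-moved (cancel -1≉0 (trans (*-congʳ (sym (trans (-‿homo σ 1#) (-‿cong (1#-homo σ)))))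
              (trans (sym (*-homo σ (- 1#) (h * h))) moved)))
          where
          -1≉0 : ¬ (- 1# ≈ 0#)
          -1≉0 eq = 1≉0 (trans (sym (-‿involutive 1#)) (trans (-‿cong eq) -0#≈0#))
          -1^odd : (- 1#) ^ (1 ℕ.+ k ℕ.* 2) ≈ - 1#
          -1^odd = trans (^-odd (- 1#) k) (trans (*-congˡ (begin
            (- 1#) ^ k * (- 1#) ^ k   ≈⟨ ^-distrib-* (- 1#) (- 1#) k ⟨
            (- 1# * - 1#) ^ k         ≈⟨ ^-congˡ k (solve 0 (con -[1+ 0 ] :* con -[1+ 0 ] := con (+ 1)) refl) ⟩
            1# ^ k                    ≈⟨ one^ k ⟩
            1#                        ∎)) (*-identityʳ _))

        -- The semilinear leaves have entries α and α h². Both are nonsquares, so their norms reach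
        -- -1, and they fail to commute because σ moves their quotient h².
        nonsquare-torusClaw : ∀ {α} → ¬ (α ≈ 0#) → ¬ Square α → TorusClaw σ α
        nonsquare-torusClaw {α} α≉0 ¬sq = let (a₀ , r₀ , a₀≈ , a₀≉0 , pow , moved) = even-square-moved in record
          { a₀≈ = a₀≈ ; a₁≈ = sym (trans (*-congˡ (*-identityʳ 1#)) (*-identityʳ α)) ; a₂≈ = refl
          ; a₀≉0 = a₀≉0 ; a₁≉0 = α≉0 ; a₂≉0 = *≉0 α≉0 (*≉0 h≉0 h≉0)
          ; z≉1 = λ -1≈1 → 2≉0 (trans (+-congʳ (sym -1≈1)) (-‿inverseˡ 1#))
          ; power₀ = pow
          ; power₁ = nonsquare-norm α≉0 ¬sq
          ; power₂ = nonsquare-norm (*≉0 α≉0 (*≉0 h≉0 h≉0)) (¬sq ∘ Square-cancel h≉0)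
          ; a₀-moved = moved
          ; a₁a₂ = λ eq → hh-moved (cancel (*≉0 α≉0 (⟦⟧≉0 σ α≉0)) (begin
              α * ⟦ σ ⟧ α * ⟦ σ ⟧ (h * h)      ≈⟨ trans (*-assoc _ _ _) (*-congˡ (sym (*-homo σ α (h * h)))) ⟩
              α * ⟦ σ ⟧ (α * (h * h))          ≈⟨ eq ⟩
              α * (h * h) * ⟦ σ ⟧ α
                  ≈⟨ solve 3 (λ a b c → a :* b :* c := a :* c :* b) refl α (h * h) (⟦ σ ⟧ α) ⟩
              α * ⟦ σ ⟧ α * (h * h)            ∎))
          }

  avoid : 5 ℕ.≤ p ℕ.^ n → (l : Fin 4 → Carrier) → ∃ λ w → ∀ i → ¬ (w ≈ l i)
  avoid 5≤q l = go (Fin.any? (λ j → Fin.all? (λ i → ¬? (from j ≟ l i))))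
    where
    hit : ¬ (∃ λ j → ∀ i → ¬ (from j ≈ l i)) → ∀ j → ∃ λ i → from j ≈ l i
    hit none j = go (Fin.any? (λ i → from j ≟ l i))
      where
      go : Dec (∃ λ i → from j ≈ l i) → ∃ λ i → from j ≈ l i
      go (yes found) = found
      go (no  miss)  = ⊥-elim (none (j , λ i eq → miss (i , eq)))
    go : Dec (∃ λ j → ∀ i → ¬ (from j ≈ l i)) → ∃ λ w → ∀ i → ¬ (w ≈ l i)
    go (yes (j , avoids)) = from j , avoids
    go (no none) = let (i , j , i<j , eq) = Fin.pigeonhole 5≤q (λ j → proj₁ (hit none j)) in
      ⊥-elim (Fin.<⇒≢ i<j (≡.trans (≡.sym (strictlyInverseˡ i)) (≡.trans
        (Inverse.to-cong enumeration (trans (proj₂ (hit none i))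
          (trans (reflexive (≡.cong l eq)) (sym (proj₂ (hit none j))))))
        (strictlyInverseˡ j))))

  module _ (p≡2 : p ≡ 2) where
    double : ∀ x → x + x ≈ 0#
    double x = begin
      x + x           ≈⟨ solve 1 (λ x → x :+ x := x :* (con (+ 1) :+ (con (+ 1) :+ con (+ 0)))) refl x ⟩
      x * (2 · 1#)    ≈⟨ *-congˡ (trans (×-congˡ (≡.sym p≡2)) p·1≈0) ⟩
      x * 0#          ≈⟨ zeroʳ x ⟩
      0#              ∎

    neg≈ : ∀ x → - x ≈ x
    neg≈ x = sym (+-inverseʳ-unique x x (double x))

    all-square : ∀ x → Square x
    all-square x = let (y , yᵖ≈x) = ^p-surjective x in
      y , trans (sym yᵖ≈x) (trans (^-congʳ y p≡2) (*-congˡ (*-identityʳ y)))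

    module _ (5≤q : 5 ℕ.≤ p ℕ.^ n) (σ : Aut) (j : ℕ) (σ≈ : ∀ x → ⟦ σ ⟧ x ≈ x ^ (p ℕ.^ j))
             (σσ : ∀ x → ⟦ σ ⟧ (⟦ σ ⟧ x) ≈ x) (y : Carrier) (y-moved : ¬ (⟦ σ ⟧ y ≈ y)) where
      private
        -- For q = 4 and σ of order two there is no such element: nonzero norms lie in the field of
        -- two elements and are all 1.
        Good : Carrier → Set _
        Good a = ¬ (⟦ σ ⟧ a ≈ a) × ¬ (a * ⟦ σ ⟧ a ≈ 1#)

        -- Given ab = 1, the second equation reads a + b + 1 = 0; multiply it by a.
        quadratic : ∀ a b → a * b ≈ 1# → (a + 1#) * (b + 1#) ≈ 1# → a * a + a + 1# ≈ 0#
        quadratic a b ab≈1 eq = begin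
          a * a + a + 1#
            ≈⟨ solve 2 (λ a b → a :* a :+ a :+ con (+ 1) :=
                 a :* ((a :+ con (+ 1)) :* (b :+ con (+ 1)) :- a :* b) :- a :* b :+ con (+ 1)) refl a b ⟩
          a * ((a + 1#) * (b + 1#) - a * b) - a * b + 1#
            ≈⟨ +-congʳ (+-cong (*-congˡ (+-cong eq (-‿cong ab≈1))) (-‿cong ab≈1)) ⟩
          a * (1# - 1#) - 1# + 1#
            ≈⟨ solve 1 (λ a → a :* (con (+ 1) :- con (+ 1)) :- con (+ 1) :+ con (+ 1) := con (+ 0)) refl a ⟩
          0#  ∎

        σ+1 : ∀ a → ⟦ σ ⟧ (a + 1#) ≈ ⟦ σ ⟧ a + 1#
        σ+1 a = trans (+-homo σ a 1#) (+-congˡ (1#-homo σ))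

        good? : ∀ a → ¬ (⟦ σ ⟧ a ≈ a) → ∃ Good ⊎ (a * ⟦ σ ⟧ a ≈ 1# × a * a + a + 1# ≈ 0#)
        good? a moved = go ((a * ⟦ σ ⟧ a) ≟ 1#) (((a + 1#) * ⟦ σ ⟧ (a + 1#)) ≟ 1#)
          where
          go : Dec (a * ⟦ σ ⟧ a ≈ 1#) → Dec ((a + 1#) * ⟦ σ ⟧ (a + 1#) ≈ 1#) →
               ∃ Good ⊎ (a * ⟦ σ ⟧ a ≈ 1# × a * a + a + 1# ≈ 0#)
          go (no ≉1) _ = inj₁ (a , moved , ≉1)
          go (yes _) (no ≉1) = inj₁ (a + 1# ,
            (λ eq → moved (RingProperties.+-cancelʳ ring 1# _ _ (trans (sym (σ+1 a)) eq))) , ≉1)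
          go (yes ≈1) (yes ≈1′) = inj₂ (≈1 , quadratic a (⟦ σ ⟧ a) ≈1 (trans (*-congˡ (sym (σ+1 a))) ≈1′))

        -- If neither y nor y + 1 is good, they are the two roots of X² + X + 1, and together with 0
        -- and 1 they form the field of four elements. The bound on q gives some w outside it. If σ
        -- moves w, then w or w + 1 is good, as w is not a root; if σ fixes w, then w y is moved and
        -- has norm w² ≠ 1.
        search : ∃ Good
        search = [ id , second ]′ (good? y y-moved)
          where
          second : y * ⟦ σ ⟧ y ≈ 1# × y * y + y + 1# ≈ 0# → ∃ Good
          second (norm , root) = third (avoid 5≤q l)
            where
            l : Fin 4 → Carrier
            l 0F = 0#
            l 1F = 1#
            l 2F = y
            l 3F = y + 1#
            third : (∃ λ w → ∀ i → ¬ (w ≈ l i)) → ∃ Good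
            third (w , w≉) = go ((⟦ σ ⟧ w) ≟ w)
              where
              two-roots : w * ⟦ σ ⟧ w ≈ 1# × w * w + w + 1# ≈ 0# → ∃ Good
              two-roots (_ , root′) = ⊥-elim ([ (λ eq → w≉ 2F (x∙y⁻¹≈ε⇒x≈y w y eq))
                , (λ eq → w≉ 3F (trans (RingProperties.+-inverseˡ-unique ring w (y + 1#) eq) (neg≈ (y + 1#)))) ]′
                (integral (w - y) (w + (y + 1#)) (begin
                  (w - y) * (w + (y + 1#))
                    ≈⟨ solve 2 (λ w y → (w :- y) :* (w :+ (y :+ con (+ 1))) :=
                         (w :* w :+ w :+ con (+ 1)) :- (y :* y :+ y :+ con (+ 1))) refl w y ⟩
                  (w * w + w + 1#) - (y * y + y + 1#)   ≈⟨ +-cong root′ (-‿cong root) ⟩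
                  0# - 0#                               ≈⟨ -‿inverseʳ 0# ⟩
                  0#                                    ∎)))
              go : Dec (⟦ σ ⟧ w ≈ w) → ∃ Good
              go (no moved) = [ id , two-roots ]′ (good? w moved)
              go (yes fixed) = w * y
                , (λ eq → y-moved (cancel (w≉ 0F) (trans (*-congʳ (sym fixed)) (trans (sym (*-homo σ w y)) eq))))
                , λ eq → [ w≉ 1F , (λ w≈-1 → w≉ 1F (trans w≈-1 (neg≈ 1#))) ]′ (square-root-of-one (begin
                    w * w                           ≈⟨ *-identityʳ _ ⟨
                    w * w * 1#                      ≈⟨ *-congˡ norm ⟨
                    w * w * (y * ⟦ σ ⟧ y)
                        ≈⟨ solve 3 (λ w y s → w :* w :* (y :* s) := w :* y :* (w :* s)) refl w y (⟦ σ ⟧ y) ⟩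
                    w * y * (w * ⟦ σ ⟧ y)           ≈⟨ *-congˡ (trans (*-homo σ w y) (*-congʳ fixed)) ⟨
                    w * y * ⟦ σ ⟧ (w * y)           ≈⟨ eq ⟩
                    1#                              ∎))

      -- Every element is a square in characteristic 2, so entries of any value fit the determinant
      -- classes. The leaves use a, a and σ(a), and the centre is their common norm, which the
      -- linear leaf reaches as a^(1 + p^j). The semilinear leaves do not commute because a² ≠
      -- σ(a)².
      even-torusClaw : ∀ {α} → ¬ (α ≈ 0#) → TorusClaw σ α
      even-torusClaw {α} α≉0 = build search
        where
        quotient : ∀ b → ∃ λ r → b ≈ α * (r * r)
        quotient b = let (α′ , αα′≈1) = invertible α α≉0 ; (r , eq) = all-square (α′ * b) in r , (begin
          b               ≈⟨ *-identityˡ b ⟨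
          1# * b          ≈⟨ *-congʳ αα′≈1 ⟨
          α * α′ * b      ≈⟨ *-assoc α α′ b ⟩
          α * (α′ * b)    ≈⟨ *-congˡ eq ⟩
          α * (r * r)     ∎)
        build : ∃ Good → TorusClaw σ α
        build (a , moved , norm≉1) = record
          { a₀≈ = proj₂ (all-square a) ; a₁≈ = proj₂ (quotient a) ; a₂≈ = proj₂ (quotient (⟦ σ ⟧ a))
          ; a₀≉0 = a≉0 ; a₁≉0 = a≉0 ; a₂≉0 = ⟦⟧≉0 σ a≉0
          ; z≉1 = norm≉1
          ; power₀ = ℕ.suc (p ℕ.^ j) , *-congˡ (sym (σ≈ a))
          ; power₁ = 1 , *-identityʳ _
          ; power₂ = 1 , trans (*-identityʳ _) (trans (*-congˡ (σσ a)) (*-comm _ _))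
          ; a₀-moved = moved
          ; a₁a₂ = λ eq → [ (λ d → moved (sym (x∙y⁻¹≈ε⇒x≈y _ _ d)))
                          , (λ d → moved (sym (trans (RingProperties.+-inverseˡ-unique ring _ _ d) (neg≈ _)))) ]′
              (integral (a - ⟦ σ ⟧ a) (a + ⟦ σ ⟧ a) (begin
                (a - ⟦ σ ⟧ a) * (a + ⟦ σ ⟧ a)
                    ≈⟨ solve 2 (λ a b → (a :- b) :* (a :+ b) := a :* a :- b :* b) refl a (⟦ σ ⟧ a) ⟩
                a * a - ⟦ σ ⟧ a * ⟦ σ ⟧ a         ≈⟨ +-cong (*-congˡ (sym (σσ a))) (-‿cong (sym eq)) ⟩
                a * ⟦ σ ⟧ (⟦ σ ⟧ a) - a * ⟦ σ ⟧ (⟦ σ ⟧ a)  ≈⟨ -‿inverseʳ _ ⟩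
                0#                                ∎))
          }
          where
          a≉0 : ¬ (a ≈ 0#)
          a≉0 a≈0 = moved (trans (⟦⟧-cong σ a≈0) (trans (0#-homo σ) (sym a≈0)))

-- Claws in groups of semilinear transformations

pairwise : ∀ {r} {R : Fin 3 → Fin 3 → Set r} → (∀ {i j} → R i j → R j i) →
           ¬ R 0F 1F → ¬ R 0F 2F → ¬ R 1F 2F → ∀ i j → ¬ (i ≡ j) → ¬ R i j
pairwise sym c₀₁ c₀₂ c₁₂ 0F 0F i≢j _ = i≢j ≡.refl
pairwise sym c₀₁ c₀₂ c₁₂ 0F 1F _ = c₀₁
pairwise sym c₀₁ c₀₂ c₁₂ 0F 2F _ = c₀₂
pairwise sym c₀₁ c₀₂ c₁₂ 1F 0F _ = c₀₁ ∘ sym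
pairwise sym c₀₁ c₀₂ c₁₂ 1F 1F i≢j _ = i≢j ≡.refl
pairwise sym c₀₁ c₀₂ c₁₂ 1F 2F _ = c₁₂
pairwise sym c₀₁ c₀₂ c₁₂ 2F 0F _ = c₀₂ ∘ sym
pairwise sym c₀₁ c₀₂ c₁₂ 2F 1F _ = c₁₂ ∘ sym
pairwise sym c₀₁ c₀₂ c₁₂ 2F 2F i≢j _ = i≢j ≡.refl

module SpecialMatrices {p : ℕ} (n : ℕ) (pr : Prime p) (F : FiniteField c ℓ (p ℕ.^ n)) where
  open FiniteField F
  open Frobenius n pr F using (one^)
  open Matrices commutativeRing
  open MatrixRing commutativeRing
  open Centralizer n pr F using (frobenius-affine)
  open LinearGroups F using (*≉0)
  open FieldFacts n pr F
  open IntegerSolver commutativeRing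
  open Exp commutativeSemiring using (_^_)
  open RingAutomorphism

  upper lower diag : Carrier → M₂
  upper x = mat 1# x 0# 1#
  lower x = mat 1# 0# x 1#
  diag a = mat 1# 0# 0# a

  mapₘ-* : ∀ (σ : Aut) A B → mapₘ ⟦ σ ⟧ (A *ₘ B) ≈ₘ mapₘ ⟦ σ ⟧ A *ₘ mapₘ ⟦ σ ⟧ B
  mapₘ-* σ A B = eqs entry entry entry entry
    where
    entry : ∀ {x y z w} → ⟦ σ ⟧ (x * z + y * w) ≈ ⟦ σ ⟧ x * ⟦ σ ⟧ z + ⟦ σ ⟧ y * ⟦ σ ⟧ w
    entry = trans (+-homo σ _ _) (+-cong (*-homo σ _ _) (*-homo σ _ _))

  mapₘ-cong : ∀ (σ : Aut) {A B} → A ≈ₘ B → mapₘ ⟦ σ ⟧ A ≈ₘ mapₘ ⟦ σ ⟧ B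
  mapₘ-cong σ (eqs p q r s) = eqs (⟦⟧-cong σ p) (⟦⟧-cong σ q) (⟦⟧-cong σ r) (⟦⟧-cong σ s)

  mapₘ-1 : ∀ (σ : Aut) → mapₘ ⟦ σ ⟧ 1ₘ ≈ₘ 1ₘ
  mapₘ-1 σ = eqs (1#-homo σ) (0#-homo σ) (0#-homo σ) (1#-homo σ)

  Fixed : Aut → M₂ → Set ℓ
  Fixed σ A = mapₘ ⟦ σ ⟧ A ≈ₘ A

  Fixed-^ : ∀ σ A k → Fixed σ A → Fixed σ (A ^ₘ k)
  Fixed-^ σ A ℕ.zero    fix = mapₘ-1 σ
  Fixed-^ σ A (ℕ.suc k) fix = ≈ₘ-trans (mapₘ-* σ A (A ^ₘ k)) (*ₘ-cong fix (Fixed-^ σ A k fix))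

  module _ (σ : Aut) where
    fixed-0 : ⟦ σ ⟧ 0# ≈ 0#
    fixed-0 = 0#-homo σ
    fixed-1 : ⟦ σ ⟧ 1# ≈ 1#
    fixed-1 = 1#-homo σ
    fixed-2 : ⟦ σ ⟧ (1# + 1#) ≈ 1# + 1#
    fixed-2 = trans (+-homo σ 1# 1#) (+-cong fixed-1 fixed-1)
    fixed-neg : ∀ {x} → ⟦ σ ⟧ x ≈ x → ⟦ σ ⟧ (- x) ≈ - x
    fixed-neg eq = trans (-‿homo σ _) (-‿cong eq)

  diag-^ : ∀ a k → diag a ^ₘ k ≈ₘ diag (a ^ k)
  diag-^ a ℕ.zero    = ≈ₘ-refl
  diag-^ a (ℕ.suc k) = ≈ₘ-trans (*ₘ-cong ≈ₘ-refl (diag-^ a k)) (diag-* a (a ^ k))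
    where
    diag-* : ∀ a b → diag a *ₘ diag b ≈ₘ diag (a * b)
    diag-* a b = eqs
      (solve 0 (con (+ 1) :* con (+ 1) :+ con (+ 0) :* con (+ 0) := con (+ 1)) refl)
      (solve 1 (λ b → con (+ 1) :* con (+ 0) :+ con (+ 0) :* b := con (+ 0)) refl b)
      (solve 1 (λ a → con (+ 0) :* con (+ 1) :+ a :* con (+ 0) := con (+ 0)) refl a)
      (solve 2 (λ a b → con (+ 0) :* con (+ 0) :+ a :* b := a :* b) refl a b)

  -- Integral matrices of trace 0 and determinant 1, distinct modulo scalars in every characteristic.
  involution : Fin 3 → M₂
  involution 0F = mat 0# (- 1#) 1# 0#
  involution 1F = mat 1# (- (1# + 1#)) 1# (- 1#)
  involution 2F = mat 1# (- 1#) (1# + 1#) (- 1#)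

  involution-fixed : ∀ σ i → Fixed σ (involution i)
  involution-fixed σ 0F = eqs (fixed-0 σ) (fixed-neg σ (fixed-1 σ)) (fixed-1 σ) (fixed-0 σ)
  involution-fixed σ 1F = eqs (fixed-1 σ) (fixed-neg σ (fixed-2 σ)) (fixed-1 σ) (fixed-neg σ (fixed-1 σ))
  involution-fixed σ 2F = eqs (fixed-1 σ) (fixed-neg σ (fixed-1 σ)) (fixed-2 σ) (fixed-neg σ (fixed-1 σ))

  involution-det : ∀ i → det (involution i) ≈ 1# * 1#
  involution-det 0F = solve 0 (con (+ 0) :* con (+ 0) :- (:- con (+ 1)) :* con (+ 1) := con (+ 1) :* con (+ 1)) refl
  involution-det 1F = solve 0 (con (+ 1) :* (:- con (+ 1)) :- (:- (con (+ 1) :+ con (+ 1))) :* con (+ 1) :=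
      con (+ 1) :* con (+ 1)) refl
  involution-det 2F = solve 0 (con (+ 1) :* (:- con (+ 1)) :- (:- con (+ 1)) :* (con (+ 1) :+ con (+ 1)) :=
      con (+ 1) :* con (+ 1)) refl

  involution² : ∀ i → involution i *ₘ involution i ≈ₘ (- 1#) • 1ₘ
  involution² i = ≈ₘ-trans (traceless² _ _ _ _ (trace i))
    (•-cong (-‿cong (trans (involution-det i) (*-identityʳ 1#))) ≈ₘ-refl)
    where
    trace : ∀ i → m₂₂ (involution i) ≈ - m₁₁ (involution i)
    trace 0F = solve 0 (con (+ 0) := :- con (+ 0)) refl
    trace 1F = refl
    trace 2F = refl
    traceless² : ∀ a b c d → d ≈ - a → mat a b c d *ₘ mat a b c d ≈ₘ (- (a * d - b * c)) • 1ₘ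
    traceless² a b c d d≈-a = ≈ₘ-trans (*ₘ-cong (eqs refl refl refl d≈-a) (eqs refl refl refl d≈-a))
      (≈ₘ-trans (eqs
        (solve 3 (λ a b c → a :* a :+ b :* c := (:- (a :* (:- a) :- b :* c)) :* con (+ 1)) refl a b c)
        (solve 3 (λ a b c → a :* b :+ b :* (:- a) := (:- (a :* (:- a) :- b :* c)) :* con (+ 0)) refl a b c)
        (solve 3 (λ a b c → c :* a :+ (:- a) :* c := (:- (a :* (:- a) :- b :* c)) :* con (+ 0)) refl a b c)
        (solve 3 (λ a b c → c :* b :+ (:- a) :* (:- a) := (:- (a :* (:- a) :- b :* c)) :* con (+ 1)) refl a b c))
        (•-cong (-‿cong (+-congʳ (*-congˡ (sym d≈-a)))) ≈ₘ-refl))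

  -1≉0 : ¬ (- 1# ≈ 0#)
  -1≉0 eq = 1≉0 (trans (solve 0 (con (+ 1) :=
      :- (:- con (+ 1))) refl) (trans (-‿cong eq) (solve 0 (:- con (+ 0) := con (+ 0)) refl)))

  involution-even : ∀ i k → ∃ λ s → ¬ (s ≈ 0#) × involution i ^ₘ (k ℕ.* 2) ≈ₘ s • 1ₘ
  involution-even i ℕ.zero    = 1# , 1≉0 , ≈ₘ-sym (•-identity 1ₘ)
  involution-even i (ℕ.suc k) = let (s , s≉0 , eq) = involution-even i k in
    - 1# * s , *≉0 -1≉0 s≉0 , ≈ₘ-trans (≈ₘ-sym (*ₘ-assoc (involution i) (involution i) _))
      (≈ₘ-trans (*ₘ-cong (involution² i) eq) (≈ₘ-trans (•-*ₘ (- 1#) s 1ₘ 1ₘ) (•-cong refl (*ₘ-identityˡ 1ₘ))))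

  involution-odd : ∀ i k → ∃ λ s → ¬ (s ≈ 0#) × involution i ^ₘ (1 ℕ.+ k ℕ.* 2) ≈ₘ s • involution i
  involution-odd i k = let (s , s≉0 , eq) = involution-even i k in
    s , s≉0 , ≈ₘ-trans (*ₘ-cong (≈ₘ-sym (•-identity (involution i))) eq)
      (≈ₘ-trans (•-*ₘ 1# s (involution i) 1ₘ) (•-cong (*-identityˡ s) (*ₘ-identityʳ (involution i))))

  involution-nonscalar : ∀ i → ¬ IsScalar (involution i)
  involution-nonscalar 0F sc = 1≉0 (s₂₁ sc)
  involution-nonscalar 1F sc = 1≉0 (s₂₁ sc)
  involution-nonscalar 2F sc = -1≉0 (s₁₂ sc)

  involution-distinct : ∀ k → ¬ (k ≈ 0#) →
    ¬ (involution 0F ≈ₘ k • involution 1F) × ¬ (involution 0F ≈ₘ k • involution 2F) × ¬ (involution 1F ≈ₘ k • involution 2F)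
  involution-distinct k k≉0 =
      (λ (eqs e _ _ _) → k≉0 (sym (trans e (*-identityʳ k))))
    , (λ (eqs e _ _ _) → k≉0 (sym (trans e (*-identityʳ k))))
    , (λ (eqs e _ f _) → 1≉0 (begin
        1#                            ≈⟨ solve 0 (con (+ 1) := con (+ 1) :+ con (+ 1) :- con (+ 1)) refl ⟩
        1# + 1# - 1#                  ≈⟨ +-cong (+-cong e e) (-‿cong f) ⟩
        k * 1# + k * 1# - k * (1# + 1#)
            ≈⟨ solve 1 (λ k → k :* con (+ 1) :+ k :* con (+ 1) :- k :* (con (+ 1) :+ con (+ 1)) :=
                con (+ 0)) refl k ⟩
        0#                            ∎))
    where open SetoidReasoning setoid

  -- Integral unipotents that do not commute modulo scalars in any characteristic.
  unipotent : Fin 3 → M₂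
  unipotent 0F = upper 1#
  unipotent 1F = lower 1#
  unipotent 2F = mat (1# + 1#) (- 1#) 1# 0#

  unipotent-fixed : ∀ σ i → Fixed σ (unipotent i)
  unipotent-fixed σ 0F = eqs (fixed-1 σ) (fixed-1 σ) (fixed-0 σ) (fixed-1 σ)
  unipotent-fixed σ 1F = eqs (fixed-1 σ) (fixed-0 σ) (fixed-1 σ) (fixed-1 σ)
  unipotent-fixed σ 2F = eqs (fixed-2 σ) (fixed-neg σ (fixed-1 σ)) (fixed-1 σ) (fixed-0 σ)

  unipotent-det : ∀ i → det (unipotent i) ≈ 1# * 1#
  unipotent-det 0F = solve 0 (con (+ 1) :* con (+ 1) :- con (+ 1) :* con (+ 0) := con (+ 1) :* con (+ 1)) refl
  unipotent-det 1F = solve 0 (con (+ 1) :* con (+ 1) :- con (+ 0) :* con (+ 1) := con (+ 1) :* con (+ 1)) refl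
  unipotent-det 2F = solve 0 ((con (+ 1) :+ con (+ 1)) :* con (+ 0) :- (:- con (+ 1)) :* con (+ 1) :=
      con (+ 1) :* con (+ 1)) refl

  -- Each of these matrices is 1 + N with N² = 0, so its p-th power is 1 + N^p = 1.
  unipotent-order : ∀ i → unipotent i ^ₘ p ≈ₘ 1ₘ
  unipotent-order i = ≈ₘ-trans (^ₘ-congˡ p (decompose i)) (≈ₘ-trans (frobenius-affine 1# (N i))
    (≈ₘ-trans (M.+-cong {scalarₘ (1# ^ p)} {1ₘ} (eqs (one^ p) refl refl (one^ p))
      (nilpotent^ p (ℕ.nonTrivial⇒n>1 p {{prime⇒nonTrivial pr}})))
      (M.+-identityʳ 1ₘ)))
    where
    N : Fin 3 → M₂
    N 0F = mat 0# 1# 0# 0#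
    N 1F = mat 0# 0# 1# 0#
    N 2F = mat 1# (- 1#) 1# (- 1#)

    decompose : ∀ i → unipotent i ≈ₘ scalarₘ 1# +ₘ N i
    decompose 0F = eqs (sym (+-identityʳ 1#)) (sym (+-identityˡ 1#)) (sym (+-identityʳ 0#)) (sym (+-identityʳ 1#))
    decompose 1F = eqs (sym (+-identityʳ 1#)) (sym (+-identityʳ 0#)) (sym (+-identityˡ 1#)) (sym (+-identityʳ 1#))
    decompose 2F = eqs refl (sym (+-identityˡ _)) (sym (+-identityˡ 1#)) (sym (-‿inverseʳ 1#))

    nilpotent : ∀ i → N i *ₘ N i ≈ₘ scalarₘ 0#
    nilpotent 0F = eqs
      (solve 0 (con (+ 0) :* con (+ 0) :+ con (+ 1) :* con (+ 0) := con (+ 0)) refl)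
      (solve 0 (con (+ 0) :* con (+ 1) :+ con (+ 1) :* con (+ 0) := con (+ 0)) refl)
      (solve 0 (con (+ 0) :* con (+ 0) :+ con (+ 0) :* con (+ 0) := con (+ 0)) refl)
      (solve 0 (con (+ 0) :* con (+ 1) :+ con (+ 0) :* con (+ 0) := con (+ 0)) refl)
    nilpotent 1F = eqs
      (solve 0 (con (+ 0) :* con (+ 0) :+ con (+ 0) :* con (+ 1) := con (+ 0)) refl)
      (solve 0 (con (+ 0) :* con (+ 0) :+ con (+ 0) :* con (+ 0) := con (+ 0)) refl)
      (solve 0 (con (+ 1) :* con (+ 0) :+ con (+ 0) :* con (+ 1) := con (+ 0)) refl)
      (solve 0 (con (+ 1) :* con (+ 0) :+ con (+ 0) :* con (+ 0) := con (+ 0)) refl)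
    nilpotent 2F = eqs
      (solve 0 (con (+ 1) :* con (+ 1) :+ (:- con (+ 1)) :* con (+ 1) := con (+ 0)) refl)
      (solve 0 (con (+ 1) :* (:- con (+ 1)) :+ (:- con (+ 1)) :* (:- con (+ 1)) := con (+ 0)) refl)
      (solve 0 (con (+ 1) :* con (+ 1) :+ (:- con (+ 1)) :* con (+ 1) := con (+ 0)) refl)
      (solve 0 (con (+ 1) :* (:- con (+ 1)) :+ (:- con (+ 1)) :* (:- con (+ 1)) := con (+ 0)) refl)

    nilpotent^ : ∀ k → 1 ℕ.< k → N i ^ₘ k ≈ₘ scalarₘ 0#
    nilpotent^ (ℕ.suc (ℕ.suc k)) _ = M.trans (M.sym (M.*-assoc (N i) (N i) (N i ^ₘ k)))
      (M.trans (M.*-congʳ {N i ^ₘ k} (nilpotent i)) (M.zeroˡ (N i ^ₘ k)))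
    nilpotent^ 1 (ℕ.s≤s ())

  -- For each pair some integral combination of entries is 1 on one product and 0 on the other,
  -- hence 0 on all its multiples.
  unipotent-noncommuting : ∀ k →
    let no-∝ = λ i j → ¬ (unipotent i *ₘ unipotent j ≈ₘ k • (unipotent j *ₘ unipotent i)) in
    no-∝ 0F 1F × no-∝ 0F 2F × no-∝ 1F 2F
  unipotent-noncommuting k =
      (λ (eqs e f _ _) → 1≉0 (begin
        1#  ≈⟨ solve 0 (con (+ 1) := (I :* I :+ I :* I) :- (I :* O :+ I :* I)) refl ⟩
        _   ≈⟨ +-cong e (-‿cong f) ⟩
        _   ≈⟨ solve 1 (λ k → k :* (I :* I :+ O :* O) :- k :* (I :* I :+ O :* I) := O) refl k ⟩
        0#  ∎))
    , (λ (eqs _ _ e f) → 1≉0 (begin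
        1#  ≈⟨ solve 0 (con (+ 1) := (O :* (I :+ I) :+ I :* I) :- (O :* (:- I) :+ I :* O)) refl ⟩
        _   ≈⟨ +-cong e (-‿cong f) ⟩
        _   ≈⟨ solve 1 (λ k → k :* (I :* I :+ O :* O) :- k :* (I :* I :+ O :* I) := O) refl k ⟩
        0#  ∎))
    , (λ (eqs _ _ _ e) → 1≉0 (begin
        1#  ≈⟨ solve 0 (I := :- (I :* (:- I) :+ I :* O)) refl ⟩
        _   ≈⟨ -‿cong e ⟩
        _   ≈⟨ solve 1 (λ k → :- (k :* (I :* O :+ O :* I)) := O) refl k ⟩
        0#  ∎))
    where
    open SetoidReasoning setoid
    I O : ∀ {m} → Polynomial m
    I = con (+ 1)
    O = con (+ 0)

module SemilinearGroups {p : ℕ} (n : ℕ) (pr : Prime p) (F : FiniteField c ℓ (p ℕ.^ n)) where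
  open FiniteField F
  open Matrices commutativeRing
  open MatrixRing commutativeRing
  open Centralizer n pr F using (cancel; IsScalar-•⁻)
  open LinearGroups F using (*≉0; unit≉0)
  open FieldFacts n pr F
  open SpecialMatrices n pr F
  open IntegerSolver commutativeRing
  open Exp commutativeSemiring using (_^_)
  open RingAutomorphism

  infix 4 _∝_

  _∝_ : M₂ → M₂ → Set _
  A ∝ B = ∃ λ k → ¬ (k ≈ 0#) × A ≈ₘ k • B

  module Semilinear {a h} (H : Group a h) (lin : Group.Carrier H → M₂) (aut : Group.Carrier H → Aut)
    (lin-∙ : ∀ x y → lin (Group._∙_ H x y) ≈ₘ lin x *ₘ mapₘ ⟦ aut x ⟧ (lin y))
    (aut-∙ : ∀ x y b → ⟦ aut (Group._∙_ H x y) ⟧ b ≈ ⟦ aut x ⟧ (⟦ aut y ⟧ b))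
    (lin-ε : lin (Group.ε H) ≈ₘ 1ₘ)
    (aut-ε : ∀ b → ⟦ aut (Group.ε H) ⟧ b ≈ b)
    (≈⇒∝ : ∀ {x y} → Group._≈_ H x y → lin x ∝ lin y)
    (∝⇒≈ : ∀ {x y} → lin x ∝ lin y → (∀ b → ⟦ aut x ⟧ b ≈ ⟦ aut y ⟧ b) → Group._≈_ H x y)
    where
    private
      module H = Group H
    open GroupPowers H

    -- An element is tracked by a convenient matrix and a bare function. Products and powers can
    -- then be described with `id`, composites and `iterate`, with no automorphism to construct.
    record Is (x : H.Carrier) (A : M₂) (f : Carrier → Carrier) : Set (c ⊔ ℓ) where
      constructor is
      field
        lin≈ : lin x ≈ₘ A
        aut≈ : ∀ b → ⟦ aut x ⟧ b ≈ f b

    Is-resp : ∀ {x A B f g} → A ≈ₘ B → (∀ b → f b ≈ g b) → Is x A f → Is x B g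
    Is-resp A≈B f≈g (is p q) = is (≈ₘ-trans p A≈B) (λ b → trans (q b) (f≈g b))

    Is-ε : Is H.ε 1ₘ id
    Is-ε = is lin-ε aut-ε

    Is-∙ : ∀ {x y A B f g} → Is x A f → Is y B g → Is (x H.∙ y) (A *ₘ mapₘ f B) (f ∘ g)
    Is-∙ {x} {y} (is p q) (is p′ q′) = is
      (≈ₘ-trans (lin-∙ x y) (*ₘ-cong p (≈ₘ-trans (mapₘ-cong (aut x) p′) (eqs (q _) (q _) (q _) (q _)))))
      (λ b → trans (aut-∙ x y b) (trans (⟦⟧-cong (aut x) (q′ b)) (q _)))

    Is-≈ : ∀ {x y A B f g} → Is x A f → Is y B g → A ∝ B → (∀ b → f b ≈ g b) → x H.≈ y
    Is-≈ (is p q) (is p′ q′) (k , k≉0 , A≈kB) f≈g = ∝⇒≈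
      (k , k≉0 , ≈ₘ-trans p (≈ₘ-trans A≈kB (•-cong refl (≈ₘ-sym p′))))
      (λ b → trans (q b) (trans (f≈g b) (sym (q′ b))))

    Is-∝ : ∀ {x y A B f g} → Is x A f → Is y B g → x H.≈ y → A ∝ B
    Is-∝ (is p _) (is p′ _) x≈y = let (k , k≉0 , eq) = ≈⇒∝ x≈y in
      k , k≉0 , ≈ₘ-trans (≈ₘ-sym p) (≈ₘ-trans eq (•-cong refl p′))

    ≈ₘ⇒∝ : ∀ {A B} → A ≈ₘ B → A ∝ B
    ≈ₘ⇒∝ eq = 1# , 1≉0 , ≈ₘ-trans eq (≈ₘ-sym (•-identity _))

    Is-· : ∀ {x A} (σ : Aut) → Fixed σ A → Is x A ⟦ σ ⟧ → ∀ k → Is (k · x) (A ^ₘ k) (iterate ⟦ σ ⟧ k)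
    Is-· σ fix x-is ℕ.zero    = Is-ε
    Is-· {A = A} σ fix x-is (ℕ.suc k) = Is-resp (*ₘ-cong ≈ₘ-refl (Fixed-^ σ A k fix)) (λ _ → refl)
      (Is-∙ x-is (Is-· σ fix x-is k))

    Is-·-linear : ∀ {x A} → Is x A id → ∀ k → Is (k · x) (A ^ₘ k) id
    Is-·-linear x-is ℕ.zero    = Is-ε
    Is-·-linear x-is (ℕ.suc k) = Is-∙ x-is (Is-·-linear x-is k)

    Is-diag-∙ : ∀ {x y a b f g} → Is x (diag a) f → Is y (diag b) g → f 0# ≈ 0# → f 1# ≈ 1# →
                Is (x H.∙ y) (diag (a * f b)) (f ∘ g)
    Is-diag-∙ {a = a} {b} {f} x-is y-is f0 f1 = Is-resp (eqs
      (trans (+-cong (trans (*-identityˡ _) f1) (zeroˡ _)) (+-identityʳ 1#))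
      (trans (+-cong (trans (*-identityˡ _) f0) (zeroˡ _)) (+-identityʳ 0#))
      (trans (+-cong (zeroˡ _) (trans (*-congˡ f0) (zeroʳ a))) (+-identityʳ 0#))
      (trans (+-cong (zeroˡ _) refl) (+-identityˡ _))) (λ _ → refl) (Is-∙ x-is y-is)

    Is-diag-commute : ∀ {x y a b f g} → Is x (diag a) f → Is y (diag b) g →
                      f 0# ≈ 0# → f 1# ≈ 1# → g 0# ≈ 0# → g 1# ≈ 1# → Commute x y → a * f b ≈ b * g a
    Is-diag-commute x-is y-is f0 f1 g0 g1 xy
      with Is-∝ (Is-diag-∙ x-is y-is f0 f1) (Is-diag-∙ y-is x-is g0 g1) xy
    ... | k , _ , eqs e₁ _ _ e₂ = trans e₂ (trans (*-congʳ (trans (sym (*-identityʳ k)) (sym e₁))) (*-identityˡ _))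

    -- Shows both kinds of centre to be nondominating: σ, with z = 1 and u moved by σ, and diag(1,
    -- z), with u = 1 and z ≠ 1.
    Is-upper-noncommuting : ∀ {x y z u f} → Is x (diag z) f → Is y (upper u) id →
                            f 0# ≈ 0# → f 1# ≈ 1# → ¬ (f u ≈ u * z) → ¬ Commute x y
    Is-upper-noncommuting {z = z} {u} {f} x-is y-is f0 f1 fu≉uz xy with Is-∝ (Is-∙ x-is y-is) (Is-∙ y-is x-is) xy
    ... | k , _ , eqs e₁ e₂ _ _ = fu≉uz (begin
      f u                          ≈⟨ solve 2 (λ f g → f := con (+ 1) :* f :+ con (+ 0) :* g) refl (f u) (f 1#) ⟩
      1# * f u + 0# * f 1#         ≈⟨ e₂ ⟩
      k * (1# * 0# + u * z)        ≈⟨ *-congʳ (begin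
        k
            ≈⟨ solve 2 (λ k u → k := k :* (con (+ 1) :* con (+ 1) :+ u :* con (+ 0))) refl k u ⟩
        k * (1# * 1# + u * 0#)     ≈⟨ e₁ ⟨
        1# * f 1# + 0# * f 0#      ≈⟨ trans (+-cong (trans (*-identityˡ _) f1) (zeroˡ _)) (+-identityʳ 1#) ⟩
        1#                         ∎) ⟩
      1# * (1# * 0# + u * z)
          ≈⟨ solve 2 (λ u z → con (+ 1) :* (con (+ 1) :* con (+ 0) :+ u :* z) := u :* z) refl u z ⟩
      u * z                        ∎)
      where open SetoidReasoning setoid

    ¬-clawFree = ¬ ClawFree (properEnhancedPowerGraph H)

    Is-pure-noncommuting : ∀ {x y} (σ : Aut) {x₀} → Is x 1ₘ ⟦ σ ⟧ → ¬ (⟦ σ ⟧ x₀ ≈ x₀) →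
                           Is y (upper x₀) id → ¬ Commute x y
    Is-pure-noncommuting σ x-is moved y-is = Is-upper-noncommuting x-is y-is (0#-homo σ) (1#-homo σ)
      (λ eq → moved (trans eq (*-identityʳ _)))

    -- With l odd and σ^l = 1, the leaf tσ satisfies (tσ)^(l + 1) = σ and (tσ)^l = t modulo scalars.
    -- A cyclic group containing two leaves would contain two distinct involutions t.
    involutionClaw : ∀ (σ : Aut) m → (∀ b → iterate ⟦ σ ⟧ (1 ℕ.+ m ℕ.* 2) b ≈ b) → ∀ {x₀} → ¬ (⟦ σ ⟧ x₀ ≈ x₀) →
      ∀ {centre d} (leaf : Fin 3 → H.Carrier) → Is centre 1ₘ ⟦ σ ⟧ → Is d (upper x₀) id →
      (∀ i → Is (leaf i) (involution i) ⟦ σ ⟧) → ¬-clawFree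
    involutionClaw σ m σˡ moved {centre} {d} leaf centre-is d-is leaf-is = claw centre d
      (Is-pure-noncommuting σ centre-is moved d-is) leaf
      (λ i → ℕ.suc l , to-centre i)
      (pairwise isCyclic-sym
        (λ cyc → let (k , k≉0 , eq) = ∝-of cyc in proj₁ (involution-distinct k k≉0) eq)
        (λ cyc → let (k , k≉0 , eq) = ∝-of cyc in proj₁ (proj₂ (involution-distinct k k≉0)) eq)
        (λ cyc → let (k , k≉0 , eq) = ∝-of cyc in proj₂ (proj₂ (involution-distinct k k≉0)) eq))
      where
      l = 1 ℕ.+ m ℕ.* 2
      power : ∀ i k → Is (k · leaf i) (involution i ^ₘ k) (iterate ⟦ σ ⟧ k)
      power i = Is-· σ (involution-fixed σ i) (leaf-is i)

      to-centre : ∀ i → ℕ.suc l · leaf i H.≈ centre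
      to-centre i = Is-≈ (power i (ℕ.suc l)) centre-is (involution-even i (ℕ.suc m))
        (λ b → ⟦⟧-cong σ (σˡ b))

      torsion : ∀ i → (2 ℕ.* l) · leaf i H.≈ H.ε
      torsion i = H.trans (·-congˡ (ℕ.*-comm 2 l)) (Is-≈ (power i (l ℕ.* 2)) Is-ε (involution-even i l)
        (λ b → trans (reflexive (≡.cong (λ k → iterate ⟦ σ ⟧ k b) (ℕ.*-comm l 2)))
          (iterate-multiple ⟦ σ ⟧ (⟦⟧-cong σ) (injective σ) l 2 (σˡ b))))

      odd : ∀ i → Is (l · leaf i) (involution i ^ₘ l) (iterate ⟦ σ ⟧ l)
      odd i = power i l

      nontrivial : ∀ i → ¬ (l · leaf i H.≈ H.ε)
      nontrivial i eq = let (k , k≉0 , p) = Is-∝ (odd i) Is-ε eq ; (s , s≉0 , q) = involution-odd i m in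
        involution-nonscalar i (IsScalar-•⁻ {s} {involution i} s≉0
          (IsScalar-resp (≈ₘ-trans (≈ₘ-sym p) q) (IsScalar-• k {1ₘ} (scalar refl refl refl))))

      ∝-cancel : ∀ {A B s t} → ¬ (s ≈ 0#) → ¬ (t ≈ 0#) → s • A ∝ t • B → A ∝ B
      ∝-cancel {A} {B} {s} {t} s≉0 t≉0 (k , k≉0 , eq) = let (s′ , ss′≈1) = invertible s s≉0 in
        s′ * (k * t) , *≉0 (unit≉0 (trans (*-comm s′ s) ss′≈1)) (*≉0 k≉0 t≉0) ,
        ≈ₘ-trans (≈ₘ-sym (≈ₘ-trans (≈ₘ-sym (•-assoc s′ s A))
          (≈ₘ-trans (•-cong (trans (*-comm s′ s) ss′≈1) ≈ₘ-refl) (•-identity A))))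
          (≈ₘ-trans (•-cong refl (≈ₘ-trans eq (≈ₘ-sym (•-assoc k t B)))) (≈ₘ-sym (•-assoc s′ (k * t) B)))

      ∝-of : ∀ {i j} → IsCyclic H (⟨_,_⟩ H (leaf i) (leaf j)) → involution i ∝ involution j
      ∝-of {i} {j} cyc =
        let (s , s≉0 , p) = involution-odd i m ; (t , t≉0 , q) = involution-odd j m
            (k , k≉0 , eq) = Is-∝ (odd i) (odd j)
              (cyclic-involution-unique l cyc (torsion i) (torsion j) (nontrivial i) (nontrivial j))
        in ∝-cancel s≉0 t≉0 (k , k≉0 , ≈ₘ-trans (≈ₘ-sym p) (≈ₘ-trans eq (•-cong refl q)))

    -- p is odd and σ² = 1, so (uσ)^p = u^p σ^p = σ. Two leaves do not commute because their
    -- unipotents do not, even modulo scalars.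
    unipotentClaw : ∀ (σ : Aut) m → p ≡ 1 ℕ.+ m ℕ.* 2 → (∀ b → ⟦ σ ⟧ (⟦ σ ⟧ b) ≈ b) → ∀ {x₀} → ¬ (⟦ σ ⟧ x₀ ≈ x₀) →
      ∀ {centre d} (leaf : Fin 3 → H.Carrier) → Is centre 1ₘ ⟦ σ ⟧ → Is d (upper x₀) id →
      (∀ i → Is (leaf i) (unipotent i) ⟦ σ ⟧) → ¬-clawFree
    unipotentClaw σ m p-odd σσ moved {centre} {d} leaf centre-is d-is leaf-is = claw centre d
      (Is-pure-noncommuting σ centre-is moved d-is) leaf
      (λ i → p , Is-≈ (Is-· σ (unipotent-fixed σ i) (leaf-is i) p) centre-is
        (≈ₘ⇒∝ (unipotent-order i)) σᵖ)
      (pairwise isCyclic-sym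
        (λ cyc → let (k , _ , eq) = ∝-of cyc in proj₁ (unipotent-noncommuting k) eq)
        (λ cyc → let (k , _ , eq) = ∝-of cyc in proj₁ (proj₂ (unipotent-noncommuting k)) eq)
        (λ cyc → let (k , _ , eq) = ∝-of cyc in proj₂ (proj₂ (unipotent-noncommuting k)) eq))
      where
      σᵖ : ∀ b → iterate ⟦ σ ⟧ p b ≈ ⟦ σ ⟧ b
      σᵖ b = trans (reflexive (≡.cong (λ k → iterate ⟦ σ ⟧ k b) p-odd))
        (⟦⟧-cong σ (iterate-multiple ⟦ σ ⟧ (⟦⟧-cong σ) (injective σ) 2 m (σσ b)))
      product : ∀ i j → Is (leaf i H.∙ leaf j) (unipotent i *ₘ unipotent j) (⟦ σ ⟧ ∘ ⟦ σ ⟧)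
      product i j = Is-resp (*ₘ-cong ≈ₘ-refl (unipotent-fixed σ j)) (λ _ → refl) (Is-∙ (leaf-is i) (leaf-is j))
      ∝-of : ∀ {i j} → IsCyclic H (⟨_,_⟩ H (leaf i) (leaf j)) →
             unipotent i *ₘ unipotent j ∝ unipotent j *ₘ unipotent i
      ∝-of {i} {j} cyc = Is-∝ (product i j) (product j i) (isCyclic⇒commute cyc)

    torusClaw : ∀ (σ : Aut) {α} (t : TorusClaw σ α) → let open TorusClaw t in (∀ b → ⟦ σ ⟧ (⟦ σ ⟧ b) ≈ b) →
      ∀ {centre d} (leaf : Fin 3 → H.Carrier) → Is centre (diag z) id → Is d (upper 1#) id →
      Is (leaf 0F) (diag a₀) id → Is (leaf 1F) (diag a₁) ⟦ σ ⟧ → Is (leaf 2F) (diag a₂) ⟦ σ ⟧ →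
      ¬-clawFree
    torusClaw σ t σσ {centre} {d} leaf centre-is d-is leaf₀ leaf₁ leaf₂ = claw centre d
      (Is-upper-noncommuting centre-is d-is refl refl (λ eq → z≉1 (trans (sym (*-identityˡ _)) (sym eq)))) leaf
      to-centre
      (pairwise isCyclic-sym
        (λ cyc → moved-by leaf₁ a₁≉0 (isCyclic⇒commute cyc))
        (λ cyc → moved-by leaf₂ a₂≉0 (isCyclic⇒commute cyc))
        (λ cyc → a₁a₂ (Is-diag-commute leaf₁ leaf₂ (0#-homo σ) (1#-homo σ) (0#-homo σ) (1#-homo σ) (isCyclic⇒commute cyc))))
      where
      open TorusClaw t
      linear-power : ∀ {x a} k → Is x (diag a) id → a ^ k ≈ z → k · x H.≈ centre
      linear-power {a = a} k x-is eq = Is-≈ (Is-·-linear x-is k) centre-is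
        (≈ₘ⇒∝ (≈ₘ-trans (diag-^ a k) (eqs refl refl refl eq))) (λ _ → refl)

      semilinear-power : ∀ {x a} k → Is x (diag a) ⟦ σ ⟧ → (a * ⟦ σ ⟧ a) ^ k ≈ z → (k ℕ.* 2) · x H.≈ centre
      semilinear-power {x} k x-is eq = H.trans (H.sym (·-assocˡ x k 2))
        (H.trans (·-congʳ k (H.∙-congˡ (H.identityʳ x)))
          (linear-power k (Is-resp ≈ₘ-refl σσ (Is-diag-∙ x-is x-is (0#-homo σ) (1#-homo σ))) eq))

      to-centre : ∀ i → ∃ λ k → k · leaf i H.≈ centre
      to-centre 0F = let (k , eq) = power₀ in k , linear-power k leaf₀ eq
      to-centre 1F = let (k , eq) = power₁ in k ℕ.* 2 , semilinear-power k leaf₁ eq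
      to-centre 2F = let (k , eq) = power₂ in k ℕ.* 2 , semilinear-power k leaf₂ eq

      moved-by : ∀ {x a} → Is x (diag a) ⟦ σ ⟧ → ¬ (a ≈ 0#) → ¬ Commute (leaf 0F) x
      moved-by {a = a} x-is a≉0 comm = a₀-moved (cancel a≉0 (sym (trans (*-comm a _)
        (Is-diag-commute leaf₀ x-is refl refl (0#-homo σ) (1#-homo σ) comm))))

-- Subgroups of PΓL(2, q) containing PSL(2, q)

iterate-square : ∀ {a} {A : Set a} (f : A → A) k x → iterate (f ∘ f) k x ≡ iterate f (k ℕ.* 2) x
iterate-square f ℕ.zero    x = ≡.refl
iterate-square f (ℕ.suc k) x = ≡.cong (f ∘ f) (iterate-square f k x)

module Theorem {p : ℕ} (n : ℕ) (pr : Prime p) (F : FiniteField c ℓ (p ℕ.^ n))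
  (G : Subgroup (ProjectiveSemilinear.PΓL n pr F) s) where
  open FiniteField F
  open Frobenius n pr F using (_≟_)
  open Matrices commutativeRing
  open LinearGroups F using (InvertibleMatrix; inv; matrix; _∼_; scaled; module GL; unit≉0)
  open ProjectiveSemilinear n pr F hiding (PGL)
  open IntegerSolver commutativeRing
  open RingAutomorphism
  open FieldFacts n pr F
  open SpecialMatrices n pr F
  open Inverse enumeration using (to; from; strictlyInverseʳ)
  module G = Subgroup G

  ⟨φ⟩-group : Group _ _
  ⟨φ⟩-group = subgroupGroup (automorphismGroup commutativeRing) ⟨φ⟩
  module Φ = Group ⟨φ⟩-group

  𝔾 : Group _ _
  𝔾 = subgroupGroup PΓL G

  -- Subgroups of PGL(2, q) give claw-free graphs

  module Linear (G≤PGL : G ≤ PGL-subgroup) where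
    trivial : ∀ (x : Group.Carrier 𝔾) y → ⟦ proj₁ (proj₂ (proj₁ x)) ⟧ y ≈ y
    trivial (_ , x∈G) = proj₂ (G≤PGL x∈G)

    trivialₘ : ∀ (x : Group.Carrier 𝔾) A → mapₘ ⟦ proj₁ (proj₂ (proj₁ x)) ⟧ A ≈ₘ A
    trivialₘ x A = eqs (trivial x _) (trivial x _) (trivial x _) (trivial x _)

    embed : Group.Carrier 𝔾 → InvertibleMatrix
    embed ((A , _) , _) = A

    embed-injective : ∀ {x y} → embed x ∼ embed y → Group._≈_ 𝔾 x y
    embed-injective {x} {y} A∼B = A∼B , λ z → trans (trivial x z) (sym (trivial y z))

    clawFree : ClawFree (properEnhancedPowerGraph 𝔾)
    clawFree = GroupPowers.transitive⇒clawFree 𝔾 λ {v} {u} {w} →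
      Embedded.adjacency-transitive n pr F 𝔾 embed
        -- Products and inverses in PΓL are twisted by the automorphism component, which acts
        -- trivially here.
        (λ x y → *ₘ-cong ≈ₘ-refl (trivialₘ x (matrix (embed y))))
        ≈ₘ-refl
        (λ x → trivialₘ (Group._⁻¹ 𝔾 x) (InvertibleMatrix.inverse (embed x)))
        proj₁ (λ {x} {y} → embed-injective {x} {y}) {v} {u} {w}

  -- Matrices with prescribed determinant class and claws from nonlinear elements

  fromDet : ∀ M k → det M * k ≈ 1# → InvertibleMatrix
  fromDet (mat a b c d) k eq = inv (mat a b c d) (k • mat d (- b) (- c) a)
    (eqs (trans (solve 5 (λ a b c d k → k :* d :* a :+ k :* (:- b) :* c :=
        (a :* d :- b :* c) :* k) refl a b c d k) eq)
         (solve 3 (λ b d k → k :* d :* b :+ k :* (:- b) :* d := con (+ 0)) refl b d k)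
         (solve 3 (λ a c k → k :* (:- c) :* a :+ k :* a :* c := con (+ 0)) refl a c k)
         (trans (solve 5 (λ a b c d k → k :* (:- c) :* b :+ k :* a :* d :=
             (a :* d :- b :* c) :* k) refl a b c d k) eq))
    (eqs (trans (solve 5 (λ a b c d k → a :* (k :* d) :+ b :* (k :* (:- c)) :=
        (a :* d :- b :* c) :* k) refl a b c d k) eq)
         (solve 3 (λ a b k → a :* (k :* (:- b)) :+ b :* (k :* a) := con (+ 0)) refl a b k)
         (solve 3 (λ c d k → c :* (k :* d) :+ d :* (k :* (:- c)) := con (+ 0)) refl c d k)
         (trans (solve 5 (λ a b c d k → c :* (k :* (:- b)) :+ d :* (k :* a) :=
             (a :* d :- b :* c) :* k) refl a b c d k) eq))

  det-• : ∀ k M → det (k • M) ≈ (k * k) * det M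
  det-• k (mat a b c d) = solve 5 (λ k a b c d → (k :* a) :* (k :* d) :- (k :* b) :* (k :* c) :=
      (k :* k) :* (a :* d :- b :* c)) refl k a b c d

  det-inverse : ∀ A → det (matrix A) * det (matrix (A GL.⁻¹)) ≈ 1#
  det-inverse A = trans (sym (det-*ₘ _ _)) (trans (det-cong (InvertibleMatrix.inverseʳ A)) det-1ₘ)

  det≉0 : ∀ A → ¬ (det (matrix A) ≈ 0#)
  det≉0 A = unit≉0 (det-inverse A)

  -- Division by a square root k of the determinant gives a representative of determinant 1.
  square-det⇒PSL : ∀ A k → ¬ (k ≈ 0#) → det (matrix A) ≈ k * k → Subgroup.Member PSL A
  square-det⇒PSL A k k≉0 det≈ = build (invertible k k≉0)
    where
    build : (∃ λ k′ → k * k′ ≈ 1#) → Subgroup.Member PSL A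
    build (k′ , kk′≈1) = fromDet (k′ • matrix A) 1# (trans (*-identityʳ _) det≈1) , det≈1 , scaled k k≉0
      (≈ₘ-sym (≈ₘ-trans (≈ₘ-sym (•-assoc k k′ (matrix A))) (≈ₘ-trans (•-cong kk′≈1 ≈ₘ-refl) (•-identity (matrix A)))))
      where
      det≈1 : det (k′ • matrix A) ≈ 1#
      det≈1 = begin
        det (k′ • matrix A)           ≈⟨ det-• k′ (matrix A) ⟩
        (k′ * k′) * det (matrix A)    ≈⟨ *-congˡ det≈ ⟩
        (k′ * k′) * (k * k)
            ≈⟨ solve 2 (λ k k′ → (k′ :* k′) :* (k :* k) := (k :* k′) :* (k :* k′)) refl k k′ ⟩
        (k * k′) * (k * k′)           ≈⟨ *-cong kk′≈1 kk′≈1 ⟩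
        1# * 1#                       ≈⟨ *-identityˡ 1# ⟩
        1#                            ∎
        where open SetoidReasoning setoid

  norm-square : ∀ {σ} → Subgroup.Member ⟨φ⟩ σ → ∀ x → Square (x * ⟦ σ ⟧ x)
  norm-square {σ} σ∈ x = [ (λ p≡2 → all-square p≡2 _)
                         , (λ (m , p-odd) → let (j , σ≈) = frobenius-power σ∈ in Square-norm m p-odd σ j σ≈ x)
                         ]′ (prime-parity pr)

  moved? : ∀ (σ : Aut) → (∃ λ x → ¬ (⟦ σ ⟧ x ≈ x)) ⊎ (∀ x → ⟦ σ ⟧ x ≈ x)
  moved? σ = go (Fin.any? (λ i → ¬? ((⟦ σ ⟧ (from i)) ≟ from i)))
    where
    go : Dec (∃ λ i → ¬ (⟦ σ ⟧ (from i) ≈ from i)) → (∃ λ x → ¬ (⟦ σ ⟧ x ≈ x)) ⊎ (∀ x → ⟦ σ ⟧ x ≈ x)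
    go (yes (i , moved)) = inj₁ (from i , moved)
    go (no none) = inj₂ λ x → trans (⟦⟧-cong σ (sym (strictlyInverseʳ x)))
      (trans (decidable-stable ((⟦ σ ⟧ (from (to x))) ≟ from (to x)) (λ moved → none (to x , moved))) (strictlyInverseʳ x))

  module NotClawFree (S≤G : PSL-subgroup ≤ G) where
    _∈G : InvertibleMatrix × Φ.Carrier → Set _
    x ∈G = G.Member x

    linear∈G : ∀ A k → ¬ (k ≈ 0#) → det (matrix A) ≈ k * k → (A , Φ.ε) ∈G
    linear∈G A k k≉0 det≈ = S≤G {A , Φ.ε} (square-det⇒PSL A k k≉0 det≈ , λ _ → refl)

    -- B A⁻¹ has square determinant and so lies in PSL ≤ G. For a given σ, membership in G thus
    -- depends on the matrix only through its determinant modulo squares.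
    same-det-class∈G : ∀ {A σ} B k → ¬ (k ≈ 0#) → (A , σ) ∈G → det (matrix B) ≈ det (matrix A) * (k * k) → (B , σ) ∈G
    same-det-class∈G {A} {σ} B k k≉0 A∈ det≈ = G.resp
      {((B GL.∙ A GL.⁻¹) , Φ.ε) ∙ᴳ (A , σ)} {B , σ}
      (scaled 1# 1≉0 (≈ₘ-trans cancelled (≈ₘ-sym (•-identity (matrix B)))) , λ _ → refl)
      (G.∙-∈ {(B GL.∙ A GL.⁻¹) , Φ.ε} {A , σ} (linear∈G (B GL.∙ A GL.⁻¹) k k≉0 (begin
        det (matrix (B GL.∙ A GL.⁻¹))                             ≈⟨ det-*ₘ (matrix B) (matrix (A GL.⁻¹)) ⟩
        det (matrix B) * det (matrix (A GL.⁻¹))                   ≈⟨ *-congʳ det≈ ⟩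
        det (matrix A) * (k * k) * det (matrix (A GL.⁻¹))
            ≈⟨ solve 3 (λ a k b → a :* k :* b :=
                a :* b :* k) refl (det (matrix A)) (k * k) (det (matrix (A GL.⁻¹))) ⟩
        det (matrix A) * det (matrix (A GL.⁻¹)) * (k * k)         ≈⟨ *-congʳ (det-inverse A) ⟩
        1# * (k * k)                                              ≈⟨ *-identityˡ _ ⟩
        k * k                                                     ∎)) A∈)
      where
      open SetoidReasoning setoid
      _∙ᴳ_ = Group._∙_ PΓL
      A′ = InvertibleMatrix.inverse A
      cancelled : (matrix B *ₘ A′) *ₘ matrix A ≈ₘ matrix B
      cancelled = ≈ₘ-trans (*ₘ-assoc (matrix B) A′ (matrix A))
        (≈ₘ-trans (*ₘ-cong ≈ₘ-refl (InvertibleMatrix.inverseˡ A)) (*ₘ-identityʳ (matrix B)))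

    pure∈G : ∀ {A σ r} → (A , σ) ∈G → det (matrix A) ≈ r * r → (GL.ε , σ) ∈G
    pure∈G {A} {σ} {r} A∈ det≈rr = go (invertible r (square-root≉0 (det≉0 A) det≈rr))
      where
      go : (∃ λ r′ → r * r′ ≈ 1#) → (GL.ε , σ) ∈G
      go (r′ , rr′≈1) = same-det-class∈G GL.ε r′ (unit≉0 (trans (*-comm r′ r) rr′≈1)) A∈ (begin
        det 1ₘ                         ≈⟨ det-1ₘ ⟩
        1#                             ≈⟨ *-identityˡ 1# ⟨
        1# * 1#                        ≈⟨ *-cong rr′≈1 rr′≈1 ⟨
        (r * r′) * (r * r′)            ≈⟨ solve 2 (λ r s → (r :* s) :* (r :* s) := (r :* r) :* (s :* s)) refl r r′ ⟩
        (r * r) * (r′ * r′)            ≈⟨ *-congʳ det≈rr ⟨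
        det (matrix A) * (r′ * r′)     ∎)
        where open SetoidReasoning setoid

    -- The matrix of (A, σ)² is A σ(A), whose determinant is the norm det A · σ(det A).
    square∈G : ∀ {A σ} → (A , σ) ∈G → (GL.ε , σ Φ.∙ σ) ∈G
    square∈G {A} {σ} A∈ = let (r , eq) = norm-square (proj₂ σ) (det (matrix A)) in
      pure∈G {_} {σ Φ.∙ σ} {r} (G.∙-∈ {A , σ} {A , σ} A∈ A∈)
        (trans (det-*ₘ (matrix A) _) (trans (*-congˡ (map-det (matrix A))) eq))
      where
      map-det : ∀ M → det (mapₘ ⟦ proj₁ σ ⟧ M) ≈ ⟦ proj₁ σ ⟧ (det M)
      map-det (mat a b c d) = sym (trans (+-homo (proj₁ σ) (a * d) (- (b * c)))
        (+-cong (*-homo (proj₁ σ) a d) (trans (-‿homo (proj₁ σ) (b * c)) (-‿cong (*-homo (proj₁ σ) b c)))))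

    open SemilinearGroups.Semilinear n pr F 𝔾 (λ ((A , _) , _) → matrix A) (λ ((_ , σ , _) , _) → σ)
      (λ _ _ → ≈ₘ-refl) (λ _ _ _ → refl) ≈ₘ-refl (λ _ → refl)
      (λ (scaled k k≉0 eq , _) → k , k≉0 , eq)
      (λ (k , k≉0 , eq) σ≈τ → scaled k k≉0 eq , σ≈τ)

    element : ∀ A σ → (A , σ) ∈G → Group.Carrier 𝔾
    element A σ A∈ = (A , σ) , A∈

    element-is : ∀ A σ A∈ → Is (element A σ A∈) (matrix A) ⟦ proj₁ σ ⟧
    element-is A σ A∈ = is ≈ₘ-refl (λ _ → refl)

    ∃-linear : ∀ M → det M ≈ 1# * 1# → ∃ λ x → Is x M id
    ∃-linear M det≈ = let A = fromDet M 1# (trans (*-identityʳ _) (trans det≈ (*-identityˡ 1#))) in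
      element A Φ.ε (linear∈G A 1# 1≉0 det≈) , is ≈ₘ-refl (λ _ → refl)

    ∃-class : ∀ {A} σ → (A , σ) ∈G → ∀ M k → ¬ (det M ≈ 0#) → ¬ (k ≈ 0#) → det M ≈ det (matrix A) * (k * k) →
              ∃ λ x → Is x M ⟦ proj₁ σ ⟧
    ∃-class {A} σ A∈ M k det≉0 k≉0 det≈ = let (d , eq) = invertible (det M) det≉0 ; B = fromDet M d eq in
      element B σ (same-det-class∈G {A} {σ} B k k≉0 A∈ det≈) , is ≈ₘ-refl (λ _ → refl)

    ∃-pure : ∀ σ → (GL.ε , σ) ∈G → ∀ M → det M ≈ 1# * 1# → ∃ λ x → Is x M ⟦ proj₁ σ ⟧
    ∃-pure σ ε∈ M det≈ = ∃-class {GL.ε} σ ε∈ M 1# (λ d≈0 → 1≉0 (trans (sym (*-identityˡ 1#)) (trans (sym det≈) d≈0))) 1≉0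
      (trans det≈ (trans (sym (*-identityˡ _)) (*-congʳ (sym det-1ₘ))))

    det-upper : ∀ u → det (upper u) ≈ 1# * 1#
    det-upper u = solve 1 (λ u → con (+ 1) :* con (+ 1) :- u :* con (+ 0) := con (+ 1) :* con (+ 1)) refl u

    det-diag : ∀ a → det (diag a) ≈ a
    det-diag a = solve 1 (λ a → con (+ 1) :* a :- con (+ 0) :* con (+ 0) := a) refl a

    odd-case : ∀ σ → (GL.ε , σ) ∈G → ∀ m → (∀ b → iterate ⟦ proj₁ σ ⟧ (1 ℕ.+ m ℕ.* 2) b ≈ b) →
               ∀ {x₀} → ¬ (⟦ proj₁ σ ⟧ x₀ ≈ x₀) → ¬-clawFree
    odd-case σ ε∈ m period {x₀} moved = involutionClaw (proj₁ σ) m period moved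
      (λ i → proj₁ (leaf i)) (element-is GL.ε σ ε∈) (proj₂ (∃-linear (upper x₀) (det-upper x₀))) (λ i → proj₂ (leaf i))
      where
      leaf : ∀ i → ∃ λ x → Is x (involution i) ⟦ proj₁ σ ⟧
      leaf i = ∃-pure σ ε∈ (involution i) (involution-det i)

    torus-case : ∀ {A} σ → (A , σ) ∈G → (∀ b → ⟦ proj₁ σ ⟧ (⟦ proj₁ σ ⟧ b) ≈ b) →
                 TorusClaw (proj₁ σ) (det (matrix A)) → ¬-clawFree
    torus-case {A} σ A∈ σσ t = torusClaw (proj₁ σ) t σσ leaf
      -- The centre is built as a power of the linear leaf, which puts it in G.
      (Is-resp (≈ₘ-trans (diag-^ a₀ (proj₁ power₀)) (eqs refl refl refl (proj₂ power₀))) (λ _ → refl)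
        (Is-·-linear (proj₂ leaf₀) (proj₁ power₀)))
      (proj₂ (∃-linear (upper 1#) (det-upper 1#))) (proj₂ leaf₀) (proj₂ leaf₁) (proj₂ leaf₂)
      where
      open TorusClaw t
      leaf₀ : ∃ λ x → Is x (diag a₀) id
      leaf₀ = let (d , eq) = invertible a₀ a₀≉0
                  B = fromDet (diag a₀) d (trans (*-congʳ (det-diag a₀)) eq) in
        element B Φ.ε (linear∈G B r₀ (square-root≉0 a₀≉0 a₀≈) (trans (det-diag a₀) a₀≈)) , is ≈ₘ-refl (λ _ → refl)
      semilinear : ∀ {a r} → ¬ (a ≈ 0#) → a ≈ det (matrix A) * (r * r) → ∃ λ x → Is x (diag a) ⟦ proj₁ σ ⟧
      semilinear {a} {r} a≉0 a≈ = ∃-class {A} σ A∈ (diag a) r (λ d≈0 → a≉0 (trans (sym (det-diag a)) d≈0))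
        (λ r≈0 → a≉0 (trans a≈ (trans (*-congˡ (trans (*-congʳ r≈0) (zeroˡ r))) (zeroʳ _)))) (trans (det-diag a) a≈)
      leaf₁ : ∃ λ x → Is x (diag a₁) ⟦ proj₁ σ ⟧
      leaf₁ = semilinear a₁≉0 a₁≈
      leaf₂ : ∃ λ x → Is x (diag a₂) ⟦ proj₁ σ ⟧
      leaf₂ = semilinear a₂≉0 a₂≈
      leaf : Fin 3 → Group.Carrier 𝔾
      leaf 0F = proj₁ leaf₀
      leaf 1F = proj₁ leaf₁
      leaf 2F = proj₁ leaf₂

    involutive-case : 5 ℕ.≤ p ℕ.^ n → ∀ {A} σ → (A , σ) ∈G → (∀ b → ⟦ proj₁ σ ⟧ (⟦ proj₁ σ ⟧ b) ≈ b) →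
                      ∀ {x₀} → ¬ (⟦ proj₁ σ ⟧ x₀ ≈ x₀) → ¬-clawFree
    involutive-case 5≤q {A} σ A∈ σσ {x₀} moved =
      [ even , (λ (m , p-odd) → odd m p-odd (square? (det (matrix A)))) ]′ (prime-parity pr)
      where
      j = proj₁ (frobenius-power (proj₂ σ))
      σ≈ = proj₂ (frobenius-power (proj₂ σ))
      even : p ≡ 2 → ¬-clawFree
      even p≡2 = torus-case {A} σ A∈ σσ (even-torusClaw p≡2 5≤q (proj₁ σ) j σ≈ σσ x₀ moved (det≉0 A))
      odd : ∀ m → p ≡ 1 ℕ.+ m ℕ.* 2 → Dec (Square (det (matrix A))) → ¬-clawFree
      odd m p-odd (no ¬sq) = torus-case {A} σ A∈ σσ (nonsquare-torusClaw m p-odd (proj₁ σ) j σ≈ σσ x₀ moved (det≉0 A) ¬sq)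
      odd m p-odd (yes (r , det≈)) = unipotentClaw (proj₁ σ) m p-odd σσ moved
        (λ i → proj₁ (leaf i)) (element-is GL.ε σ ε∈) (proj₂ (∃-linear (upper x₀) (det-upper x₀))) (λ i → proj₂ (leaf i))
        where
        ε∈ : (GL.ε , σ) ∈G
        ε∈ = pure∈G {A} {σ} {r} A∈ det≈
        leaf : ∀ i → ∃ λ x → Is x (unipotent i) ⟦ proj₁ σ ⟧
        leaf i = ∃-pure σ ε∈ (unipotent i) (unipotent-det i)

    -- The square of (A, σ) has square determinant, so (1, σ²) ∈ G; repeated squaring leads to an automorphism of
    -- order two or of odd order.
    descent : 5 ℕ.≤ p ℕ.^ n → ∀ l e {A} σ → (A , σ) ∈G → (∀ b → iterate ⟦ proj₁ σ ⟧ ((1 ℕ.+ l ℕ.* 2) ℕ.* 2 ℕ.^ e) b ≈ b) →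
              ∀ {x₀} → ¬ (⟦ proj₁ σ ⟧ x₀ ≈ x₀) → ¬-clawFree
    descent 5≤q l e {A} σ A∈ period moved = go e period (moved? (proj₁ (σ Φ.∙ σ)))
      where
      f = ⟦ proj₁ σ ⟧
      L = 1 ℕ.+ l ℕ.* 2
      halve : ∀ k → (∀ b → iterate f (k ℕ.* 2) b ≈ b) → ∀ b → iterate (f ∘ f) k b ≈ b
      halve k eq b = trans (reflexive (iterate-square f k b)) (eq b)
      go : ∀ e → (∀ b → iterate f (L ℕ.* 2 ℕ.^ e) b ≈ b) →
           (∃ λ x → ¬ (f (f x) ≈ x)) ⊎ (∀ x → f (f x) ≈ x) → ¬-clawFree
      -- Here σ² = 1, and A is kept: for odd p its determinant class decides between the two kinds
      -- of claw.
      go e _ (inj₂ σσ) = involutive-case 5≤q {A} σ A∈ σσ moved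
      -- σ has odd order; passing to σ² preserves the odd period and trades A for the identity
      -- matrix.
      go ℕ.zero period (inj₁ (x₁ , moved₁)) = odd-case (σ Φ.∙ σ) (square∈G {A} {σ} A∈) l
        (halve L λ b → trans (reflexive (≡.cong (λ k → iterate f k b) (ℕ.*-comm L 2)))
          (iterate-multiple f (⟦⟧-cong (proj₁ σ)) (injective (proj₁ σ)) L 2
            (trans (reflexive (≡.cong (λ k → iterate f k b) (≡.sym (ℕ.*-identityʳ L)))) (period b)))) moved₁
      go (ℕ.suc e) period (inj₁ (x₁ , moved₁)) = descent 5≤q l e (σ Φ.∙ σ) (square∈G {A} {σ} A∈)
        (halve (L ℕ.* 2 ℕ.^ e) λ b → trans (reflexive (≡.cong (λ k → iterate f k b)
          (≡.trans (ℕ.*-assoc L (2 ℕ.^ e) 2) (≡.cong (L ℕ.*_) (ℕ.*-comm (2 ℕ.^ e) 2))))) (period b)) moved₁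

    clawFree⇒linear : 5 ℕ.≤ p ℕ.^ n → ClawFree (properEnhancedPowerGraph 𝔾) → G ≤ PGL-subgroup
    clawFree⇒linear 5≤q clawFree {A , σ} A∈ = tt , λ x →
      -- Equality in F is decidable, so it is enough to refute that σ moves x.
      decidable-stable (⟦ proj₁ σ ⟧ x ≟ x) λ moved →
        let (N , period) = uniform-period ⟦ proj₁ σ ⟧ (⟦⟧-cong (proj₁ σ)) (injective (proj₁ σ))
            (l , e , N≡) = odd-part (ℕ.suc N)
        in descent 5≤q l e {A} σ A∈ (λ b → trans (reflexive (≡.cong (λ k → iterate ⟦ proj₁ σ ⟧ k b) (≡.sym N≡))) (period b))
             moved clawFree

theorem6p3 : {c ℓ s : Level} (p n : ℕ) (pr : Prime p) → 1 ℕ.≤ n → 5 ℕ.≤ p ℕ.^ n →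
    (F : FiniteField c ℓ (p ℕ.^ n)) → let open ProjectiveSemilinear n pr F in
    (G : Subgroup PΓL s) → PSL-subgroup ≤ G →
    ClawFree (properEnhancedPowerGraph (subgroupGroup PΓL G)) ⇔ (PSL-subgroup ≤ G × G ≤ PGL-subgroup)
theorem6p3 p n pr _ 5≤q F G S≤G = mk⇔
  (λ clawFree → (λ {x} → S≤G {x}) , (λ {x} → NotClawFree.clawFree⇒linear (λ {y} → S≤G {y}) 5≤q clawFree {x}))
  (λ { (_ , G≤PGL) → Linear.clawFree (λ {x} → G≤PGL {x}) })
  where
  open Theorem n pr F G
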